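{- Let $h=(1,h_1,h_2,h_3)\in\mathbb{Z}^4$. Then $h$ is the $h$-vector of a $2$-dimensional connected Buchsbaum simplicial complex if and only if the following conditions hold: (i) $0\le h_1$; (ii) $0\le h_2\le \binom{h_1+1}{2}$; (iii) $-\frac13 h_2\le h_3\le h_2^{\langle 2\rangle}$.
   Context: A simplicial complex $\Delta$ on $[n]=\{1,\dots,n\}$ is a collection of subsets of $[n]$ with $\{i\}\in\Delta$ for all $i\in[n]$ and closed under taking subsets. $f_k(\Delta)$ is the number of faces of cardinality $k+1$ ($f_{ -1}=1$), $\dim\Delta=\max\{k: f_k(\Delta)\neq 0\}$, $d=\dim\Delta+1$. The $h$-vector $(h_0,\dots,h_d)$ is defined by $\sum_{i=0}^d f_{i-1}(\Delta)(x-1)^{d-i}=\sum_{i=0}^d h_i(\Delta)x^{d-i}$. The link of a face $F$ is $\mathrm{lk}_\Delta(F)=\{G\subset[n]\setminus F: G\cup F\in\Delta\}$. Fix a field $K$ and let $\beta_i(\Delta)=\dim_K\tilde H_i(\Delta;K)$. A $(d-1)$-dimensional complex is Cohen–Macaulay if for every face $F$ (including $\emptyset$), $\beta_i(\mathrm{lk}_\Delta(F))=0$ for $i\neq d-1-|F|$. $\Delta$ is Buchsbaum if it is pure (all facets have the same cardinality) and $\mathrm{lk}_\Delta(v)$ is Cohen–Macaulay for every vertex $v$. For positive integers $a,d$, write the unique $d$-th Macaulay representation $a=\binom{a(d)+d}{d}+\binom{a(d-1)+d-1}{d-1}+\cdots+\binom{a(k)+k}{k}$ with $k\ge1$ and $a(d)\ge\cdots\ge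 a(k)\ge 0$, and set $a^{\langle d\rangle}=\binom{a(d)+d+1}{d+1}+\cdots+\binom{a(k)+k+1}{k+1}$; also $0^{\langle d\rangle}=0$. -}

module Defs where

open import Level using (Level; _⊔_) renaming (suc to lsuc)
open import Algebra.Bundles using (CommutativeRing)
open import Data.Bool using (Bool; true; false; T; not; _∧_; if_then_else_)
open import Data.Nat using (ℕ; zero; suc; _∸_; _≤_; _<ᵇ_; _≡ᵇ_; _≤ᵇ_) renaming (_+_ to _+ℕ_; _*_ to _*ℕ_)
open import Data.Nat.Combinatorics using (_C_)
open import Data.Fin using (Fin; toℕ)
open import Data.Fin.Subset using (Subset; ⁅_⁆; _∪_; _∩_; ∣_∣; _⊆_; inside; outside)
open import Data.Vec using ([]; _∷_; lookup)
open import Data.List using (List; []; _∷_; [_]; map; _++_; foldr; filter; length; allFin; upTo)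
open import Data.Integer using (ℤ; +_) renaming (_+_ to _+ℤ_; _*_ to _*ℤ_; -_ to -ℤ_)
open import Data.Product using (Σ; ∃; _×_)
open import Relation.Nullary using (¬_)
open import Relation.Binary.PropositionalEquality using (_≡_; _≢_)

record Field (c ℓ : Level) : Set (lsuc (c ⊔ ℓ)) where
  field
    commutativeRing : CommutativeRing c ℓ
  open CommutativeRing commutativeRing public
  field
    0≉1     : ¬ (0# ≈ 1#)
    inverse : ∀ x → ¬ (x ≈ 0#) → ∃ λ y → x * y ≈ 1#

Complex : ℕ → Set
Complex n = Subset n → Bool

module _ {n : ℕ} where

  IsSimplicialComplex : Complex n → Set
  IsSimplicialComplex Δ =
    (∀ (i : Fin n) → T (Δ ⁅ i ⁆)) × (∀ F G → G ⊆ F → T (Δ F) → T (Δ G))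

  disjoint : Subset n → Subset n → Bool
  disjoint G F = ∣ G ∩ F ∣ ≡ᵇ 0

  lk : Complex n → Subset n → Complex n
  lk Γ F G = disjoint G F ∧ Γ (G ∪ F)

  DimPlusOne : Complex n → ℕ → Set
  DimPlusOne Γ d = (∃ λ F → T (Γ F) × ∣ F ∣ ≡ d) × (∀ F → T (Γ F) → ∣ F ∣ ≤ d)

  Facet : Complex n → Subset n → Set
  Facet Γ F = T (Γ F) × (∀ G → T (Γ G) → F ⊆ G → F ≡ G)

  Pure : Complex n → Set
  Pure Γ = ∀ F G → Facet Γ F → Facet Γ G → ∣ F ∣ ≡ ∣ G ∣

  data Reach (Δ : Complex n) (u : Fin n) : Fin n → Set where
    here : Reach Δ u u
    step : ∀ {v w} → Reach Δ u v → T (Δ (⁅ v ⁆ ∪ ⁅ w ⁆)) → Reach Δ u w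

  Connected : Complex n → Set
  Connected Δ = ∀ u v → T (Δ ⁅ u ⁆) → T (Δ ⁅ v ⁆) → Reach Δ u v

  below : Fin n → Subset n → ℕ
  below v G = length (filter (λ u → T? (lookup G u ∧ (toℕ u <ᵇ toℕ v))) (allFin n))
    where
    open import Relation.Nullary.Decidable using (Dec; yes; no)
    T? : (b : Bool) → Dec (T b)
    T? true  = yes _
    T? false = no (λ ())

-- Reduced simplicial homology with coefficients in a field K.
-- A chain of "size" s (i.e. of degree i = s - 1) is a function on the
-- faces of cardinality s (values elsewhere are irrelevant).
-- Faces are oriented by the natural order of [n].

module Homology {c ℓ : Level} (K : Field c ℓ) where
  open Field K

  sgn : ℕ → Carrier → Carrier
  sgn zero    x = x
  sgn (suc k) x = - sgn k x

  ∂ : ∀ {n} → Complex n → (Subset n → Carrier) → Subset n → Carrier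
  ∂ {n} Γ ch G = foldr _+_ 0# (map term (allFin n))
    where
    term : Fin n → Carrier
    term v = if not (lookup G v) ∧ Γ (G ∪ ⁅ v ⁆)
             then sgn (below v G) (ch (G ∪ ⁅ v ⁆))
             else 0#

  -- β_{s-1}(Γ; K) = 0 : every (s-1)-cycle is a boundary.
  HomologyVanishes : ∀ {n} → Complex n → ℕ → Set (c ⊔ ℓ)
  HomologyVanishes {n} Γ s =
    ∀ (ch : Subset n → Carrier) →
      (∀ G → T (Γ G) → suc ∣ G ∣ ≡ s → ∂ Γ ch G ≈ 0#) →
      ∃ λ (e : Subset n → Carrier) →
        ∀ F → T (Γ F) → ∣ F ∣ ≡ s → ∂ Γ e F ≈ ch F

  -- Cohen–Macaulay: if Γ is (d-1)-dimensional, then for every face F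
  -- β_i(lk F) = 0 for all i ≠ d - 1 - |F|   (i = s - 1).
  CohenMacaulay : ∀ {n} → Complex n → Set (c ⊔ ℓ)
  CohenMacaulay {n} Γ =
    ∀ d → DimPlusOne Γ d → ∀ F → T (Γ F) →
      ∀ s → s ≢ d ∸ ∣ F ∣ → HomologyVanishes (lk Γ F) s

  Buchsbaum : ∀ {n} → Complex n → Set (c ⊔ ℓ)
  Buchsbaum {n} Δ = Pure Δ × (∀ (v : Fin n) → T (Δ ⁅ v ⁆) → CohenMacaulay (lk Δ ⁅ v ⁆))

subsets : (n : ℕ) → List (Subset n)
subsets zero    = [ [] ]
subsets (suc n) = map (inside ∷_) (subsets n) ++ map (outside ∷_) (subsets n)

faces : ∀ {n} → Complex n → ℕ → ℕ
faces {n} Δ k = length (filter (λ F → T? (Δ F ∧ (∣ F ∣ ≡ᵇ k))) (subsets n))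
  where
  open import Relation.Nullary.Decidable using (Dec; yes; no)
  T? : (b : Bool) → Dec (T b)
  T? true  = yes _
  T? false = no (λ ())

signℤ : ℕ → ℤ → ℤ
signℤ zero    x = x
signℤ (suc k) x = -ℤ signℤ k x

-- h_j = Σ_{i=0}^{j} (-1)^{j-i} C(d-i, j-i) f_{i-1}
-- (coefficient of x^{d-j} in Σ_i f_{i-1} (x-1)^{d-i})
hvec : ∀ {n} → Complex n → (d j : ℕ) → ℤ
hvec Δ d j = foldr _+ℤ_ (+ 0)
  (map (λ i → signℤ (j ∸ i) (+ (((d ∸ i) C (j ∸ i)) *ℕ faces Δ i))) (upTo (suc j)))

-- Macaulay's function a ↦ a^⟨d⟩, computed from the greedy d-th Macaulay
-- representation  a = C(m_d, d) + C(m_{d-1}, d-1) + … + C(m_k, k)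
-- (m_i = a(i) + i), where m_d is the largest m with C(m,d) ≤ a.

-- largest m ≤ B with C(m, d) ≤ a  (0 if none)
largest : (d a B : ℕ) → ℕ
largest d a zero    = zero
largest d a (suc B) with (suc B C d) ≤ᵇ a
... | true  = suc B
... | false = largest d a B

macaulayUp : (d a : ℕ) → ℕ
macaulayUp zero    a       = 0
macaulayUp (suc d) zero    = 0
macaulayUp (suc d) (suc a) =
  let m = largest (suc d) (suc a) (suc a +ℕ suc d)
  in (suc m C suc (suc d)) +ℕ macaulayUp d (suc a ∸ (m C suc d))

{-# OPTIONS --safe #-}
-- A pure two-dimensional complex is Buchsbaum, over any field, exactly when its vertex links are connected graphs, so
-- the h-vectors in question are determined by counting the edges and triangles of such complexes on n = h₁ + 3 vertices.
--
-- Necessity.  If an edge leaves a proper set of vertices S in which no vertex is isolated, then the link of its endpoint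
-- in S also has an edge leaving S, and the end of that edge has two neighbours in S.  Hence the vertices can be ordered
-- so that each of them, from the third on, has at least two earlier neighbours.  Along such an order f₁ = 2n − 3 + h₂
-- with h₂ ≥ 0, and no induced subgraph on at least two vertices has larger excess (edges − 2 · vertices + 3).  So a
-- vertex with δ + 2 earlier neighbours closes at most 1 + 2δ + min(C(δ,2), a) triangles, where a is the excess before it, and the
-- function a ↦ a^⟨2⟩ grows fast enough to absorb this.  The lower bound on h₃ is 3 f₂ ≥ 2 f₁ − f₀, the sum over the
-- vertices of the fact that a connected graph has at least as many edges as a spanning tree.
--
-- Sufficiency.  Attaching a triangle that keeps links connected may raise h₂ by one, raise h₃ by one, or add a vertex.
-- Joining vertices one by one to a complete graph, with as many of the closed triangles as desired, yields the vectors
-- with h₃ ≥ 0.  A strip of two triangles xyw, ywv between disjoint edges xy and wv with xw, yw, yv not yet present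
-- raises h₂ by three and lowers h₃ by one.  When three vertices are added to a graph, the missing edges at the new
-- vertices decompose into paths x – w – y – v of this kind, so strips can be used until fewer than three edges are
-- missing; this yields h₃ = −q with h₂ = 3q, and single edges then raise h₂ alone.

module Submission where

open import Defs
open import Algebra.Bundles using (CommutativeRing)
open import Data.Bool using (Bool; true; false; T; not; _∧_; _∨_; if_then_else_)
import Data.Bool.Properties as Boolₚ
open import Data.Empty using (⊥; ⊥-elim)
open import Data.Fin using (Fin; zero; suc; toℕ)
import Data.Fin.Properties as Finₚ
open import Data.Fin.Subset using (Subset; ⁅_⁆; _∪_; _∩_; ∣_∣; inside; outside)
  renaming (⊥ to ∅; _∈_ to _∈ₛ_; _∉_ to _∉ₛ_; _⊆_ to _⊆ₛ_)
open import Data.Fin.Subset.Properties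
  using (x∈⁅x⁆; x∈⁅y⁆⇒x≡y; ∪-comm; ∪-assoc; ∪-identityˡ; ∪-identityʳ; ∪-idem; x∈p∪q⁺; x∈p∪q⁻; x∈p∩q⁺; x∈p∩q⁻;
         ⊆-antisym; p⊆q⇒∣p∣≤∣q∣; ∣⁅x⁆∣≡1; ∣⊥∣≡0; ∣p∣≤n; Empty-unique; ∉⊥; anySubset?; drop-∷-⊆; drop-there)
  renaming (_∈?_ to _∈ₛ?_; _⊆?_ to _⊆ₛ?_; ⊥⊆ to ∅⊆)
open import Data.List using (List; []; _∷_; length; map; filter; foldr; allFin; _++_; take; drop)
open import Data.List.Membership.Propositional using (_∈_; _∉_)
open import Data.List.Membership.Propositional.Properties using (∈-allFin; ∈-++⁺ˡ; ∈-++⁺ʳ)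
open import Data.List.Membership.Propositional.Properties.WithK using (unique∧set⇒bag)
open import Data.List.Properties using (map-tabulate; length-tabulate; take++drop≡id; length-take; length-drop)
open import Data.List.Relation.Binary.BagAndSetEquality using (∼bag⇒↭)
open import Data.List.Relation.Binary.Permutation.Propositional as ↭ using (_↭_)
open import Data.List.Relation.Binary.Permutation.Propositional.Properties using (↭-length)
open import Data.List.Relation.Binary.Sublist.Propositional using ([]; _∷_; _∷ʳ_) renaming (_⊆_ to _⊑_)
import Data.List.Relation.Binary.Sublist.Propositional.Properties as Sublistₚ
open import Data.List.Relation.Unary.All as All using (All; []; _∷_)
open import Data.List.Relation.Unary.AllPairs using ([]; _∷_)
open import Data.List.Relation.Unary.Any using (here; there)
open import Data.List.Relation.Unary.Unique.Propositional using (Unique)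
import Data.List.Relation.Unary.Unique.Propositional.Properties as Uniqueₚ
open import Data.Nat
open import Data.Nat.Combinatorics using (_C_; nC1≡n; nCk+nC[k+1]≡[n+1]C[k+1])
open import Data.Nat.Properties
open import Data.Nat.Tactic.RingSolver using (solve-∀)
open import Data.Product using (Σ; ∃; ∃₂; _×_; _,_; proj₁; proj₂)
open import Data.Sum using (_⊎_; inj₁; inj₂; [_,_])
open import Data.Unit using (tt)
open import Data.Vec using ([]; _∷_; lookup; here; there)
open import Data.Vec.Properties using ([]=⇒lookup; lookup⇒[]=; ≡-dec)
open import Function using (_∘_; id; case_of_)
open import Function.Bundles using (_⇔_; mk⇔)
open import Relation.Binary.Construct.Closure.ReflexiveTransitive using (Star; ε; _◅_; _◅◅_; gmap; reverse)
open import Relation.Binary.Definitions using (DecidableEquality; tri<; tri≈; tri>)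
open import Relation.Binary.PropositionalEquality hiding ([_])
open import Relation.Nullary using (¬_; Dec; yes; no; does)
open import Relation.Nullary.Decidable using (dec-true; dec-false; _×-dec_; ¬?)
open import Relation.Unary using (Decidable)

-- Sums over subsets and over lists

-- Write h₃ as triangles - edges + vertices - 1. A vertex with `δ + 2` earlier neighbours that
-- closes `1 + 2δ + x` triangles raises h₂ by `δ` and h₃ by `δ + x`, which is what the growth of `U`
-- has to absorb. Both bounds on `x` concern the graph induced on these neighbours: it has at most
-- C(δ + 2, 2) = 1 + 2δ + C(δ, 2) edges, and its excess is at most that of all earlier vertices;
-- hence the excess is controlled on every sublist. The bound is sharp because, for h₂ = C(m, 2) + i
-- with i ≤ m, the terms C(m + 1, 3) and C(i + 1, 2) of its image under `U` are the largest h₃ on a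
-- complete graph with m + 2 vertices and the most that one more vertex with i + 2 neighbours adds.
-- For negative h₃ no missing edge may be wasted. Three vertices glued to N old ones leave 3(N - 1)
-- new missing edges, exactly the growth of C(N - 2, 2) when N becomes N + 3, and paths of three
-- edges have to cover them all. The covering uses a matching of the old vertices by edges, with a
-- triangle for one pair when N is odd, and has to return such a structure for the next round.

ind : Bool → ℕ
ind true  = 1
ind false = 0

-- The subsets of size `k` are split by Pascal's rule. For `k ≤ 3` the recursion unfolds into sums
-- over vertices, pairs and triples, which is how face counts become counts of edges and triangles.
ΣS : ∀ n → ℕ → (Subset n → ℕ) → ℕ
ΣS zero    zero    g = g []
ΣS zero    (suc k) g = 0
ΣS (suc n) zero    g = ΣS n zero (g ∘ (outside ∷_))
ΣS (suc n) (suc k) g = ΣS n k (g ∘ (inside ∷_)) + ΣS n (suc k) (g ∘ (outside ∷_))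

module _ {a} {A : Set a} where

  Σ₁ : (A → ℕ) → List A → ℕ
  Σ₁ g []       = 0
  Σ₁ g (x ∷ xs) = g x + Σ₁ g xs

  Σ₂ : (A → A → ℕ) → List A → ℕ
  Σ₂ g []       = 0
  Σ₂ g (x ∷ xs) = Σ₁ (g x) xs + Σ₂ g xs

  Σ₃ : (A → A → A → ℕ) → List A → ℕ
  Σ₃ g []       = 0
  Σ₃ g (x ∷ xs) = Σ₂ (g x) xs + Σ₃ g xs

  Σ₁-cong : ∀ {f g : A → ℕ} xs → (∀ x → f x ≡ g x) → Σ₁ f xs ≡ Σ₁ g xs
  Σ₁-cong []       eq = refl
  Σ₁-cong (x ∷ xs) eq = cong₂ _+_ (eq x) (Σ₁-cong xs eq)

  Σ₂-cong : ∀ {f g : A → A → ℕ} xs → (∀ x y → f x y ≡ g x y) → Σ₂ f xs ≡ Σ₂ g xs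
  Σ₂-cong []       eq = refl
  Σ₂-cong (x ∷ xs) eq = cong₂ _+_ (Σ₁-cong xs (eq x)) (Σ₂-cong xs eq)

module _ {a b} {A : Set a} {B : Set b} (h : B → A) where

  Σ₁-map : ∀ g xs → Σ₁ g (map h xs) ≡ Σ₁ (g ∘ h) xs
  Σ₁-map g []       = refl
  Σ₁-map g (x ∷ xs) = cong (g (h x) +_) (Σ₁-map g xs)

  Σ₂-map : ∀ g xs → Σ₂ g (map h xs) ≡ Σ₂ (λ x y → g (h x) (h y)) xs
  Σ₂-map g []       = refl
  Σ₂-map g (x ∷ xs) = cong₂ _+_ (Σ₁-map (g (h x)) xs) (Σ₂-map g xs)

  Σ₃-map : ∀ g xs → Σ₃ g (map h xs) ≡ Σ₃ (λ x y z → g (h x) (h y) (h z)) xs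
  Σ₃-map g []       = refl
  Σ₃-map g (x ∷ xs) = cong₂ _+_ (Σ₂-map (g (h x)) xs) (Σ₃-map g xs)

allFin-suc : ∀ n → allFin (suc n) ≡ zero ∷ map suc (allFin n)
allFin-suc n = cong (zero ∷_) (sym (map-tabulate id suc))

ΣS-cong : ∀ n k {f g : Subset n → ℕ} → (∀ F → ∣ F ∣ ≡ k → f F ≡ g F) → ΣS n k f ≡ ΣS n k g
ΣS-cong zero    zero    eq = eq [] refl
ΣS-cong zero    (suc k) eq = refl
ΣS-cong (suc n) zero    eq = ΣS-cong n zero (λ F p → eq _ p)
ΣS-cong (suc n) (suc k) eq =
  cong₂ _+_ (ΣS-cong n k (λ F p → eq _ (cong suc p))) (ΣS-cong n (suc k) (λ F p → eq _ p))

ΣS-+ : ∀ n k (f g : Subset n → ℕ) → ΣS n k (λ F → f F + g F) ≡ ΣS n k f + ΣS n k g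
ΣS-+ zero    zero    f g = refl
ΣS-+ zero    (suc k) f g = refl
ΣS-+ (suc n) zero    f g = ΣS-+ n zero _ _
ΣS-+ (suc n) (suc k) f g
  rewrite ΣS-+ n k (f ∘ (inside ∷_)) (g ∘ (inside ∷_))
        | ΣS-+ n (suc k) (f ∘ (outside ∷_)) (g ∘ (outside ∷_)) =
  eq (ΣS n k (f ∘ (inside ∷_))) (ΣS n k (g ∘ (inside ∷_))) (ΣS n (suc k) (f ∘ (outside ∷_))) (ΣS n (suc k) (g ∘ (outside ∷_)))
  where
  eq : ∀ a b c d → a + b + (c + d) ≡ a + c + (b + d)
  eq = solve-∀

ΣS-0 : ∀ n g → ΣS n 0 g ≡ g ∅
ΣS-0 zero    g = refl
ΣS-0 (suc n) g = ΣS-0 n _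

ΣS-1 : ∀ n g → ΣS n 1 g ≡ Σ₁ (g ∘ ⁅_⁆) (allFin n)
ΣS-1 zero    g = refl
ΣS-1 (suc n) g = begin
  ΣS n 0 (g ∘ (inside ∷_)) + ΣS n 1 (g ∘ (outside ∷_))
    ≡⟨ cong₂ _+_ (ΣS-0 n _) (ΣS-1 n _) ⟩
  g (inside ∷ ∅) + Σ₁ (λ i → g (outside ∷ ⁅ i ⁆)) (allFin n)
    ≡⟨ cong (g (inside ∷ ∅) +_) (Σ₁-map suc (g ∘ ⁅_⁆) (allFin n)) ⟨
  Σ₁ (g ∘ ⁅_⁆) (zero ∷ map suc (allFin n))
    ≡⟨ cong (Σ₁ (g ∘ ⁅_⁆)) (allFin-suc n) ⟨
  Σ₁ (g ∘ ⁅_⁆) (allFin (suc n)) ∎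
  where open ≡-Reasoning

ΣS-2 : ∀ n g → ΣS n 2 g ≡ Σ₂ (λ i j → g (⁅ i ⁆ ∪ ⁅ j ⁆)) (allFin n)
ΣS-2 zero    g = refl
ΣS-2 (suc n) g = begin
  ΣS n 1 (g ∘ (inside ∷_)) + ΣS n 2 (g ∘ (outside ∷_))
    ≡⟨ cong₂ _+_ (ΣS-1 n _) (ΣS-2 n _) ⟩
  Σ₁ (λ i → g (inside ∷ ⁅ i ⁆)) (allFin n) + Σ₂ (λ i j → g (⁅ suc i ⁆ ∪ ⁅ suc j ⁆)) (allFin n)
    ≡⟨ cong₂ _+_ (trans (Σ₁-map suc _ (allFin n)) (Σ₁-cong (allFin n) λ i → cong (g ∘ (inside ∷_)) (∪-identityˡ ⁅ i ⁆)))
                 (Σ₂-map suc _ (allFin n)) ⟨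
  Σ₂ g₂ (zero ∷ map suc (allFin n))
    ≡⟨ cong (Σ₂ g₂) (allFin-suc n) ⟨
  Σ₂ g₂ (allFin (suc n)) ∎
  where
  open ≡-Reasoning
  g₂ : Fin (suc n) → Fin (suc n) → ℕ
  g₂ i j = g (⁅ i ⁆ ∪ ⁅ j ⁆)

ΣS-3 : ∀ n g → ΣS n 3 g ≡ Σ₃ (λ i j k → g (⁅ i ⁆ ∪ (⁅ j ⁆ ∪ ⁅ k ⁆))) (allFin n)
ΣS-3 zero    g = refl
ΣS-3 (suc n) g = begin
  ΣS n 2 (g ∘ (inside ∷_)) + ΣS n 3 (g ∘ (outside ∷_))
    ≡⟨ cong₂ _+_ (ΣS-2 n _) (ΣS-3 n _) ⟩
  Σ₂ (λ i j → g (inside ∷ (⁅ i ⁆ ∪ ⁅ j ⁆))) (allFin n) + Σ₃ (λ i j k → g₃ (suc i) (suc j) (suc k)) (allFin n)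
    ≡⟨ cong₂ _+_ (trans (Σ₂-map suc _ (allFin n)) (Σ₂-cong (allFin n) λ i j → cong (g ∘ (inside ∷_)) (∪-identityˡ (⁅ i ⁆ ∪ ⁅ j ⁆))))
                 (Σ₃-map suc _ (allFin n)) ⟨
  Σ₃ g₃ (zero ∷ map suc (allFin n))
    ≡⟨ cong (Σ₃ g₃) (allFin-suc n) ⟨
  Σ₃ g₃ (allFin (suc n)) ∎
  where
  open ≡-Reasoning
  g₃ : Fin (suc n) → Fin (suc n) → Fin (suc n) → ℕ
  g₃ i j k = g (⁅ i ⁆ ∪ (⁅ j ⁆ ∪ ⁅ k ⁆))

does-T : ∀ b (d : Dec (T b)) → does d ≡ b
does-T true  (yes _) = refl
does-T true  (no ¬p) = ⊥-elim (¬p tt)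
does-T false (no _)  = refl

length-filter : ∀ {a} {A : Set a} (b : A → Bool) (P? : Decidable (T ∘ b)) →
  ∀ xs → length (filter P? xs) ≡ Σ₁ (ind ∘ b) xs
length-filter b P? []       = refl
length-filter b P? (x ∷ xs) with does (P? x) | does-T (b x) (P? x)
... | true  | p rewrite sym p = cong suc (length-filter b P? xs)
... | false | p rewrite sym p = length-filter b P? xs

Σ₁-++ : ∀ {a} {A : Set a} (g : A → ℕ) xs ys → Σ₁ g (xs ++ ys) ≡ Σ₁ g xs + Σ₁ g ys
Σ₁-++ g []       ys = refl
Σ₁-++ g (x ∷ xs) ys = trans (cong (g x +_) (Σ₁-++ g xs ys)) (sym (+-assoc (g x) _ _))

Σ₁-zero : ∀ {a} {A : Set a} (g : A → ℕ) xs → (∀ x → g x ≡ 0) → Σ₁ g xs ≡ 0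
Σ₁-zero g []       eq = refl
Σ₁-zero g (x ∷ xs) eq = cong₂ _+_ (eq x) (Σ₁-zero g xs eq)

sized : ∀ {n} → (Subset n → Bool) → ℕ → Subset n → ℕ
sized Γ k F = ind (Γ F ∧ (∣ F ∣ ≡ᵇ k))

Σ₁-subsets : ∀ n k (Γ : Subset n → Bool) → Σ₁ (sized Γ k) (subsets n) ≡ ΣS n k (ind ∘ Γ)
Σ₁-subsets zero    zero    Γ = trans (+-identityʳ _) (cong ind (Boolₚ.∧-identityʳ (Γ [])))
Σ₁-subsets zero    (suc k) Γ = trans (+-identityʳ _) (cong ind (Boolₚ.∧-zeroʳ (Γ [])))
Σ₁-subsets (suc n) zero    Γ
  rewrite Σ₁-++ (sized Γ 0) (map (inside ∷_) (subsets n)) (map (outside ∷_) (subsets n))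
        | Σ₁-map (inside ∷_) (sized Γ 0) (subsets n)
        | Σ₁-map (outside ∷_) (sized Γ 0) (subsets n)
        | Σ₁-zero (λ F → sized Γ 0 (inside ∷ F)) (subsets n) (λ F → cong ind (Boolₚ.∧-zeroʳ (Γ (inside ∷ F)))) =
  Σ₁-subsets n zero (Γ ∘ (outside ∷_))
Σ₁-subsets (suc n) (suc k) Γ
  rewrite Σ₁-++ (sized Γ (suc k)) (map (inside ∷_) (subsets n)) (map (outside ∷_) (subsets n))
        | Σ₁-map (inside ∷_) (sized Γ (suc k)) (subsets n)
        | Σ₁-map (outside ∷_) (sized Γ (suc k)) (subsets n) =
  cong₂ _+_ (Σ₁-subsets n k (Γ ∘ (inside ∷_))) (Σ₁-subsets n (suc k) (Γ ∘ (outside ∷_)))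

faces-ΣS : ∀ {n} (Δ : Complex n) k → faces Δ k ≡ ΣS n k (ind ∘ Δ)
faces-ΣS {n} Δ k =
  trans (length-filter (λ F → Δ F ∧ (∣ F ∣ ≡ᵇ k)) _ (subsets n))
        (Σ₁-subsets n k Δ)

-- Macaulay's function

-- C(n, 2), that is, the triangular numbers shifted by one; likewise `tet n` is C(n, 3).
tri : ℕ → ℕ
tri zero    = 0
tri (suc n) = n + tri n

tet : ℕ → ℕ
tet zero    = 0
tet (suc n) = tri n + tet n

C2≡tri : ∀ n → n C 2 ≡ tri n
C2≡tri zero    = refl
C2≡tri (suc n) = trans (sym (nCk+nC[k+1]≡[n+1]C[k+1] n 1)) (cong₂ _+_ (nC1≡n n) (C2≡tri n))

C3≡tet : ∀ n → n C 3 ≡ tet n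
C3≡tet zero    = refl
C3≡tet (suc n) = trans (sym (nCk+nC[k+1]≡[n+1]C[k+1] n 2)) (cong₂ _+_ (C2≡tri n) (C3≡tet n))

tri-+ : ∀ m n → tri (m + n) ≡ tri m + tri n + m * n
tri-+ zero    n = sym (+-identityʳ _)
tri-+ (suc m) n rewrite tri-+ m n = eq m n (tri m) (tri n)
  where
  eq : ∀ m n x y → m + n + (x + y + m * n) ≡ m + x + y + (n + m * n)
  eq = solve-∀

tri-mono : ∀ {m n} → m ≤ n → tri m ≤ tri n
tri-mono z≤n     = z≤n
tri-mono (s≤s p) = +-mono-≤ p (tri-mono p)

n≤1+tri : ∀ n → n ≤ suc (tri n)
n≤1+tri zero    = z≤n
n≤1+tri (suc n) = s≤s (m≤m+n n (tri n))

largest-≡ : ∀ d a m B → m ≤ B → m C d ≤ a → (∀ j → m < j → a < j C d) → largest d a B ≡ m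
largest-≡ d a m zero    m≤B _  _  = sym (n≤0⇒n≡0 m≤B)
largest-≡ d a m (suc B) m≤B lo hi with (suc B C d) ≤ᵇ a in eq
... | true with m≤n⇒m<n∨m≡n m≤B
...   | inj₁ m<B = ⊥-elim (<⇒≱ (hi (suc B) m<B) (≤ᵇ⇒≤ _ _ (subst T (sym eq) tt)))
...   | inj₂ m≡B = sym m≡B
largest-≡ d a m (suc B) m≤B lo hi | false with m≤n⇒m<n∨m≡n m≤B
...   | inj₁ (s≤s m≤B′) = largest-≡ d a m B m≤B′ lo hi
...   | inj₂ refl       = ⊥-elim (subst T eq (≤⇒≤ᵇ lo))

macaulayUp-1 : ∀ r → macaulayUp 1 r ≡ tri (suc r)
macaulayUp-1 zero = refl
macaulayUp-1 (suc r)
  rewrite largest-≡ 1 (suc r) (suc r) (suc r + 1) (m≤m+n _ 1) (≤-reflexive (nC1≡n (suc r)))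
            (λ j lt → subst (suc r <_) (sym (nC1≡n j)) lt) =
  trans (+-identityʳ _) (C2≡tri (suc (suc r)))

U : ℕ → ℕ
U = macaulayUp 2

U-tri< : ∀ m i → i < m → U (tri m + i) ≡ tet (suc m) + tri (suc i)
U-tri< m i i<m = go (tri m + i) refl
  where
  go : ∀ a → a ≡ tri m + i → U a ≡ tet (suc m) + tri (suc i)
  go zero eq = zeros m i i<m eq
    where
    zeros : ∀ m i → i < m → 0 ≡ tri m + i → 0 ≡ tet (suc m) + tri (suc i)
    zeros zero          i       ()
    zeros (suc zero)    zero    i<m eq = refl
    zeros (suc zero)    (suc i) (s≤s ()) eq
    zeros (suc (suc m)) i       i<m ()
  go (suc a) eq
    rewrite largest-≡ 2 (suc a) m (suc a + 2)
      (≤-trans (n≤1+tri m) (≤-trans (s≤s (≤-trans (m≤m+n (tri m) i) (≤-reflexive (sym eq))))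
        (subst (suc (suc a) ≤_) (sym (+-suc (suc a) 1)) (s≤s (m≤m+n (suc a) 1)))))
      (subst (_≤ suc a) (sym (C2≡tri m)) (subst (tri m ≤_) (sym eq) (m≤m+n (tri m) i)))
      (λ j m<j → subst (suc a <_) (sym (C2≡tri j)) (≤-trans (s≤s (≤-reflexive eq))
        (≤-trans (≤-trans (≤-reflexive (sym (+-suc (tri m) i))) (≤-trans (+-monoʳ-≤ (tri m) i<m)
          (≤-reflexive (+-comm (tri m) m)))) (tri-mono m<j))))
      | C3≡tet (suc m) | C2≡tri m | eq | m+n∸m≡n (tri m) i | macaulayUp-1 i = refl

-- At `i = m` the representation is not the greedy one, since `tri m + m` is `tri (suc m) + 0`.
-- Pascal's rule gives the same value, so both ends of a block obey one formula.
U-tri : ∀ m i → i ≤ m → U (tri m + i) ≡ tet (suc m) + tri (suc i)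
U-tri m i i≤m with m≤n⇒m<n∨m≡n i≤m
... | inj₁ i<m  = U-tri< m i i<m
... | inj₂ refl = begin
  U (tri i + i)                       ≡⟨ cong U (trans (+-comm (tri i) i) (sym (+-identityʳ _))) ⟩
  U (tri (suc i) + 0)                 ≡⟨ U-tri< (suc i) 0 (s≤s z≤n) ⟩
  tri (suc i) + tet (suc i) + 0       ≡⟨ +-identityʳ _ ⟩
  tri (suc i) + tet (suc i)           ≡⟨ +-comm (tri (suc i)) _ ⟩
  tet (suc i) + tri (suc i)           ∎
  where open ≡-Reasoning

-- The remainder is taken in 1 ... m instead of 0 ... m - 1. When a complex is built from this
-- decomposition, the last vertex then always has at least three neighbours to be joined to.
decompose : ∀ a → ∃₂ λ m i → i < m × suc a ≡ tri m + suc i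
decompose zero = 1 , 0 , s≤s z≤n , refl
decompose (suc a) with decompose a
... | m , i , i<m , eq with m≤n⇒m<n∨m≡n i<m
...   | inj₁ si<m = m , suc i , si<m , trans (cong suc eq) (sym (+-suc (tri m) (suc i)))
...   | inj₂ refl = suc m , 0 , s≤s z≤n ,
        trans (cong suc eq) (trans (sym (+-comm (tri m + m) 1)) (cong (_+ 1) (+-comm (tri m) m)))

decompose′ : ∀ a → ∃₂ λ m i → i ≤ m × a ≡ tri m + i
decompose′ zero    = 0 , 0 , z≤n , refl
decompose′ (suc a) with decompose a
... | m , i , i<m , eq = m , suc i , i<m , eq

U-suc : ∀ a → suc (U a) ≤ U (suc a)
U-suc a with decompose′ a
... | m , i , i≤m , refl with m≤n⇒m<n∨m≡n i≤m
...   | inj₁ i<m = begin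
  suc (U (tri m + i))                 ≡⟨ cong suc (U-tri m i i≤m) ⟩
  suc (tet (suc m) + tri (suc i))     ≡⟨ +-suc (tet (suc m)) (tri (suc i)) ⟨
  tet (suc m) + suc (tri (suc i))     ≤⟨ +-monoʳ-≤ (tet (suc m)) (s≤s (m≤n+m _ i)) ⟩
  tet (suc m) + tri (suc (suc i))     ≡⟨ U-tri m (suc i) i<m ⟨
  U (tri m + suc i)                   ≡⟨ cong U (+-suc (tri m) i) ⟩
  U (suc (tri m + i))                 ∎
  where open ≤-Reasoning
...   | inj₂ refl = begin
  suc (U (tri m + m))                 ≡⟨ cong suc (U-tri m m i≤m) ⟩
  suc (tet (suc m) + tri (suc m))     ≡⟨ trans (cong suc (+-comm (tet (suc m)) _)) (sym (+-comm _ 1)) ⟩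
  tri (suc m) + tet (suc m) + 1       ≡⟨⟩
  tet (suc (suc m)) + tri 2           ≡⟨ U-tri (suc m) 1 (s≤s z≤n) ⟨
  U (tri (suc m) + 1)                 ≡⟨ cong U (trans (+-comm (tri (suc m)) 1) (cong suc (+-comm m (tri m)))) ⟩
  U (suc (tri m + m))                 ∎
  where open ≤-Reasoning

U-+ : ∀ a r → U a + r ≤ U (a + r)
U-+ a zero    = ≤-reflexive (trans (+-identityʳ (U a)) (cong U (sym (+-identityʳ a))))
U-+ a (suc r) = begin
  U a + suc r     ≡⟨ +-suc (U a) r ⟩
  suc (U a + r)   ≤⟨ s≤s (U-+ a r) ⟩
  suc (U (a + r)) ≤⟨ U-suc (a + r) ⟩
  U (suc (a + r)) ≡⟨ cong U (+-suc a r) ⟨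
  U (a + suc r)   ∎
  where open ≤-Reasoning

-- The increments of U run through 1; 1, 2; 1, 2, 3; … . The window of δ of them starting at a stays in one block,
-- or it ends in the next block at or before the position where it began, or it reaches further.
U-window : ∀ a δ x → x ≤ tri δ → x ≤ a → U a + δ + x ≤ U (a + δ)
U-window a δ x x≤tri x≤a with decompose′ a
... | m , i , i≤m , refl with i + δ ≤? m
...   | yes i+δ≤m = begin
  U (tri m + i) + δ + x              ≡⟨ cong (λ u → u + δ + x) (U-tri m i i≤m) ⟩
  tet (suc m) + (i + tri i) + δ + x  ≤⟨ +-monoʳ-≤ (tet (suc m) + (i + tri i) + δ) (≤-trans x≤tri (m≤m+n _ (i * δ))) ⟩
  tet (suc m) + (i + tri i) + δ + (tri δ + i * δ)
    ≡⟨ eq (tet (suc m)) i δ (tri i) (tri δ) ⟩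
  tet (suc m) + (i + δ + (tri i + tri δ + i * δ))
    ≡⟨ cong (λ u → tet (suc m) + (i + δ + u)) (tri-+ i δ) ⟨
  tet (suc m) + tri (suc (i + δ))    ≡⟨ U-tri m (i + δ) i+δ≤m ⟨
  U (tri m + (i + δ))                ≡⟨ cong U (+-assoc (tri m) i δ) ⟨
  U (tri m + i + δ)                  ∎
  where
  open ≤-Reasoning
  eq : ∀ t i d x y → t + (i + x) + d + (y + i * d) ≡ t + (i + d + (x + y + i * d))
  eq = solve-∀
-- Here `p = m − i` increments complete the current block, and `δ′ = δ − p` of them lie beyond it.
...   | no i+δ≰m with m≤n⇒∃[o]m+o≡n i≤m | m≤n⇒∃[o]m+o≡n (≰⇒≥ i+δ≰m)
...     | p , refl | δ′ , i+p+δ′≡i+δ with +-cancelˡ-≡ i (p + δ′) δ (trans (sym (+-assoc i p δ′)) i+p+δ′≡i+δ)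
...       | refl with δ′ ≤? i
-- The cross term `p * δ′` of `tri (p + δ′)` is at most `p * i`, which is the cross term of
-- `tri (i + p)` in the value at the new block.
...         | yes δ′≤i = begin
  U (tri (i + p) + i) + (p + δ′) + x
    ≡⟨ cong (λ u → u + (p + δ′) + x) (U-tri (i + p) i i≤m) ⟩
  tet (suc (i + p)) + (i + tri i) + (p + δ′) + x
    ≤⟨ +-monoʳ-≤ (tet (suc (i + p)) + (i + tri i) + (p + δ′)) x≤tri ⟩
  tet (suc (i + p)) + (i + tri i) + (p + δ′) + tri (p + δ′)
    ≡⟨ cong (tet (suc (i + p)) + (i + tri i) + (p + δ′) +_) (tri-+ p δ′) ⟩
  tet (suc (i + p)) + (i + tri i) + (p + δ′) + (tri p + tri δ′ + p * δ′)
    ≤⟨ +-monoʳ-≤ (tet (suc (i + p)) + (i + tri i) + (p + δ′)) (+-monoʳ-≤ (tri p + tri δ′) (*-monoʳ-≤ p δ′≤i)) ⟩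
  tet (suc (i + p)) + (i + tri i) + (p + δ′) + (tri p + tri δ′ + p * i)
    ≡⟨ eq (tet (suc (i + p))) i p δ′ (tri i) (tri p) (tri δ′) ⟩
  i + p + (tri i + tri p + i * p) + tet (suc (i + p)) + (δ′ + tri δ′)
    ≡⟨ cong (λ u → i + p + u + tet (suc (i + p)) + (δ′ + tri δ′)) (tri-+ i p) ⟨
  tet (suc (suc (i + p))) + tri (suc δ′)
    ≡⟨ U-tri (suc (i + p)) δ′ (≤-trans δ′≤i (≤-trans i≤m (n≤1+n _))) ⟨
  U (tri (suc (i + p)) + δ′)
    ≡⟨ cong U (eq′ i p δ′ (tri (i + p))) ⟩
  U (tri (i + p) + i + (p + δ′)) ∎
  where
  open ≤-Reasoning
  eq : ∀ t i p d x y z → t + (i + x) + (p + d) + (y + z + p * i) ≡ i + p + (x + y + i * p) + t + (d + z)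
  eq = solve-∀
  eq′ : ∀ i p d x → i + p + x + d ≡ x + i + (p + d)
  eq′ = solve-∀
-- Now `x ≤ a` takes over: after `suc i` steps into the next block the value already pays for
-- `x = a` with equality, and each of the `r` remaining steps adds at least one.
...         | no δ′≰i with m≤n⇒∃[o]m+o≡n (≰⇒> δ′≰i)
...           | r , refl = begin
  U (tri (i + p) + i) + (p + (suc i + r)) + x
    ≡⟨ cong (λ u → u + (p + (suc i + r)) + x) (U-tri (i + p) i i≤m) ⟩
  tet (suc (i + p)) + (i + tri i) + (p + (suc i + r)) + x
    ≤⟨ +-monoʳ-≤ (tet (suc (i + p)) + (i + tri i) + (p + (suc i + r))) x≤a ⟩
  tet (suc (i + p)) + (i + tri i) + (p + (suc i + r)) + (tri (i + p) + i)
    ≡⟨ eq (tet (suc (i + p))) i p r (tri i) (tri (i + p)) ⟩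
  tet (suc (suc (i + p))) + tri (suc (suc i)) + r
    ≡⟨ cong (_+ r) (U-tri (suc (i + p)) (suc i) (s≤s i≤m)) ⟨
  U (tri (suc (i + p)) + suc i) + r
    ≤⟨ U-+ (tri (suc (i + p)) + suc i) r ⟩
  U (tri (suc (i + p)) + suc i + r)
    ≡⟨ cong U (eq′ i p r (tri (i + p))) ⟩
  U (tri (i + p) + i + (p + (suc i + r))) ∎
  where
  open ≤-Reasoning
  eq : ∀ t i p r x y → t + (i + x) + (p + (suc i + r)) + (y + i) ≡ i + p + y + t + (suc i + (i + x)) + r
  eq = solve-∀
  eq′ : ∀ i p r x → i + p + x + suc i + r ≡ x + i + (p + (suc i + r))
  eq′ = solve-∀

-- Symmetric counting functions

ind≤1 : ∀ b → ind b ≤ 1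
ind≤1 true  = ≤-refl
ind≤1 false = z≤n

module _ {a} {A : Set a} where

  Σ₁-↭ : ∀ (g : A → ℕ) {xs ys} → xs ↭ ys → Σ₁ g xs ≡ Σ₁ g ys
  Σ₁-↭ g ↭.refl         = refl
  Σ₁-↭ g (↭.prep x p)   = cong (g x +_) (Σ₁-↭ g p)
  Σ₁-↭ g (↭.swap {xs} x y p) = trans (eq (g x) (g y) (Σ₁ g xs)) (cong (λ u → g y + (g x + u)) (Σ₁-↭ g p))
    where
    eq : ∀ a b c → a + (b + c) ≡ b + (a + c)
    eq = solve-∀
  Σ₁-↭ g (↭.trans p q)  = trans (Σ₁-↭ g p) (Σ₁-↭ g q)

  Σ₂-↭ : ∀ (g : A → A → ℕ) → (∀ x y → g x y ≡ g y x) → ∀ {xs ys} → xs ↭ ys → Σ₂ g xs ≡ Σ₂ g ys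
  Σ₂-↭ g s ↭.refl        = refl
  Σ₂-↭ g s (↭.prep x p)  = cong₂ _+_ (Σ₁-↭ (g x) p) (Σ₂-↭ g s p)
  Σ₂-↭ g s (↭.swap {xs} {ys} x y p)
    rewrite Σ₁-↭ (g x) p | Σ₁-↭ (g y) p | Σ₂-↭ g s p | s x y =
    eq (g y x) (Σ₁ (g x) ys) (Σ₁ (g y) ys) (Σ₂ g ys)
    where
    eq : ∀ a b c d → a + b + (c + d) ≡ a + c + (b + d)
    eq = solve-∀
  Σ₂-↭ g s (↭.trans p q) = trans (Σ₂-↭ g s p) (Σ₂-↭ g s q)

  Σ₃-↭ : ∀ (g : A → A → A → ℕ) → (∀ x y z → g x y z ≡ g y x z) → (∀ x y z → g x y z ≡ g x z y) →
         ∀ {xs ys} → xs ↭ ys → Σ₃ g xs ≡ Σ₃ g ys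
  Σ₃-↭ g s s′ ↭.refl        = refl
  Σ₃-↭ g s s′ (↭.prep x p)  = cong₂ _+_ (Σ₂-↭ (g x) (s′ x) p) (Σ₃-↭ g s s′ p)
  Σ₃-↭ g s s′ (↭.swap {xs} {ys} x y p)
    rewrite Σ₁-↭ (g x y) p | Σ₂-↭ (g x) (s′ x) p | Σ₂-↭ (g y) (s′ y) p | Σ₃-↭ g s s′ p
          | Σ₁-cong ys (s x y) =
    eq (Σ₁ (g y x) ys) (Σ₂ (g x) ys) (Σ₂ (g y) ys) (Σ₃ g ys)
    where
    eq : ∀ a b c d → a + b + (c + d) ≡ a + c + (b + d)
    eq = solve-∀
  Σ₃-↭ g s s′ (↭.trans p q) = trans (Σ₃-↭ g s s′ p) (Σ₃-↭ g s s′ q)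

  Σ₁-+ : ∀ (f g : A → ℕ) xs → Σ₁ (λ x → f x + g x) xs ≡ Σ₁ f xs + Σ₁ g xs
  Σ₁-+ f g []       = refl
  Σ₁-+ f g (x ∷ xs) rewrite Σ₁-+ f g xs = eq (f x) (g x) (Σ₁ f xs) (Σ₁ g xs)
    where
    eq : ∀ a b c d → a + b + (c + d) ≡ a + c + (b + d)
    eq = solve-∀

  Σ₁-Σ₁ : ∀ (g : A → A → ℕ) → (∀ x y → g x y ≡ g y x) → (∀ x → g x x ≡ 0) → ∀ xs →
          Σ₁ (λ x → Σ₁ (g x) xs) xs ≡ 2 * Σ₂ g xs
  Σ₁-Σ₁ g s z []       = refl
  Σ₁-Σ₁ g s z (x ∷ xs)
    rewrite z x | Σ₁-+ (λ y → g y x) (λ y → Σ₁ (g y) xs) xs | Σ₁-Σ₁ g s z xs | Σ₁-cong xs (λ y → s y x) =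
    eq (Σ₁ (g x) xs) (Σ₂ g xs)
    where
    eq : ∀ a b → a + (a + 2 * b) ≡ 2 * (a + b)
    eq = solve-∀

  -- The handshake identity one dimension up: a triple is met once from each of its three members.
  -- Vanishing at `g x x y` is enough, because the symmetries move any repetition to the front.
  Σ₁-Σ₂ : ∀ (g : A → A → A → ℕ) → (∀ x y z → g x y z ≡ g y x z) → (∀ x y z → g x y z ≡ g x z y) →
          (∀ x y → g x x y ≡ 0) → ∀ xs → Σ₁ (λ x → Σ₂ (g x) xs) xs ≡ 3 * Σ₃ g xs
  Σ₁-Σ₂ g s s′ z []       = refl
  Σ₁-Σ₂ g s s′ z (x ∷ xs)
    rewrite Σ₁-zero (g x x) xs (z x) | Σ₁-+ (λ y → Σ₁ (g y x) xs) (λ y → Σ₂ (g y) xs) xs | Σ₁-Σ₂ g s s′ z xs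
          | Σ₁-cong xs (λ y → Σ₁-cong xs (s y x))
          | Σ₁-Σ₁ (g x) (s′ x) (λ y → trans (s x y y) (trans (s′ y x y) (z y x))) xs =
    eq (Σ₂ (g x) xs) (Σ₃ g xs)
    where
    eq : ∀ a b → a + (2 * a + 3 * b) ≡ 3 * (a + b)
    eq = solve-∀

  Σ₁-mono : ∀ {f g : A → ℕ} xs → (∀ x → f x ≤ g x) → Σ₁ f xs ≤ Σ₁ g xs
  Σ₁-mono []       le = z≤n
  Σ₁-mono (x ∷ xs) le = +-mono-≤ (le x) (Σ₁-mono xs le)

  Σ₁-strict : ∀ {f g : A → ℕ} {y} xs → (∀ x → f x ≤ g x) → y ∈ xs → f y < g y → Σ₁ f xs < Σ₁ g xs
  Σ₁-strict (x ∷ xs) le (here refl) lt = +-mono-<-≤ lt (Σ₁-mono xs le)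
  Σ₁-strict (x ∷ xs) le (there p)   lt = +-mono-≤-< (le x) (Σ₁-strict xs le p lt)

  Σ₁-∈ : ∀ (g : A → ℕ) {y} xs → y ∈ xs → g y ≤ Σ₁ g xs
  Σ₁-∈ g (x ∷ xs) (here refl) = m≤m+n _ _
  Σ₁-∈ g (x ∷ xs) (there p)   = ≤-trans (Σ₁-∈ g xs p) (m≤n+m _ (g x))

  Σ₁-⊑ : ∀ (g : A → ℕ) {xs ys} → xs ⊑ ys → Σ₁ g xs ≤ Σ₁ g ys
  Σ₁-⊑ g []         = z≤n
  Σ₁-⊑ g (y ∷ʳ p)   = ≤-trans (Σ₁-⊑ g p) (m≤n+m _ (g y))
  Σ₁-⊑ g (refl ∷ p) = +-monoʳ-≤ _ (Σ₁-⊑ g p)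

  Σ₂-⊑ : ∀ (g : A → A → ℕ) {xs ys} → xs ⊑ ys → Σ₂ g xs ≤ Σ₂ g ys
  Σ₂-⊑ g []               = z≤n
  Σ₂-⊑ g (y ∷ʳ p)         = ≤-trans (Σ₂-⊑ g p) (m≤n+m _ _)
  Σ₂-⊑ g (_∷_ {x} refl p) = +-mono-≤ (Σ₁-⊑ (g x) p) (Σ₂-⊑ g p)

  Σ₁-ind≤length : ∀ (b : A → Bool) xs → Σ₁ (ind ∘ b) xs ≤ length xs
  Σ₁-ind≤length b []       = z≤n
  Σ₁-ind≤length b (x ∷ xs) = +-mono-≤ (ind≤1 (b x)) (Σ₁-ind≤length b xs)

  Σ₂-ind≤tri : ∀ (b : A → A → Bool) xs → Σ₂ (λ x y → ind (b x y)) xs ≤ tri (length xs)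
  Σ₂-ind≤tri b []       = z≤n
  Σ₂-ind≤tri b (x ∷ xs) = +-mono-≤ (Σ₁-ind≤length (b x) xs) (Σ₂-ind≤tri b xs)

  sub : (A → Bool) → List A → List A
  sub b []       = []
  sub b (x ∷ xs) with b x
  ... | true  = x ∷ sub b xs
  ... | false = sub b xs

  sub-⊑ : ∀ b xs → sub b xs ⊑ xs
  sub-⊑ b []       = []
  sub-⊑ b (x ∷ xs) with b x
  ... | true  = refl ∷ sub-⊑ b xs
  ... | false = x ∷ʳ sub-⊑ b xs

  length-sub : ∀ b xs → length (sub b xs) ≡ Σ₁ (ind ∘ b) xs
  length-sub b []       = refl
  length-sub b (x ∷ xs) with b x
  ... | true  = cong suc (length-sub b xs)
  ... | false = length-sub b xs

  ∈-sub⁺ : ∀ b {y} xs → y ∈ xs → b y ≡ true → y ∈ sub b xs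
  ∈-sub⁺ b (x ∷ xs) (here refl) eq rewrite eq = here refl
  ∈-sub⁺ b (x ∷ xs) (there p)   eq with b x
  ... | true  = there (∈-sub⁺ b xs p eq)
  ... | false = ∈-sub⁺ b xs p eq

  ∈-sub⁻ : ∀ b {y} xs → y ∈ sub b xs → b y ≡ true
  ∈-sub⁻ b (x ∷ xs) p with b x in eq
  ∈-sub⁻ b (x ∷ xs) (here refl) | true  = eq
  ∈-sub⁻ b (x ∷ xs) (there p)   | true  = ∈-sub⁻ b xs p
  ∈-sub⁻ b (x ∷ xs) p           | false = ∈-sub⁻ b xs p

  sub-Unique : ∀ b {xs} → Unique xs → Unique (sub b xs)
  sub-Unique b []                     = []
  sub-Unique b (_∷_ {x} {xs} x∉ u) with b x
  ... | true  = Sublistₚ.All-resp-⊆ (sub-⊑ b xs) x∉ ∷ sub-Unique b u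
  ... | false = sub-Unique b u

  -- Every pair counted on the left lies in the neighbourhood cut out by b.
  Σ₂-sub : ∀ (b : A → Bool) (f g : A → A → Bool) →
    (∀ x y → f x y ≡ true → b x ≡ true × b y ≡ true × g x y ≡ true) → ∀ xs →
    Σ₂ (λ x y → ind (f x y)) xs ≤ Σ₂ (λ x y → ind (g x y)) (sub b xs)
  Σ₂-sub b f g h []       = z≤n
  Σ₂-sub b f g h (x ∷ xs) with b x in eq
  ... | true  = +-mono-≤ (row xs) (Σ₂-sub b f g h xs)
    where
    row : ∀ ys → Σ₁ (λ y → ind (f x y)) ys ≤ Σ₁ (λ y → ind (g x y)) (sub b ys)
    row []       = z≤n
    row (y ∷ ys) with b y in eqy | f x y in eqf
    ... | true  | true  rewrite proj₂ (proj₂ (h x y eqf)) = s≤s (row ys)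
    ... | true  | false = ≤-trans (row ys) (m≤n+m _ _)
    ... | false | false = row ys
    ... | false | true  with () ← trans (sym eqy) (proj₁ (proj₂ (h x y eqf)))
  ... | false = ≤-trans (≤-reflexive (cong (_+ Σ₂ (λ x y → ind (f x y)) xs) (Σ₁-zero _ xs none))) (Σ₂-sub b f g h xs)
    where
    none : ∀ y → ind (f x y) ≡ 0
    none y with f x y in eqf
    ... | false = refl
    ... | true  with () ← trans (sym eq) (proj₁ (h x y eqf))

-- Lists grown one element at a time

module Growth {a} {A : Set a} (_≟_ : DecidableEquality A) where

  open import Data.List.Membership.DecPropositional _≟_ using (_∈?_)

  mem : List A → A → Bool
  mem xs x = does (x ∈? xs)

  mem⁺ : ∀ {x xs} → x ∈ xs → mem xs x ≡ true
  mem⁺ {x} {xs} p = dec-true (x ∈? xs) p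

  mem⁻ : ∀ {x xs} → mem xs x ≡ true → x ∈ xs
  mem⁻ {x} {xs} eq with x ∈? xs
  ... | yes p = p

  nmem⁺ : ∀ {x xs} → x ∉ xs → mem xs x ≡ false
  nmem⁺ {x} {xs} p = dec-false (x ∈? xs) p

  nmem⁻ : ∀ {x xs} → mem xs x ≡ false → x ∉ xs
  nmem⁻ {x} {xs} eq p with () ← trans (sym eq) (mem⁺ p)

  missing : List A → A → ℕ
  missing xs x = ind (not (mem xs x))

  missing-∷ : ∀ x xs y → missing (x ∷ xs) y ≤ missing xs y
  missing-∷ x xs y = weaken (does (y ≟ x)) (mem xs y)
    where
    weaken : ∀ b c → ind (not (b ∨ c)) ≤ ind (not c)
    weaken true  c = z≤n
    weaken false c = ≤-refl

  missing-here : ∀ x xs → x ∉ xs → missing (x ∷ xs) x < missing xs x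
  missing-here x xs x∉ =
    subst₂ _<_ (cong (ind ∘ not) (sym (mem⁺ {x} {x ∷ xs} (here refl)))) (cong (ind ∘ not) (sym (nmem⁺ x∉))) (s≤s z≤n)

  outsider : ∀ xs zs → ¬ All (_∈ xs) zs → ∃ λ y → y ∈ zs × y ∉ xs
  outsider xs []       ¬all = ⊥-elim (¬all [])
  outsider xs (z ∷ zs) ¬all with z ∈? xs
  ... | no z∉  = z , here refl , z∉
  ... | yes z∈ with outsider xs zs (¬all ∘ (z∈ ∷_))
  ...   | y , y∈ , y∉ = y , there y∈ , y∉

  -- The element `y` only witnesses that a target is still absent; the step itself chooses which
  -- target `x` to add. The number of absent targets drops each time and bounds the recursion.
  -- Spanning trees of links and the vertex order of the whole graph are both obtained this way.
  grow : ∀ {p} (P : List A → Set p) (targets : List A) →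
    (∀ xs → P xs → ∀ y → y ∈ targets → y ∉ xs → ∃ λ x → x ∉ xs × x ∈ targets × P (x ∷ xs)) →
    ∀ xs → P xs → ∃ λ ys → P ys × (∀ {y} → y ∈ targets → y ∈ ys)
  grow P targets advance xs Pxs = go (suc (Σ₁ (missing xs) targets)) xs ≤-refl Pxs
    where
    go : ∀ fuel xs → Σ₁ (missing xs) targets < fuel → P xs → ∃ λ ys → P ys × (∀ {y} → y ∈ targets → y ∈ ys)
    go (suc fuel) xs (s≤s le) Pxs with All.all? (_∈? xs) targets
    ... | yes all = xs , Pxs , λ y∈ → All.lookup all y∈
    ... | no ¬all with outsider xs targets ¬all
    ...   | y , y∈ , y∉ with advance xs Pxs y y∈ y∉
    ...     | x , x∉ , x∈ , Px =
      go fuel (x ∷ xs) (≤-trans (Σ₁-strict targets (missing-∷ x xs) x∈ (missing-here x xs x∉)) le) Px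

  same-elements : ∀ {xs ys : List A} → Unique xs → Unique ys →
    (∀ {x} → x ∈ xs → x ∈ ys) → (∀ {x} → x ∈ ys → x ∈ xs) → xs ↭ ys
  same-elements u v f g = ∼bag⇒↭ (unique∧set⇒bag u v (mk⇔ f g))

∉⇒Unique : ∀ {a} {A : Set a} {x : A} {xs} → x ∉ xs → Unique xs → Unique (x ∷ xs)
∉⇒Unique x∉ u = All.tabulate (λ y∈ x≡y → x∉ (subst (_∈ _) (sym x≡y) y∈)) ∷ u

-- Graphs with connected links

-- Connectedness enters as a cut property: every two-colouring that uses both colours is crossed by
-- an edge. Growing a list asks for exactly this, and for links it is what the vanishing of homology
-- yields directly.
module Necessity
  {A : Set} (_≟_ : DecidableEquality A) (all : List A) (all! : Unique all) (complete : ∀ x → x ∈ all)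
  (E : A → A → Bool) (Tr : A → A → A → Bool)
  (E-sym : ∀ x y → E x y ≡ E y x) (E-irr : ∀ x → E x x ≡ false)
  (Tr-sym : ∀ x y z → Tr x y z ≡ Tr y x z) (Tr-sym′ : ∀ x y z → Tr x y z ≡ Tr x z y)
  (Tr⇒E : ∀ x y z → Tr x y z ≡ true → E x y ≡ true)
  (crossing : ∀ (S : A → Bool) u w → S u ≡ true → S w ≡ false →
    ∃₂ λ u′ w′ → S u′ ≡ true × S w′ ≡ false × E u′ w′ ≡ true)
  (link-crossing : ∀ v (S : A → Bool) x y → E v x ≡ true → E v y ≡ true → S x ≡ true → S y ≡ false →
    ∃₂ λ x′ y′ → S x′ ≡ true × S y′ ≡ false × Tr v x′ y′ ≡ true)
  (u₀ w₀ : A) (u₀w₀ : E u₀ w₀ ≡ true)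
  where

  open Growth _≟_

  e : List A → ℕ
  e = Σ₂ (λ x y → ind (E x y))

  t : List A → ℕ
  t = Σ₃ (λ x y z → ind (Tr x y z))

  deg : A → List A → ℕ
  deg x = Σ₁ (λ y → ind (E x y))

  Tr-irr : ∀ x y → Tr x x y ≡ false
  Tr-irr x y with Tr x x y in eq
  ... | false = refl
  ... | true  = trans (sym (Tr⇒E x x y eq)) (E-irr x)

  Tr⇒E₂ : ∀ x y z → Tr x y z ≡ true → E x z ≡ true
  Tr⇒E₂ x y z p = Tr⇒E x z y (trans (Tr-sym′ x z y) p)

  Tr⇒E₃ : ∀ x y z → Tr x y z ≡ true → E y z ≡ true
  Tr⇒E₃ x y z p = Tr⇒E₂ y x z (trans (Tr-sym y x z) p)

  ind-true : ∀ {b} → b ≡ true → ind b ≡ 1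
  ind-true refl = refl

  true-∈ : ∀ (b : A → Bool) {y} xs → y ∈ xs → b y ≡ true → 1 ≤ Σ₁ (ind ∘ b) xs
  true-∈ b xs y∈ eq = ≤-trans (≤-reflexive (sym (ind-true eq))) (Σ₁-∈ (ind ∘ b) xs y∈)

  two-∈ : ∀ (b : A → Bool) {x y} xs → x ∈ xs → y ∈ xs → x ≢ y → b x ≡ true → b y ≡ true → 2 ≤ Σ₁ (ind ∘ b) xs
  two-∈ b (z ∷ xs) (here refl) (here refl) x≢y _ _ = ⊥-elim (x≢y refl)
  two-∈ b (z ∷ xs) (here refl) (there y∈)  _ bx by = +-mono-≤ (≤-reflexive (sym (ind-true bx))) (true-∈ b xs y∈ by)
  two-∈ b (z ∷ xs) (there x∈)  (here refl) _ bx by = +-mono-≤ (≤-reflexive (sym (ind-true by))) (true-∈ b xs x∈ bx)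
  two-∈ b (z ∷ xs) (there x∈)  (there y∈)  x≢y bx by = ≤-trans (two-∈ b xs x∈ y∈ x≢y bx by) (m≤n+m _ _)

  edges≤ : e all ≤ tri (length all)
  edges≤ = Σ₂-ind≤tri E all

  link-edges : A → ℕ
  link-edges v = Σ₂ (λ x y → ind (Tr v x y)) all

  -- A spanning tree of the link is grown from one neighbour `c`: each further neighbour comes with
  -- a link edge to an earlier one. Keeping `c` in the list ensures that every cut has a neighbour
  -- of `v` on its inner side.
  link-bound : ∀ v → deg v all ≤ link-edges v + 1
  link-bound v with sub (E v) all in eq
  ... | [] = ≤-trans (≤-reflexive (trans (sym (length-sub (E v) all)) (cong length eq))) z≤n
  ... | c ∷ _ with grow P (sub (E v) all) advance (c ∷ []) (([] ∷ []) , (λ { (here refl) → c∈ }) , here refl , s≤s z≤n)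
    where
    nbrs : List A
    nbrs = sub (E v) all
    c∈ : c ∈ nbrs
    c∈ = subst (c ∈_) (sym eq) (here refl)
    P : List A → Set
    P ws = Unique ws × (∀ {x} → x ∈ ws → x ∈ nbrs) × c ∈ ws × length ws ≤ Σ₂ (λ x y → ind (Tr v x y)) ws + 1
    advance : ∀ xs → P xs → ∀ y → y ∈ nbrs → y ∉ xs → ∃ λ x → x ∉ xs × x ∈ nbrs × P (x ∷ xs)
    advance xs (u , ⊆nbrs , c∈xs , le) y y∈ y∉
      with link-crossing v (mem xs) c y (∈-sub⁻ (E v) all c∈) (∈-sub⁻ (E v) all y∈) (mem⁺ c∈xs) (nmem⁺ y∉)
    ... | x , x′ , Sx , Sx′ , vxx′ =
      x′ , nmem⁻ Sx′ , x′∈ , ∉⇒Unique (nmem⁻ Sx′) u , (λ { (here refl) → x′∈ ; (there p) → ⊆nbrs p }) , there c∈xs ,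
      ≤-trans (+-mono-≤ (true-∈ (Tr v x′) xs (mem⁻ Sx) (trans (Tr-sym′ v x′ x) vxx′)) le)
              (≤-reflexive (sym (+-assoc (Σ₁ (ind ∘ Tr v x′) xs) _ 1)))
      where
      x′∈ : x′ ∈ nbrs
      x′∈ = ∈-sub⁺ (E v) all (complete x′) (Tr⇒E₂ v x x′ vxx′)
  ... | ws , (u , ⊆nbrs , _ , le) , nbrs⊆ = begin
    deg v all                                          ≡⟨ length-sub (E v) all ⟨
    length (sub (E v) all)                             ≡⟨ ↭-length perm ⟨
    length ws                                          ≤⟨ le ⟩
    Σ₂ (λ x y → ind (Tr v x y)) ws + 1                 ≡⟨ cong (_+ 1) (Σ₂-↭ _ (λ x y → cong ind (Tr-sym′ v x y)) perm) ⟩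
    Σ₂ (λ x y → ind (Tr v x y)) (sub (E v) all) + 1    ≤⟨ +-monoˡ-≤ 1 (Σ₂-⊑ _ (sub-⊑ (E v) all)) ⟩
    link-edges v + 1                                   ∎
    where
    open ≤-Reasoning
    perm : ws ↭ sub (E v) all
    perm = same-elements u (sub-Unique (E v) all!) ⊆nbrs nbrs⊆

  Σ₁-one : ∀ (f : A → ℕ) xs → Σ₁ (λ x → f x + 1) xs ≡ Σ₁ f xs + length xs
  Σ₁-one f []       = refl
  Σ₁-one f (x ∷ xs) rewrite Σ₁-one f xs = eq (f x) (Σ₁ f xs) (length xs)
    where
    eq : ∀ a b c → a + 1 + (b + c) ≡ a + b + suc c
    eq = solve-∀

  edges≤triangles : 2 * e all ≤ 3 * t all + length all
  edges≤triangles = begin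
    2 * e all                       ≡⟨ Σ₁-Σ₁ _ (λ x y → cong ind (E-sym x y)) (λ x → cong ind (E-irr x)) all ⟨
    Σ₁ (λ v → deg v all) all        ≤⟨ Σ₁-mono all link-bound ⟩
    Σ₁ (λ v → link-edges v + 1) all ≡⟨ Σ₁-one link-edges all ⟩
    Σ₁ link-edges all + length all  ≡⟨ cong (_+ length all) (Σ₁-Σ₂ _ (λ x y z → cong ind (Tr-sym x y z))
                                         (λ x y z → cong ind (Tr-sym′ x y z)) (λ x y → cong ind (Tr-irr x y)) all) ⟩
    3 * t all + length all          ∎
    where open ≤-Reasoning

  -- `a` is the excess of the graph induced on `xs`, its h₂. As h₃ equals triangles + 2 - vertices -
  -- `a`, the field `triangles` says that h₃ is at most `U a`. `no-isolated` is what moves an edge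
  -- leaving `xs` into the link of its inner end.
  record Built (xs : List A) : Set where
    field
      a          : ℕ
      unique     : Unique xs
      long       : 2 ≤ length xs
      no-isolated : ∀ {x} → x ∈ xs → ∃ λ y → y ∈ xs × E x y ≡ true
      edges      : e xs + 3 ≡ 2 * length xs + a
      sublists   : ∀ {ys} → ys ⊑ xs → 2 ≤ length ys → e ys + 3 ≤ 2 * length ys + a
      triangles  : t xs + 2 ≤ length xs + a + U a

  extend : ∀ {x xs} → x ∉ xs → 2 ≤ deg x xs → Built xs → Built (x ∷ xs)
  extend {x} {xs} x∉ 2≤deg b with m≤n⇒∃[o]m+o≡n 2≤deg
  ... | δ , deg≡ = record
    { a = a + δ
    ; unique = ∉⇒Unique x∉ unique
    ; long = ≤-trans long (n≤1+n _)
    ; no-isolated = no-iso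
    ; edges = trans (cong (λ u → u + e xs + 3) (sym deg≡)) (trans (+-assoc (2 + δ) (e xs) 3)
                (trans (cong (2 + δ +_) edges) (eq₁ δ (length xs) a)))
    ; sublists = sublists′
    ; triangles = triangles′
    }
    where
    open Built b
    eq₁ : ∀ d l a → 2 + d + (2 * l + a) ≡ 2 * suc l + (a + d)
    eq₁ = solve-∀
    no-iso : ∀ {y} → y ∈ x ∷ xs → ∃ λ z → z ∈ x ∷ xs × E y z ≡ true
    no-iso (there y∈) with no-isolated y∈
    ... | z , z∈ , yz = z , there z∈ , yz
    no-iso (here refl) with sub (E x) xs in eq
    ... | [] with () ← trans deg≡ (trans (sym (length-sub (E x) xs)) (cong length eq))
    ... | z ∷ _ = z , there (Sublistₚ.Any-resp-⊆ (sub-⊑ (E x) xs) z∈) , ∈-sub⁻ (E x) xs z∈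
      where
      z∈ : z ∈ sub (E x) xs
      z∈ = subst (z ∈_) (sym eq) (here refl)
    sublists′ : ∀ {ys} → ys ⊑ x ∷ xs → 2 ≤ length ys → e ys + 3 ≤ 2 * length ys + (a + δ)
    sublists′ {ys} (_ ∷ʳ p) le = ≤-trans (sublists p le) (+-monoʳ-≤ (2 * length ys) (m≤m+n a δ))
    sublists′ {_ ∷ []} (refl ∷ p) (s≤s ())
    -- The tail is too short for the earlier bound; a single edge gives at most 1 + 3 = 2 · 2.
    sublists′ {_ ∷ y ∷ []} (refl ∷ p) le = 
      ≤-trans (≤-reflexive (cong (_+ 3) (trans (+-identityʳ _) (+-identityʳ _))))
        (≤-trans (+-monoˡ-≤ 3 (ind≤1 (E x y))) (m≤m+n 4 (a + δ)))
    sublists′ {_ ∷ ys@(_ ∷ _ ∷ _)} (refl ∷ p) le = begin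
      deg x ys + e ys + 3               ≡⟨ +-assoc (deg x ys) (e ys) 3 ⟩
      deg x ys + (e ys + 3)             ≤⟨ +-mono-≤ (Σ₁-⊑ _ p) (sublists p (s≤s (s≤s z≤n))) ⟩
      deg x xs + (2 * length ys + a)    ≡⟨ cong (_+ (2 * length ys + a)) deg≡ ⟨
      2 + δ + (2 * length ys + a)       ≡⟨ eq₁ δ (length ys) a ⟩
      2 * suc (length ys) + (a + δ)     ∎
      where open ≤-Reasoning
    nbrs : List A
    nbrs = sub (E x) xs
    len : length nbrs ≡ 2 + δ
    len = trans (length-sub (E x) xs) (sym deg≡)
    -- On `δ + 2` vertices, `1 + 2 * δ` edges amount to excess zero. What goes beyond is at most
    -- `tri δ`, reached by a complete graph, and at most `a`, by the bound on sublists.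
    excess : ℕ
    excess = e nbrs ∸ (1 + 2 * δ)
    excess≤tri : excess ≤ tri δ
    excess≤tri = ≤-trans (∸-monoˡ-≤ (1 + 2 * δ) (Σ₂-ind≤tri E nbrs))
      (≤-reflexive (trans (cong (_∸ (1 + 2 * δ)) (trans (cong tri len) (eq δ (tri δ)))) (m+n∸m≡n (1 + 2 * δ) (tri δ))))
      where
      eq : ∀ d y → suc d + (d + y) ≡ 1 + 2 * d + y
      eq = solve-∀
    excess≤a : excess ≤ a
    excess≤a = ≤-trans (∸-monoˡ-≤ (1 + 2 * δ) (+-cancelʳ-≤ 3 (e nbrs) (1 + 2 * δ + a)
        (≤-trans (sublists (sub-⊑ (E x) xs) (subst (2 ≤_) (sym len) (s≤s (s≤s z≤n))))
                 (≤-reflexive (trans (cong (λ l → 2 * l + a) len) (eq δ a))))))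
      (≤-reflexive (m+n∸m≡n (1 + 2 * δ) a))
      where
      eq : ∀ d a → 2 * (2 + d) + a ≡ 1 + 2 * d + a + 3
      eq = solve-∀
    triangles′ : t (x ∷ xs) + 2 ≤ length (x ∷ xs) + (a + δ) + U (a + δ)
    triangles′ = begin
      Σ₂ (λ y z → ind (Tr x y z)) xs + t xs + 2
        ≡⟨ +-assoc (Σ₂ (λ y z → ind (Tr x y z)) xs) (t xs) 2 ⟩
      Σ₂ (λ y z → ind (Tr x y z)) xs + (t xs + 2)
        ≤⟨ +-mono-≤ (Σ₂-sub (E x) (Tr x) E (λ y z p → Tr⇒E x y z p , Tr⇒E₂ x y z p , Tr⇒E₃ x y z p) xs) triangles ⟩
      e nbrs + (length xs + a + U a)
        ≤⟨ +-monoˡ-≤ (length xs + a + U a) (m≤n+m∸n (e nbrs) (1 + 2 * δ)) ⟩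
      1 + 2 * δ + excess + (length xs + a + U a)
        ≡⟨ eq δ excess (length xs) a (U a) ⟩
      suc (length xs) + (a + δ) + (U a + δ + excess)
        ≤⟨ +-monoʳ-≤ (suc (length xs) + (a + δ)) (U-window a δ excess excess≤tri excess≤a) ⟩
      suc (length xs) + (a + δ) + U (a + δ) ∎
      where
      open ≤-Reasoning
      eq : ∀ d x l a u → 1 + 2 * d + x + (l + a + u) ≡ suc l + (a + d) + (u + d + x)
      eq = solve-∀

  E⇒≢ : ∀ {x y} → E x y ≡ true → x ≢ y
  E⇒≢ {x} p refl with () ← trans (sym p) (E-irr x)

  built : ∃ λ xs → Built xs × (∀ {y} → y ∈ all → y ∈ xs)
  built = grow Built all advance (u₀ ∷ w₀ ∷ []) record
    { a = 0
    ; unique = (E⇒≢ u₀w₀ ∷ []) ∷ [] ∷ []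
    ; long = ≤-refl
    ; no-isolated = λ { (here refl) → w₀ , there (here refl) , u₀w₀
                      ; (there (here refl)) → u₀ , here refl , trans (E-sym w₀ u₀) u₀w₀ }
    ; edges = cong (λ b → ind b + 0 + 0 + 3) u₀w₀
    ; sublists = λ { (_ ∷ʳ _ ∷ʳ []) () ; (_ ∷ʳ refl ∷ []) (s≤s ()) ; (refl ∷ _ ∷ʳ []) (s≤s ())
                   ; (refl ∷ refl ∷ []) _ → ≤-reflexive (cong (λ b → ind b + 0 + 0 + 3) u₀w₀) }
    ; triangles = ≤-refl
    }
    where
    advance : ∀ xs → Built xs → ∀ y → y ∈ all → y ∉ xs → ∃ λ x → x ∉ xs × x ∈ all × Built (x ∷ xs)
    advance [] b y _ _ with () ← Built.long b
    advance xs@(x₀ ∷ _) b y _ y∉ with crossing (mem xs) x₀ y (mem⁺ {x₀} {xs} (here refl)) (nmem⁺ y∉)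
    ... | u , w , Su , Sw , uw with Built.no-isolated b (mem⁻ Su)
    ...   | s , s∈ , us with link-crossing u (mem xs) s w us uw (mem⁺ s∈) Sw
    ...     | s′ , w′ , Ss′ , Sw′ , us′w′ = w′ , w′∉ , complete w′ , extend w′∉
              (two-∈ (E w′) xs (mem⁻ Su) (mem⁻ Ss′) (E⇒≢ (Tr⇒E u s′ w′ us′w′))
                (trans (E-sym w′ u) (Tr⇒E₂ u s′ w′ us′w′)) (trans (E-sym w′ s′) (Tr⇒E₃ u s′ w′ us′w′))) b
      where
      w′∉ : w′ ∉ xs
      w′∉ = nmem⁻ Sw′

  h-bounds : ∃ λ a → e all + 3 ≡ 2 * length all + a × t all + 2 ≤ length all + a + U a
  h-bounds with built
  ... | xs , b , all⊆ = a ,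
        subst₂ (λ x y → x + 3 ≡ 2 * y + a) (Σ₂-↭ _ (λ x y → cong ind (E-sym x y)) perm) (↭-length perm) edges ,
        subst₂ (λ x y → x + 2 ≤ y + a + U a)
          (Σ₃-↭ _ (λ x y z → cong ind (Tr-sym x y z)) (λ x y z → cong ind (Tr-sym′ x y z)) perm) (↭-length perm) triangles
    where
    open Built b
    perm : xs ↭ all
    perm = same-elements unique all! (λ {x} _ → complete x) all⊆

-- Homology of graphs

T-∧⁻ : ∀ {a b} → T (a ∧ b) → T a × T b
T-∧⁻ {true} p = tt , p

T-∧⁺ : ∀ {a b} → T a → T b → T (a ∧ b)
T-∧⁺ {true} _ q = q

T⇒≡ : ∀ {b} → T b → b ≡ true
T⇒≡ {true} _ = refl

≡⇒T : ∀ {b} → b ≡ true → T b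
≡⇒T refl = tt

¬T⇒≡ : ∀ {b} → ¬ T b → b ≡ false
¬T⇒≡ {true}  ¬p = ⊥-elim (¬p tt)
¬T⇒≡ {false} _  = refl

module _ {n : ℕ} where

  ∉⇒lookup : ∀ {i : Fin n} {F} → i ∉ₛ F → lookup F i ≡ false
  ∉⇒lookup {i} {F} i∉ with lookup F i in eq
  ... | false = refl
  ... | true  = ⊥-elim (i∉ (lookup⇒[]= i F eq))

  ⁅⁆⊆ : ∀ {i : Fin n} {F} → i ∈ₛ F → ⁅ i ⁆ ⊆ₛ F
  ⁅⁆⊆ {i} i∈ j∈ rewrite x∈⁅y⁆⇒x≡y i j∈ = i∈

  ∪⊆ : ∀ {F G H : Subset n} → F ⊆ₛ H → G ⊆ₛ H → F ∪ G ⊆ₛ H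
  ∪⊆ {F} {G} p q x∈ with x∈p∪q⁻ F G x∈
  ... | inj₁ x∈F = p x∈F
  ... | inj₂ x∈G = q x∈G

  ⊆∪ˡ : ∀ {F G H : Subset n} → F ⊆ₛ G → F ⊆ₛ G ∪ H
  ⊆∪ˡ p x∈ = x∈p∪q⁺ (inj₁ (p x∈))

  ⊆∪ʳ : ∀ {F G H : Subset n} → F ⊆ₛ H → F ⊆ₛ G ∪ H
  ⊆∪ʳ {F} {G} p x∈ = x∈p∪q⁺ {p = G} (inj₂ (p x∈))

  ∪-absorb : ∀ {i : Fin n} {F} → i ∈ₛ F → ⁅ i ⁆ ∪ F ≡ F
  ∪-absorb i∈ = ⊆-antisym (∪⊆ (⁅⁆⊆ i∈) (λ z → z)) (⊆∪ʳ (λ z → z))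

  ≢⇒∉⁅⁆ : ∀ {i j : Fin n} → i ≢ j → i ∉ₛ ⁅ j ⁆
  ≢⇒∉⁅⁆ {j = j} i≢j i∈ = i≢j (x∈⁅y⁆⇒x≡y j i∈)

  ∣∣≡0⇒∅ : ∀ {F : Subset n} → ∣ F ∣ ≡ 0 → F ≡ ∅
  ∣∣≡0⇒∅ {F} eq = Empty-unique λ (i , i∈) →
    <⇒≱ (≤-trans (≤-reflexive (sym (∣⁅x⁆∣≡1 i))) (p⊆q⇒∣p∣≤∣q∣ (⁅⁆⊆ i∈))) (≤-reflexive eq)

∣⁅⁆∪∣ : ∀ {n} {i : Fin n} {F} → i ∉ₛ F → ∣ ⁅ i ⁆ ∪ F ∣ ≡ suc ∣ F ∣
∣⁅⁆∪∣ {i = zero}  {true  ∷ F} i∉ = ⊥-elim (i∉ here)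
∣⁅⁆∪∣ {i = zero}  {false ∷ F} i∉ = cong (suc ∘ ∣_∣) (∪-identityˡ F)
∣⁅⁆∪∣ {i = suc i} {true  ∷ F} i∉ = cong suc (∣⁅⁆∪∣ (i∉ ∘ there))
∣⁅⁆∪∣ {i = suc i} {false ∷ F} i∉ = ∣⁅⁆∪∣ (i∉ ∘ there)

∣∣≡1⇒⁅⁆ : ∀ {n} {F : Subset n} → ∣ F ∣ ≡ 1 → ∃ λ i → F ≡ ⁅ i ⁆
∣∣≡1⇒⁅⁆ {F = true  ∷ F} eq = zero , cong (inside ∷_) (∣∣≡0⇒∅ (suc-injective eq))
∣∣≡1⇒⁅⁆ {F = false ∷ F} eq with ∣∣≡1⇒⁅⁆ {F = F} eq
... | i , refl = suc i , refl

module _ {n : ℕ} where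

  ∣pair∣ : ∀ {i j : Fin n} → i ≢ j → ∣ ⁅ i ⁆ ∪ ⁅ j ⁆ ∣ ≡ 2
  ∣pair∣ {i} {j} i≢j = trans (∣⁅⁆∪∣ (≢⇒∉⁅⁆ i≢j)) (cong suc (∣⁅x⁆∣≡1 j))

  disjoint⁻ : ∀ {F G : Subset n} {i} → T (disjoint F G) → i ∈ₛ F → i ∉ₛ G
  disjoint⁻ {F} {G} d i∈F i∈G = ∉⊥ (subst (_ ∈ₛ_) (∣∣≡0⇒∅ (≡ᵇ⇒≡ _ 0 d)) (x∈p∩q⁺ (i∈F , i∈G)))

  disjoint⁺ : ∀ {F G : Subset n} → (∀ {i} → i ∈ₛ F → i ∉ₛ G) → T (disjoint F G)
  disjoint⁺ {F} {G} h = ≡⇒≡ᵇ _ 0 (trans (cong ∣_∣ (Empty-unique {p = F ∩ G} λ (i , i∈) →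
    h (proj₁ (x∈p∩q⁻ F G i∈)) (proj₂ (x∈p∩q⁻ F G i∈)))) (∣⊥∣≡0 n))

Σ₁-single : ∀ {a} {A : Set a} (f : A → ℕ) {x} xs → Unique xs → x ∈ xs → (∀ y → y ≢ x → f y ≡ 0) → Σ₁ f xs ≡ f x
Σ₁-single f {x} (_ ∷ xs) (x∉ ∷ u) (here refl) z = trans (cong (f x +_) (rest xs x∉)) (+-identityʳ _)
  where
  rest : ∀ ys → All (x ≢_) ys → Σ₁ f ys ≡ 0
  rest []       []       = refl
  rest (y ∷ ys) (p ∷ ps) = cong₂ _+_ (z y (p ∘ sym)) (rest ys ps)
Σ₁-single f (y ∷ xs) (y∉ ∷ u) (there x∈) z =
  cong₂ _+_ (z y (All.lookup y∉ x∈)) (Σ₁-single f xs u x∈ z)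

module _ {n : ℕ} where

  below-Σ : ∀ (v : Fin n) G → below v G ≡ Σ₁ (λ u → ind (lookup G u ∧ (toℕ u <ᵇ toℕ v))) (allFin n)
  below-Σ v G = length-filter (λ u → lookup G u ∧ (toℕ u <ᵇ toℕ v)) _ (allFin n)

  below-∅ : ∀ (v : Fin n) → below v ∅ ≡ 0
  below-∅ v = trans (below-Σ v ∅) (Σ₁-zero _ (allFin n)
    (λ u → cong (λ b → ind (b ∧ (toℕ u <ᵇ toℕ v))) (∉⇒lookup {i = u} {F = ∅} ∉⊥)))

  below-⁅⁆ : ∀ (v w : Fin n) → below v ⁅ w ⁆ ≡ ind (toℕ w <ᵇ toℕ v)
  below-⁅⁆ v w = trans (below-Σ v ⁅ w ⁆)
    (trans (Σ₁-single _ (allFin n) (Uniqueₚ.allFin⁺ n) (∈-allFin w)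
             (λ u u≢w → cong (λ b → ind (b ∧ (toℕ u <ᵇ toℕ v))) (∉⇒lookup (≢⇒∉⁅⁆ u≢w))))
           (cong (λ b → ind (b ∧ (toℕ w <ᵇ toℕ v))) ([]=⇒lookup (x∈⁅x⁆ w))))

  -- Seen from its two ends, an edge has opposite incidence signs. Nothing else about the vertex
  -- order enters the homology computations.
  below-≶ : ∀ {v w : Fin n} → v ≢ w →
    (below v ⁅ w ⁆ ≡ 0 × below w ⁅ v ⁆ ≡ 1) ⊎ (below v ⁅ w ⁆ ≡ 1 × below w ⁅ v ⁆ ≡ 0)
  below-≶ {v} {w} v≢w with <-cmp (toℕ v) (toℕ w)
  ... | tri< v<w _ w≮v = inj₁ (trans (below-⁅⁆ v w) (cong ind (¬T⇒≡ (w≮v ∘ <ᵇ⇒< _ _))) ,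
                               trans (below-⁅⁆ w v) (cong ind (T⇒≡ (<⇒<ᵇ v<w))))
  ... | tri≈ _ v≡w _   = ⊥-elim (v≢w (Finₚ.toℕ-injective v≡w))
  ... | tri> v≮w _ w<v = inj₂ (trans (below-⁅⁆ v w) (cong ind (T⇒≡ (<⇒<ᵇ w<v))) ,
                               trans (below-⁅⁆ w v) (cong ind (¬T⇒≡ (v≮w ∘ <ᵇ⇒< _ _))))

-- Chains in degrees -1, 0 and 1

module Chains {c ℓ} (K : Field c ℓ) where

  open Field K
    using (Carrier; _≈_; 0#; 1#; -_; 0≉1; commutativeRing)
    renaming (_+_ to _⊕_; _*_ to _⊗_; refl to ≈-refl; sym to ≈-sym; trans to ≈-trans; reflexive to ≈-reflexive;
              +-cong to ⊕-cong; +-congˡ to ⊕-congˡ; +-congʳ to ⊕-congʳ; +-assoc to ⊕-assoc; +-comm to ⊕-comm;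
              +-identityˡ to ⊕-identityˡ; +-identityʳ to ⊕-identityʳ; -‿cong to ⊖-cong;
              -‿inverseˡ to ⊖-inverseˡ; -‿inverseʳ to ⊖-inverseʳ)
  open Homology K
  open import Algebra.Bundles using (CommutativeRing)
  open import Algebra.Properties.Ring (CommutativeRing.ring commutativeRing)
    using (-0#≈0#; -‿involutive; -‿+-comm)
  open import Algebra.Properties.CommutativeSemigroup
    (CommutativeRing.+-commutativeSemigroup commutativeRing) using (interchange)
  open import Relation.Binary.Reasoning.Setoid (CommutativeRing.setoid commutativeRing)

  sum : ∀ {a} {A : Set a} → (A → Carrier) → List A → Carrier
  sum f xs = foldr _⊕_ 0# (map f xs)

  module _ {a} {A : Set a} where

    sum-cong : ∀ {f g : A → Carrier} xs → (∀ x → f x ≈ g x) → sum f xs ≈ sum g xs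
    sum-cong []       eq = ≈-refl
    sum-cong (x ∷ xs) eq = ⊕-cong (eq x) (sum-cong xs eq)

    sum-zero : ∀ {f : A → Carrier} xs → (∀ x → f x ≈ 0#) → sum f xs ≈ 0#
    sum-zero []       eq = ≈-refl
    sum-zero (x ∷ xs) eq = ≈-trans (⊕-cong (eq x) (sum-zero xs eq)) (⊕-identityˡ 0#)

    sum-⊕ : ∀ (f g : A → Carrier) xs → sum (λ x → f x ⊕ g x) xs ≈ sum f xs ⊕ sum g xs
    sum-⊕ f g []       = ≈-sym (⊕-identityˡ 0#)
    sum-⊕ f g (x ∷ xs) = ≈-trans (⊕-congˡ (sum-⊕ f g xs)) (interchange _ _ _ _)

    sum-⊖ : ∀ (f : A → Carrier) xs → sum (λ x → - f x) xs ≈ - sum f xs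
    sum-⊖ f []       = ≈-sym -0#≈0#
    sum-⊖ f (x ∷ xs) = ≈-trans (⊕-congˡ (sum-⊖ f xs)) (-‿+-comm _ _)

    sum-single : ∀ (f : A → Carrier) {x} xs → Unique xs → x ∈ xs → (∀ y → y ≢ x → f y ≈ 0#) → sum f xs ≈ f x
    sum-single f {x} (_ ∷ xs) (x∉ ∷ u) (here refl) z = ≈-trans (⊕-congˡ (rest xs x∉)) (⊕-identityʳ _)
      where
      rest : ∀ ys → All (x ≢_) ys → sum f ys ≈ 0#
      rest []       []       = ≈-refl
      rest (y ∷ ys) (p ∷ ps) = ≈-trans (⊕-cong (z y (p ∘ sym)) (rest ys ps)) (⊕-identityˡ 0#)
    sum-single f (y ∷ xs) (y∉ ∷ u) (there x∈) z =
      ≈-trans (⊕-cong (z y (All.lookup y∉ x∈)) (sum-single f xs u x∈ z)) (⊕-identityˡ _)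

    -- The diagonal is treated separately because antisymmetry says nothing about it in characteristic 2.
    sum-antisym : ∀ (M : A → A → Carrier) → (∀ x → M x x ≈ 0#) → (∀ x y → M x y ⊕ M y x ≈ 0#) → ∀ xs →
      sum (λ x → sum (M x) xs) xs ≈ 0#
    sum-antisym M diag anti []       = ≈-refl
    sum-antisym M diag anti (x ∷ xs) = begin
      (M x x ⊕ sum (M x) xs) ⊕ sum (λ y → M y x ⊕ sum (M y) xs) xs
        ≈⟨ ⊕-cong (≈-trans (⊕-congʳ (diag x)) (⊕-identityˡ _)) (sum-⊕ (λ y → M y x) (λ y → sum (M y) xs) xs) ⟩
      sum (M x) xs ⊕ (sum (λ y → M y x) xs ⊕ sum (λ y → sum (M y) xs) xs)
        ≈⟨ ⊕-assoc _ _ _ ⟨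
      (sum (M x) xs ⊕ sum (λ y → M y x) xs) ⊕ sum (λ y → sum (M y) xs) xs
        ≈⟨ ⊕-cong (≈-trans (≈-sym (sum-⊕ (M x) (λ y → M y x) xs)) (sum-zero xs (anti x))) (sum-antisym M diag anti xs) ⟩
      0# ⊕ 0#
        ≈⟨ ⊕-identityˡ 0# ⟩
      0# ∎

  sgn-cong : ∀ k {x y} → x ≈ y → sgn k x ≈ sgn k y
  sgn-cong zero    p = p
  sgn-cong (suc k) p = ⊖-cong (sgn-cong k p)

  sgn-⊕ : ∀ k x y → sgn k (x ⊕ y) ≈ sgn k x ⊕ sgn k y
  sgn-⊕ zero    x y = ≈-refl
  sgn-⊕ (suc k) x y = ≈-trans (⊖-cong (sgn-⊕ k x y)) (≈-sym (-‿+-comm _ _))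

  sgn-0 : ∀ k → sgn k 0# ≈ 0#
  sgn-0 zero    = ≈-refl
  sgn-0 (suc k) = ≈-trans (⊖-cong (sgn-0 k)) -0#≈0#

  if-cong : ∀ b {x y z} → (T b → x ≈ y) → (if b then x else z) ≈ (if b then y else z)
  if-cong true  p = p tt
  if-cong false p = ≈-refl

  if-0 : ∀ b {x} → (T b → x ≈ 0#) → (if b then x else 0#) ≈ 0#
  if-0 true  p = p tt
  if-0 false p = ≈-refl

  if-⊕ : ∀ b {x y} → (if b then x ⊕ y else 0#) ≈ (if b then x else 0#) ⊕ (if b then y else 0#)
  if-⊕ true  = ≈-refl
  if-⊕ false = ≈-sym (⊕-identityˡ 0#)

  module _ {n : ℕ} (Γ : Complex n) where

    ∂-term : (Subset n → Carrier) → Subset n → Fin n → Carrier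
    ∂-term ch G v = if not (lookup G v) ∧ Γ (G ∪ ⁅ v ⁆) then sgn (below v G) (ch (G ∪ ⁅ v ⁆)) else 0#

    ∂-⊕ : ∀ ch ch′ G → ∂ Γ (λ F → ch F ⊕ ch′ F) G ≈ ∂ Γ ch G ⊕ ∂ Γ ch′ G
    ∂-⊕ ch ch′ G = ≈-trans
      (sum-cong {g = λ v → ∂-term ch G v ⊕ ∂-term ch′ G v} (allFin n) λ v →
        ≈-trans (if-cong (not (lookup G v) ∧ Γ (G ∪ ⁅ v ⁆)) (λ _ → sgn-⊕ (below v G) _ _))
                (if-⊕ (not (lookup G v) ∧ Γ (G ∪ ⁅ v ⁆))))
      (sum-⊕ (∂-term ch G) (∂-term ch′ G) (allFin n))

    ∂-∅ : ∀ ch → ∂ Γ ch ∅ ≈ sum (λ v → if Γ ⁅ v ⁆ then ch ⁅ v ⁆ else 0#) (allFin n)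
    ∂-∅ ch = sum-cong (allFin n) term
      where
      term : ∀ v → ∂-term ch ∅ v ≈ (if Γ ⁅ v ⁆ then ch ⁅ v ⁆ else 0#)
      term v rewrite ∉⇒lookup {i = v} {F = ∅} ∉⊥ | ∪-identityˡ ⁅ v ⁆ | below-∅ v = ≈-refl

    -- The 0-chain concentrated at `z`. Only its values on singletons matter, so membership of `z`
    -- serves as the test for equality with `⁅ z ⁆`.
    δ : Fin n → Carrier → Subset n → Carrier
    δ z k F = if lookup F z then k else 0#

    δ-≡ : ∀ z k → δ z k ⁅ z ⁆ ≡ k
    δ-≡ z k = cong (if_then k else 0#) ([]=⇒lookup (x∈⁅x⁆ z))

    δ-≢ : ∀ {z w} k → w ≢ z → δ z k ⁅ w ⁆ ≡ 0#
    δ-≢ k w≢z = cong (if_then k else 0#) (∉⇒lookup (≢⇒∉⁅⁆ (w≢z ∘ sym)))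

    ∂-δ : ∀ z k → T (Γ ⁅ z ⁆) → ∂ Γ (δ z k) ∅ ≈ k
    ∂-δ z k Γz = begin
      ∂ Γ (δ z k) ∅
        ≈⟨ ∂-∅ (δ z k) ⟩
      sum (λ v → if Γ ⁅ v ⁆ then δ z k ⁅ v ⁆ else 0#) (allFin n)
        ≈⟨ sum-single _ (allFin n) (Uniqueₚ.allFin⁺ n) (∈-allFin z) (λ v v≢z → if-0 (Γ ⁅ v ⁆)
             (λ _ → ≈-reflexive (δ-≢ k v≢z))) ⟩
      (if Γ ⁅ z ⁆ then δ z k ⁅ z ⁆ else 0#)
        ≡⟨ cong (if_then _ else 0#) (T⇒≡ Γz) ⟩
      δ z k ⁅ z ⁆
        ≡⟨ δ-≡ z k ⟩
      k ∎

    vanishes-0 : ∀ u → T (Γ ⁅ u ⁆) → HomologyVanishes Γ 0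
    vanishes-0 u Γu ch _ = δ u (ch ∅) , λ F _ ∣F∣≡0 →
      subst (λ F → ∂ Γ (δ u (ch ∅)) F ≈ ch F) (sym (∣∣≡0⇒∅ ∣F∣≡0)) (∂-δ u (ch ∅) Γu)

    Edge : Fin n → Fin n → Set
    Edge i j = i ≢ j × T (Γ (⁅ i ⁆ ∪ ⁅ j ⁆))

    module _ (closed : ∀ F G → G ⊆ₛ F → T (Γ F) → T (Γ G)) where

      -- If no edge leaves `S`, the 0-cycle x - y does not bound. For a bounding 1-chain, add up the
      -- boundary coefficients over the vertices in `S`: every edge involved has both ends there and
      -- contributes twice with opposite signs, so the total is 0, whereas it should be the
      -- coefficient 1 of `x`.
      cut : HomologyVanishes Γ 1 → ∀ (S : Fin n → Bool) x y → T (Γ ⁅ x ⁆) → T (Γ ⁅ y ⁆) → S x ≡ true → S y ≡ false →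
        ¬ (∀ i j → S i ≡ true → S j ≡ false → ¬ Edge i j)
      cut hv S x y Γx Γy Sx Sy none = 0≉1 (begin
        0#
          ≈⟨ sum-antisym M M-diag M-anti (allFin n) ⟨
        sum (λ w → sum (M w) (allFin n)) (allFin n)
          ≈⟨ sum-cong (allFin n) row ⟩
        sum (λ w → if S′ w then ch ⁅ w ⁆ else 0#) (allFin n)
          ≈⟨ sum-single _ (allFin n) (Uniqueₚ.allFin⁺ n) (∈-allFin x) off ⟩
        (if S′ x then ch ⁅ x ⁆ else 0#)
          ≡⟨ cong (if_then ch ⁅ x ⁆ else 0#) (cong₂ _∧_ Sx (T⇒≡ Γx)) ⟩
        ch ⁅ x ⁆
          ≡⟨ cong₂ _⊕_ (δ-≡ x 1#) (δ-≢ (- 1#) x≢y) ⟩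
        1# ⊕ 0#
          ≈⟨ ⊕-identityʳ 1# ⟩
        1# ∎)
        where
        x≢y : x ≢ y
        x≢y refl with () ← trans (sym Sx) Sy
        S′ : Fin n → Bool
        S′ w = S w ∧ Γ ⁅ w ⁆
        ch : Subset n → Carrier
        ch F = δ x 1# F ⊕ δ y (- 1#) F
        cycle : ∀ G → T (Γ G) → suc ∣ G ∣ ≡ 1 → ∂ Γ ch G ≈ 0#
        cycle G _ eq rewrite ∣∣≡0⇒∅ {F = G} (suc-injective eq) =
          ≈-trans (∂-⊕ (δ x 1#) (δ y (- 1#)) ∅) (≈-trans (⊕-cong (∂-δ x 1# Γx) (∂-δ y (- 1#) Γy)) (⊖-inverseʳ 1#))
        bounded = hv ch cycle
        e : Subset n → Carrier
        e = proj₁ bounded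
        M : Fin n → Fin n → Carrier
        M w v = if S′ w ∧ S′ v then ∂-term e ⁅ w ⁆ v else 0#
        ∂-term-diag : ∀ w → ∂-term e ⁅ w ⁆ w ≈ 0#
        ∂-term-diag w rewrite []=⇒lookup (x∈⁅x⁆ w) = ≈-refl
        M-diag : ∀ w → M w w ≈ 0#
        M-diag w = if-0 (S′ w ∧ S′ w) λ _ → ∂-term-diag w
        ∂-term-anti : ∀ w v → ∂-term e ⁅ w ⁆ v ⊕ ∂-term e ⁅ v ⁆ w ≈ 0#
        ∂-term-anti w v with w Finₚ.≟ v
        ... | yes refl = ≈-trans (⊕-cong (∂-term-diag w) (∂-term-diag w)) (⊕-identityˡ 0#)
        ... | no w≢v rewrite ∉⇒lookup (≢⇒∉⁅⁆ w≢v) | ∉⇒lookup (≢⇒∉⁅⁆ (w≢v ∘ sym)) | ∪-comm ⁅ v ⁆ ⁅ w ⁆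
          with Γ (⁅ w ⁆ ∪ ⁅ v ⁆) | below-≶ w≢v
        ...   | false | _ = ⊕-identityˡ 0#
        ...   | true  | inj₁ (p , q) rewrite p | q = ⊖-inverseˡ _
        ...   | true  | inj₂ (p , q) rewrite p | q = ⊖-inverseʳ _
        M-anti : ∀ w v → M w v ⊕ M v w ≈ 0#
        M-anti w v rewrite Boolₚ.∧-comm (S′ v) (S′ w) =
          ≈-trans (≈-sym (if-⊕ (S′ w ∧ S′ v))) (if-0 (S′ w ∧ S′ v) λ _ → ∂-term-anti w v)
        row : ∀ w → sum (M w) (allFin n) ≈ (if S′ w then ch ⁅ w ⁆ else 0#)
        row w with S′ w in S′w
        ... | false = sum-zero (allFin n) (λ _ → ≈-refl)
        ... | true  = ≈-trans (sum-cong (allFin n) inside-S)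
                        (proj₂ bounded ⁅ w ⁆ (proj₂ (T-∧⁻ (≡⇒T S′w))) (∣⁅x⁆∣≡1 w))
          where
          inside-S : ∀ v → (if S′ v then ∂-term e ⁅ w ⁆ v else 0#) ≈ ∂-term e ⁅ w ⁆ v
          inside-S v with S′ v in S′v
          ... | true  = ≈-refl
          ... | false = ≈-sym (if-0 _ λ p → ⊥-elim (outside-S p))
            where
            outside-S : ¬ T (not (lookup ⁅ w ⁆ v) ∧ Γ (⁅ w ⁆ ∪ ⁅ v ⁆))
            outside-S p with S v in Sv
            ... | false = none w v (T⇒≡ (proj₁ (T-∧⁻ (≡⇒T S′w)))) Sv
                            ((λ { refl → subst (T ∘ not) ([]=⇒lookup (x∈⁅x⁆ w)) (proj₁ (T-∧⁻ p)) }) , proj₂ (T-∧⁻ p))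
            ... | true  = subst T S′v (closed _ ⁅ v ⁆ (⊆∪ʳ (λ z → z)) (proj₂ (T-∧⁻ p)))
        off : ∀ w → w ≢ x → (if S′ w then ch ⁅ w ⁆ else 0#) ≈ 0#
        off w w≢x = if-0 (S′ w) λ S′w → ≈-trans
          (≈-reflexive (cong₂ _⊕_ (δ-≢ 1# w≢x) (δ-≢ {y} {w} (- 1#) λ { refl → subst T Sy (proj₁ (T-∧⁻ S′w)) })))
          (⊕-identityˡ 0#)

    -- Connected graphs have no reduced homology in degree 0

    Bounds : (Fin n → Carrier) → Set _
    Bounds c = ∃ λ e → ∀ w → T (Γ ⁅ w ⁆) → ∂ Γ e ⁅ w ⁆ ≈ c w

    bounds-≈ : ∀ {c c′} → (∀ w → T (Γ ⁅ w ⁆) → c w ≈ c′ w) → Bounds c → Bounds c′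
    bounds-≈ eq (e , h) = e , λ w Γw → ≈-trans (h w Γw) (eq w Γw)

    bounds-0 : Bounds (λ _ → 0#)
    bounds-0 = (λ _ → 0#) , λ w _ → sum-zero (allFin n) λ v →
      if-0 (not (lookup ⁅ w ⁆ v) ∧ Γ (⁅ w ⁆ ∪ ⁅ v ⁆)) λ _ → sgn-0 (below v ⁅ w ⁆)

    bounds-⊕ : ∀ {c c′} → Bounds c → Bounds c′ → Bounds (λ w → c w ⊕ c′ w)
    bounds-⊕ (e , h) (e′ , h′) = (λ F → e F ⊕ e′ F) , λ w Γw →
      ≈-trans (∂-⊕ e e′ ⁅ w ⁆) (⊕-cong (h w Γw) (h′ w Γw))

    bounds-sum : ∀ {a} {A : Set a} (c : A → Fin n → Carrier) → (∀ u → Bounds (c u)) →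
      ∀ us → Bounds (λ w → sum (λ u → c u w) us)
    bounds-sum c h []       = bounds-0
    bounds-sum c h (u ∷ us) = bounds-⊕ (h u) (bounds-sum c h us)

    dipole : Fin n → Fin n → Carrier → Fin n → Carrier
    dipole i j k w = δ i k ⁅ w ⁆ ⊕ δ j (- k) ⁅ w ⁆

    indicator : Subset n → Carrier → Subset n → Carrier
    indicator P k F = if does (≡-dec Boolₚ._≟_ F P) then k else 0#

    indicator-≡ : ∀ P k → indicator P k P ≡ k
    indicator-≡ P k with ≡-dec Boolₚ._≟_ P P
    ... | yes _  = refl
    ... | no P≢P = ⊥-elim (P≢P refl)

    indicator-≢ : ∀ {P F} k → F ≢ P → indicator P k F ≡ 0#
    indicator-≢ {P} {F} k F≢P with ≡-dec Boolₚ._≟_ F P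
    ... | yes F≡P = ⊥-elim (F≢P F≡P)
    ... | no _    = refl

    pair-∈ : ∀ {i j x : Fin n} → x ∈ₛ ⁅ i ⁆ ∪ ⁅ j ⁆ → x ≡ i ⊎ x ≡ j
    pair-∈ {i} {j} x∈ with x∈p∪q⁻ ⁅ i ⁆ ⁅ j ⁆ x∈
    ... | inj₁ p = inj₁ (x∈⁅y⁆⇒x≡y i p)
    ... | inj₂ p = inj₂ (x∈⁅y⁆⇒x≡y j p)

    -- The chain that is `k` on the edge and 0 elsewhere does it, in the orientation in which `i`
    -- receives the positive sign. The other orientation follows by exchanging the ends and negating
    -- `k`.
    bounds-edge₀ : ∀ {i j} → Edge i j → below j ⁅ i ⁆ ≡ 0 → below i ⁅ j ⁆ ≡ 1 → ∀ k → Bounds (dipole i j k)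
    bounds-edge₀ {i} {j} (i≢j , Γij) j₀ i₁ k = e , at
      where
      P = ⁅ i ⁆ ∪ ⁅ j ⁆
      e = indicator P k
      j≢i = i≢j ∘ sym
      single : ∀ w x → (∀ y → y ≢ x → y ≢ w → ⁅ w ⁆ ∪ ⁅ y ⁆ ≢ P) → ∂ Γ e ⁅ w ⁆ ≈ ∂-term e ⁅ w ⁆ x
      single w x ≢P = sum-single (∂-term e ⁅ w ⁆) (allFin n) (Uniqueₚ.allFin⁺ n) (∈-allFin x) λ y y≢x →
        if-0 (not (lookup ⁅ w ⁆ y) ∧ Γ (⁅ w ⁆ ∪ ⁅ y ⁆)) λ p →
          ≈-trans (sgn-cong (below y ⁅ w ⁆) (≈-reflexive (indicator-≢ k (≢P y y≢x
            λ { refl → subst (T ∘ not) ([]=⇒lookup (x∈⁅x⁆ w)) (proj₁ (T-∧⁻ p)) })))) (sgn-0 (below y ⁅ w ⁆))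
      at : ∀ w → T (Γ ⁅ w ⁆) → ∂ Γ e ⁅ w ⁆ ≈ dipole i j k w
      at w _ with w Finₚ.≟ i | w Finₚ.≟ j
      ... | yes refl | yes refl = ⊥-elim (i≢j refl)
      ... | yes refl | no _ = begin
        ∂ Γ e ⁅ i ⁆
          ≈⟨ single i j (λ y y≢j y≢i eq → case (pair-∈ (subst (y ∈ₛ_) eq (⊆∪ʳ {G = ⁅ i ⁆} (λ z → z) (x∈⁅x⁆ y)))) y≢i y≢j) ⟩
        ∂-term e ⁅ i ⁆ j
          ≡⟨ cong₂ (λ b c → if not b ∧ c then sgn (below j ⁅ i ⁆) (e P) else 0#) (∉⇒lookup (≢⇒∉⁅⁆ j≢i)) (T⇒≡ Γij) ⟩
        sgn (below j ⁅ i ⁆) (e P)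
          ≡⟨ cong₂ sgn j₀ (indicator-≡ P k) ⟩
        k
          ≈⟨ ⊕-identityʳ k ⟨
        k ⊕ 0#
          ≡⟨ cong₂ _⊕_ (δ-≡ i k) (δ-≢ (- k) i≢j) ⟨
        dipole i j k i ∎
        where
        case : ∀ {y} → y ≡ i ⊎ y ≡ j → y ≢ i → y ≢ j → ⊥
        case (inj₁ p) q _ = q p
        case (inj₂ p) _ q = q p
      ... | no _ | yes refl = begin
        ∂ Γ e ⁅ j ⁆
          ≈⟨ single j i (λ y y≢i y≢j eq → case (pair-∈ (subst (y ∈ₛ_) eq (⊆∪ʳ {G = ⁅ j ⁆} (λ z → z) (x∈⁅x⁆ y)))) y≢i y≢j) ⟩
        ∂-term e ⁅ j ⁆ i
          ≡⟨ cong₂ (λ b Q → if not b ∧ Γ Q then sgn (below i ⁅ j ⁆) (e Q) else 0#) (∉⇒lookup (≢⇒∉⁅⁆ i≢j)) (∪-comm ⁅ j ⁆ ⁅ i ⁆) ⟩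
        (if Γ P then sgn (below i ⁅ j ⁆) (e P) else 0#)
          ≡⟨ cong (if_then sgn (below i ⁅ j ⁆) (e P) else 0#) (T⇒≡ Γij) ⟩
        sgn (below i ⁅ j ⁆) (e P)
          ≡⟨ cong₂ sgn i₁ (indicator-≡ P k) ⟩
        - k
          ≈⟨ ⊕-identityˡ (- k) ⟨
        0# ⊕ - k
          ≡⟨ cong₂ _⊕_ (δ-≢ k j≢i) (δ-≡ j (- k)) ⟨
        dipole i j k j ∎
        where
        case : ∀ {y} → y ≡ i ⊎ y ≡ j → y ≢ i → y ≢ j → ⊥
        case (inj₁ p) q _ = q p
        case (inj₂ p) _ q = q p
      ... | no w≢i | no w≢j = begin
        ∂ Γ e ⁅ w ⁆
          ≈⟨ sum-zero (allFin n) (λ y → if-0 (not (lookup ⁅ w ⁆ y) ∧ Γ (⁅ w ⁆ ∪ ⁅ y ⁆)) λ _ →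
               ≈-trans (sgn-cong (below y ⁅ w ⁆) (≈-reflexive (indicator-≢ k λ eq →
                 case (pair-∈ (subst (w ∈ₛ_) eq (⊆∪ˡ {H = ⁅ y ⁆} (λ z → z) (x∈⁅x⁆ w))))))) (sgn-0 (below y ⁅ w ⁆))) ⟩
        0#
          ≈⟨ ⊕-identityˡ 0# ⟨
        0# ⊕ 0#
          ≡⟨ cong₂ _⊕_ (δ-≢ k w≢i) (δ-≢ (- k) w≢j) ⟨
        dipole i j k w ∎
        where
        case : w ≡ i ⊎ w ≡ j → ⊥
        case (inj₁ p) = w≢i p
        case (inj₂ p) = w≢j p

    δ-cong : ∀ z {k k′} → k ≈ k′ → ∀ F → δ z k F ≈ δ z k′ F
    δ-cong z eq F = if-cong (lookup F z) λ _ → eq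

    δ-⊕ : ∀ z k k′ F → δ z k F ⊕ δ z k′ F ≈ δ z (k ⊕ k′) F
    δ-⊕ z k k′ F = ≈-sym (if-⊕ (lookup F z))

    δ-0 : ∀ z F → δ z 0# F ≈ 0#
    δ-0 z F = if-0 (lookup F z) λ _ → ≈-refl

    bounds-edge : ∀ {i j} → Edge i j → ∀ k → Bounds (dipole i j k)
    bounds-edge {i} {j} ij@(i≢j , Γij) k with below-≶ i≢j
    ... | inj₂ (i₁ , j₀) = bounds-edge₀ ij j₀ i₁ k
    ... | inj₁ (i₀ , j₁) = bounds-≈
      (λ w _ → ≈-trans (⊕-comm _ _) (⊕-congʳ (δ-cong i (-‿involutive k) ⁅ w ⁆)))
      (bounds-edge₀ (i≢j ∘ sym , subst (T ∘ Γ) (∪-comm ⁅ i ⁆ ⁅ j ⁆) Γij) i₀ j₁ (- k))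

    bounds-path : ∀ {i j} → Star Edge i j → ∀ k → Bounds (dipole i j k)
    bounds-path {i} ε k = bounds-≈
      (λ w _ → ≈-sym (≈-trans (δ-⊕ i k (- k) ⁅ w ⁆) (≈-trans (δ-cong i (⊖-inverseʳ k) ⁅ w ⁆) (δ-0 i ⁅ w ⁆)))) bounds-0
    bounds-path {i} {j} (_◅_ {j = m} im p) k = bounds-≈
      (λ w _ → begin
        (δ i k ⁅ w ⁆ ⊕ δ m (- k) ⁅ w ⁆) ⊕ (δ m k ⁅ w ⁆ ⊕ δ j (- k) ⁅ w ⁆)
          ≈⟨ ⊕-assoc _ _ _ ⟩
        δ i k ⁅ w ⁆ ⊕ (δ m (- k) ⁅ w ⁆ ⊕ (δ m k ⁅ w ⁆ ⊕ δ j (- k) ⁅ w ⁆))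
          ≈⟨ ⊕-congˡ (⊕-assoc _ _ _) ⟨
        δ i k ⁅ w ⁆ ⊕ ((δ m (- k) ⁅ w ⁆ ⊕ δ m k ⁅ w ⁆) ⊕ δ j (- k) ⁅ w ⁆)
          ≈⟨ ⊕-congˡ (⊕-congʳ (≈-trans (δ-⊕ m (- k) k ⁅ w ⁆) (≈-trans (δ-cong m (⊖-inverseˡ k) ⁅ w ⁆) (δ-0 m ⁅ w ⁆)))) ⟩
        δ i k ⁅ w ⁆ ⊕ (0# ⊕ δ j (- k) ⁅ w ⁆)
          ≈⟨ ⊕-congˡ (⊕-identityˡ _) ⟩
        δ i k ⁅ w ⁆ ⊕ δ j (- k) ⁅ w ⁆ ∎)
      (bounds-⊕ (bounds-edge im k) (bounds-path p k))

    -- The coefficients of a cycle sum to zero, by the boundary condition at the empty face. Hence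
    -- the cycle is the sum over all vertices u of its coefficient at u times u - `r`, and each such
    -- difference bounds along a path to `r`. Non-vertices get weight zero.
    vanishes-1 : T (Γ ∅) → ∀ r → (∀ u → T (Γ ⁅ u ⁆) → Star Edge u r) → HomologyVanishes Γ 1
    vanishes-1 Γ∅ r path ch cycle = e , λ F ΓF ∣F∣≡1 → go F ΓF (∣∣≡1⇒⁅⁆ ∣F∣≡1)
      where
      weight : Fin n → Carrier
      weight u = if Γ ⁅ u ⁆ then ch ⁅ u ⁆ else 0#
      part : ∀ u → Bounds (dipole u r (weight u))
      part u with Boolₚ.T? (Γ ⁅ u ⁆)
      ... | yes Γu = bounds-path (path u Γu) _
      ... | no ¬Γu = bounds-≈ (λ w _ → ≈-sym (≈-trans
              (⊕-cong (≈-trans (δ-cong u weight≈0 ⁅ w ⁆) (δ-0 u ⁅ w ⁆))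
                      (≈-trans (δ-cong r (≈-trans (⊖-cong weight≈0) -0#≈0#) ⁅ w ⁆) (δ-0 r ⁅ w ⁆)))
              (⊕-identityˡ 0#))) bounds-0
        where
        weight≈0 : weight u ≈ 0#
        weight≈0 = ≈-reflexive (cong (if_then ch ⁅ u ⁆ else 0#) (¬T⇒≡ ¬Γu))
      total : Bounds (λ w → sum (λ u → dipole u r (weight u) w) (allFin n))
      total = bounds-sum _ part (allFin n)
      e = proj₁ total
      δ-sum : ∀ z (k : Fin n → Carrier) F us → sum (λ u → δ z (k u) F) us ≈ δ z (sum k us) F
      δ-sum z k F []       = ≈-sym (δ-0 z F)
      δ-sum z k F (u ∷ us) = ≈-trans (⊕-congˡ (δ-sum z k F us)) (δ-⊕ z (k u) (sum k us) F)
      go : ∀ F → T (Γ F) → (∃ λ w → F ≡ ⁅ w ⁆) → ∂ Γ e F ≈ ch F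
      go _ Γw (w , refl) = begin
        ∂ Γ e ⁅ w ⁆
          ≈⟨ proj₂ total w Γw ⟩
        sum (λ u → δ u (weight u) ⁅ w ⁆ ⊕ δ r (- weight u) ⁅ w ⁆) (allFin n)
          ≈⟨ sum-⊕ (λ u → δ u (weight u) ⁅ w ⁆) (λ u → δ r (- weight u) ⁅ w ⁆) (allFin n) ⟩
        sum (λ u → δ u (weight u) ⁅ w ⁆) (allFin n) ⊕ sum (λ u → δ r (- weight u) ⁅ w ⁆) (allFin n)
          ≈⟨ ⊕-cong (sum-single _ (allFin n) (Uniqueₚ.allFin⁺ n) (∈-allFin w) (λ u u≢w → ≈-reflexive (δ-≢ (weight u) (u≢w ∘ sym))))
                    (δ-sum r (λ u → - weight u) ⁅ w ⁆ (allFin n)) ⟩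
        δ w (weight w) ⁅ w ⁆ ⊕ δ r (sum (λ u → - weight u) (allFin n)) ⁅ w ⁆
          ≈⟨ ⊕-congˡ (≈-trans (δ-cong r balance ⁅ w ⁆) (δ-0 r ⁅ w ⁆)) ⟩
        δ w (weight w) ⁅ w ⁆ ⊕ 0#
          ≈⟨ ⊕-identityʳ _ ⟩
        δ w (weight w) ⁅ w ⁆
          ≡⟨ trans (δ-≡ w (weight w)) (cong (if_then ch ⁅ w ⁆ else 0#) (T⇒≡ Γw)) ⟩
        ch ⁅ w ⁆ ∎
        where
        balance : sum (λ u → - weight u) (allFin n) ≈ 0#
        balance = begin
          sum (λ u → - weight u) (allFin n) ≈⟨ sum-⊖ weight (allFin n) ⟩
          - sum weight (allFin n)           ≈⟨ ⊖-cong (≈-trans (≈-sym (∂-∅ ch)) (cycle ∅ Γ∅ (cong suc (∣⊥∣≡0 n)))) ⟩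
          - 0#                              ≈⟨ -0#≈0# ⟩
          0#                                ∎

-- The graph of a Buchsbaum complex

split-∈ : ∀ {n} {v : Fin n} {F} → v ∈ₛ F → ∃ λ G → v ∉ₛ G × F ≡ ⁅ v ⁆ ∪ G
split-∈ {F = _ ∷ F} here       = outside ∷ F , (λ ()) , cong (inside ∷_) (sym (∪-identityˡ F))
split-∈ {F = b ∷ F} (there v∈) with split-∈ v∈
... | G , v∉ , refl = b ∷ G , (λ { (there p) → v∉ p }) , refl

two-elements : ∀ {n} {F : Subset n} → 2 ≤ ∣ F ∣ → ∃₂ λ i j → i ∈ₛ F × j ∈ₛ F × i ≢ j
two-elements {F = true ∷ F} (s≤s 1≤) with element 1≤
  where
  element : ∀ {n} {F : Subset n} → 1 ≤ ∣ F ∣ → ∃ λ i → i ∈ₛ F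
  element {F = true  ∷ F} _  = zero , here
  element {F = false ∷ F} 1≤ with element 1≤
  ... | i , i∈ = suc i , there i∈
... | i , i∈ = zero , suc i , here , there i∈ , λ ()
two-elements {F = false ∷ F} 2≤ with two-elements 2≤
... | i , j , i∈ , j∈ , i≢j = suc i , suc j , there i∈ , there j∈ , i≢j ∘ Finₚ.suc-injective

module _ {n : ℕ} where

  ∣triple∣ : ∀ {i j k : Fin n} → i ≢ j → i ≢ k → j ≢ k → ∣ ⁅ i ⁆ ∪ (⁅ j ⁆ ∪ ⁅ k ⁆) ∣ ≡ 3
  ∣triple∣ {i} {j} {k} i≢j i≢k j≢k = trans (∣⁅⁆∪∣ i∉) (cong suc (∣pair∣ j≢k))
    where
    i∉ : i ∉ₛ ⁅ j ⁆ ∪ ⁅ k ⁆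
    i∉ p with x∈p∪q⁻ ⁅ j ⁆ ⁅ k ⁆ p
    ... | inj₁ q = i≢j (x∈⁅y⁆⇒x≡y j q)
    ... | inj₂ q = i≢k (x∈⁅y⁆⇒x≡y k q)

  ∣pair∣≤2 : ∀ (i j : Fin n) → ∣ ⁅ i ⁆ ∪ ⁅ j ⁆ ∣ ≤ 2
  ∣pair∣≤2 i j with i Finₚ.≟ j
  ... | no i≢j   = ≤-reflexive (∣pair∣ i≢j)
  ... | yes refl = ≤-trans (≤-reflexive (trans (cong ∣_∣ (∪-idem ⁅ i ⁆)) (∣⁅x⁆∣≡1 i))) (n≤1+n 1)

  ∪-swap : ∀ (F G H : Subset n) → F ∪ (G ∪ H) ≡ G ∪ (F ∪ H)
  ∪-swap F G H = trans (sym (∪-assoc F G H)) (trans (cong (_∪ H) (∪-comm F G)) (∪-assoc G F H))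

  module Skeleton (Δ : Complex n) where

    -- The test on the size discards repeated vertices, where the union would be a smaller face.
    -- This makes `E` irreflexive, and the sums over pairs and triples count faces of sizes 2 and 3
    -- exactly.
    E : Fin n → Fin n → Bool
    E i j = Δ (⁅ i ⁆ ∪ ⁅ j ⁆) ∧ (∣ ⁅ i ⁆ ∪ ⁅ j ⁆ ∣ ≡ᵇ 2)

    Tr : Fin n → Fin n → Fin n → Bool
    Tr i j k = Δ (⁅ i ⁆ ∪ (⁅ j ⁆ ∪ ⁅ k ⁆)) ∧ (∣ ⁅ i ⁆ ∪ (⁅ j ⁆ ∪ ⁅ k ⁆) ∣ ≡ᵇ 3)

    E⁻ : ∀ {i j} → E i j ≡ true → i ≢ j × T (Δ (⁅ i ⁆ ∪ ⁅ j ⁆))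
    E⁻ {i} {j} eq with T-∧⁻ (≡⇒T eq)
    ... | Δij , two = (λ { refl → case (trans (sym (≡ᵇ⇒≡ _ 2 two)) (trans (cong ∣_∣ (∪-idem ⁅ i ⁆)) (∣⁅x⁆∣≡1 i))) }) , Δij
      where
      case : 2 ≡ 1 → ⊥
      case ()

    E⁺ : ∀ {i j} → i ≢ j → T (Δ (⁅ i ⁆ ∪ ⁅ j ⁆)) → E i j ≡ true
    E⁺ i≢j Δij = T⇒≡ (T-∧⁺ Δij (≡⇒≡ᵇ _ 2 (∣pair∣ i≢j)))

    Tr⁻ : ∀ {i j k} → Tr i j k ≡ true → i ≢ j × T (Δ (⁅ i ⁆ ∪ (⁅ j ⁆ ∪ ⁅ k ⁆)))
    Tr⁻ {i} {j} {k} eq with T-∧⁻ (≡⇒T eq)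
    ... | Δijk , three = (λ { refl → <⇒≱ ≤-refl (≤-trans (≤-reflexive (sym (≡ᵇ⇒≡ _ 3 three)))
            (≤-trans (≤-reflexive (cong ∣_∣ (∪-absorb {i = i} {⁅ i ⁆ ∪ ⁅ k ⁆} (⊆∪ˡ id (x∈⁅x⁆ i))))) (∣pair∣≤2 i k))) }) , Δijk

    Tr⁺ : ∀ {i j k} → i ≢ j → i ≢ k → j ≢ k → T (Δ (⁅ i ⁆ ∪ (⁅ j ⁆ ∪ ⁅ k ⁆))) → Tr i j k ≡ true
    Tr⁺ i≢j i≢k j≢k Δijk = T⇒≡ (T-∧⁺ Δijk (≡⇒≡ᵇ _ 3 (∣triple∣ i≢j i≢k j≢k)))

    E-sym : ∀ i j → E i j ≡ E j i
    E-sym i j = cong (λ F → Δ F ∧ (∣ F ∣ ≡ᵇ 2)) (∪-comm ⁅ i ⁆ ⁅ j ⁆)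

    E-irr : ∀ i → E i i ≡ false
    E-irr i = ¬T⇒≡ λ p → proj₁ (E⁻ (T⇒≡ p)) refl

    Tr-sym : ∀ i j k → Tr i j k ≡ Tr j i k
    Tr-sym i j k = cong (λ F → Δ F ∧ (∣ F ∣ ≡ᵇ 3)) (∪-swap ⁅ i ⁆ ⁅ j ⁆ ⁅ k ⁆)

    Tr-sym′ : ∀ i j k → Tr i j k ≡ Tr i k j
    Tr-sym′ i j k = cong (λ F → Δ (⁅ i ⁆ ∪ F) ∧ (∣ ⁅ i ⁆ ∪ F ∣ ≡ᵇ 3)) (∪-comm ⁅ j ⁆ ⁅ k ⁆)

    sized-faces : ∀ k → faces Δ k ≡ ΣS n k (λ F → ind (Δ F ∧ (∣ F ∣ ≡ᵇ k)))
    sized-faces k = trans (faces-ΣS Δ k) (ΣS-cong n k λ F ∣F∣≡k →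
      cong ind (sym (trans (cong (Δ F ∧_) (T⇒≡ (≡⇒≡ᵇ _ k ∣F∣≡k))) (Boolₚ.∧-identityʳ (Δ F)))))

    faces-2 : faces Δ 2 ≡ Σ₂ (λ i j → ind (E i j)) (allFin n)
    faces-2 = trans (sized-faces 2) (ΣS-2 n _)

    faces-3 : faces Δ 3 ≡ Σ₃ (λ i j k → ind (Tr i j k)) (allFin n)
    faces-3 = trans (sized-faces 3) (ΣS-3 n _)

    module _ (simplicial : IsSimplicialComplex Δ) where

      private
        vertex : ∀ i → T (Δ ⁅ i ⁆)
        vertex = proj₁ simplicial

      closed : ∀ {F G} → G ⊆ₛ F → T (Δ F) → T (Δ G)
      closed {F} {G} = proj₂ simplicial F G

      faces-1 : faces Δ 1 ≡ n
      faces-1 = trans (faces-ΣS Δ 1) (trans (ΣS-1 n _)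
        (trans (Σ₁-cong (allFin n) (λ i → cong ind (T⇒≡ (vertex i)))) (trans (ones (allFin n)) (length-tabulate id))))
        where
        ones : ∀ (xs : List (Fin n)) → Σ₁ (λ _ → 1) xs ≡ length xs
        ones []       = refl
        ones (_ ∷ xs) = cong suc (ones xs)

      faces-0 : Fin n → faces Δ 0 ≡ 1
      faces-0 v = trans (faces-ΣS Δ 0) (trans (ΣS-0 n _) (cong ind (T⇒≡ (closed ∅⊆ (vertex v)))))

      Tr⇒E : ∀ i j k → Tr i j k ≡ true → E i j ≡ true
      Tr⇒E i j k p = E⁺ (proj₁ (Tr⁻ {i} {j} {k} p))
        (closed (∪⊆ (⊆∪ˡ id) (⊆∪ʳ {G = ⁅ i ⁆} (⊆∪ˡ id))) (proj₂ (Tr⁻ {i} {j} {k} p)))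

      crossing : Connected Δ → ∀ (S : Fin n → Bool) u w → S u ≡ true → S w ≡ false →
        ∃₂ λ u′ w′ → S u′ ≡ true × S w′ ≡ false × E u′ w′ ≡ true
      crossing conn S u w Su Sw = go w (conn u w (vertex u) (vertex w)) Sw
        where
        go : ∀ w → Reach Δ u w → S w ≡ false → ∃₂ λ u′ w′ → S u′ ≡ true × S w′ ≡ false × E u′ w′ ≡ true
        go w here Sw with () ← trans (sym Su) Sw
        go w (step {v = v} r vw) Sw with S v in Sv
        ... | false = go v r Sv
        ... | true  = v , w , Sv , Sw , E⁺ (λ { refl → case (trans (sym Sv) Sw) }) vw
          where
          case : true ≡ false → ⊥
          case ()

⊆∧∣∣≤⇒≡ : ∀ {n} {F G : Subset n} → F ⊆ₛ G → ∣ G ∣ ≤ ∣ F ∣ → F ≡ G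
⊆∧∣∣≤⇒≡ {F = []}        {[]}        _ _  = refl
⊆∧∣∣≤⇒≡ {F = true  ∷ F} {true  ∷ G} p le = cong (true ∷_) (⊆∧∣∣≤⇒≡ (drop-∷-⊆ p) (s≤s⁻¹ le))
⊆∧∣∣≤⇒≡ {F = false ∷ F} {false ∷ G} p le = cong (false ∷_) (⊆∧∣∣≤⇒≡ (drop-∷-⊆ p) le)
⊆∧∣∣≤⇒≡ {F = true  ∷ F} {false ∷ G} p le with () ← p here
⊆∧∣∣≤⇒≡ {F = false ∷ F} {true  ∷ G} p le =
  ⊥-elim (<⇒≱ le (p⊆q⇒∣p∣≤∣q∣ {p = F} {G} λ x∈ → drop-there (p (there x∈))))

module _ {n : ℕ} (Γ : Complex n) where

  lk⁻ : ∀ F G → T (lk Γ F G) → (∀ {i} → i ∈ₛ G → i ∉ₛ F) × T (Γ (G ∪ F))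
  lk⁻ F G p = disjoint⁻ {F = G} {F} (proj₁ (T-∧⁻ p)) , proj₂ (T-∧⁻ p)

  lk⁺ : ∀ F G → (∀ {i} → i ∈ₛ G → i ∉ₛ F) → T (Γ (G ∪ F)) → T (lk Γ F G)
  lk⁺ F G d p = T-∧⁺ (disjoint⁺ {F = G} {F} d) p

  lk-closed : (∀ F G → G ⊆ₛ F → T (Γ F) → T (Γ G)) → ∀ H F G → G ⊆ₛ F → T (lk Γ H F) → T (lk Γ H G)
  lk-closed closed H F G G⊆F p with lk⁻ H F p
  ... | d , q = lk⁺ H G (λ i∈G → d (G⊆F i∈G)) (closed (F ∪ H) (G ∪ H) (∪⊆ (⊆∪ˡ G⊆F) (⊆∪ʳ {G = F} id)) q)

  maximal⇒Facet : ∀ F → T (Γ F) → (∀ G → T (Γ G) → F ⊆ₛ G → ∣ G ∣ ≤ ∣ F ∣) → Facet Γ F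
  maximal⇒Facet F ΓF max = ΓF , λ G ΓG F⊆G → ⊆∧∣∣≤⇒≡ F⊆G (max G ΓG F⊆G)

module LinkOfVertex {n : ℕ} (Δ : Complex n) (simplicial : IsSimplicialComplex Δ) (v : Fin n) where

  -- `CohenMacaulay` at the empty face speaks of the link of ∅ inside the link of `v`. It has the
  -- same faces as the link of `v` but is not the same term.
  L : Complex n
  L = lk (lk Δ ⁅ v ⁆) ∅

  L-closed : ∀ F G → G ⊆ₛ F → T (L F) → T (L G)
  L-closed = lk-closed (lk Δ ⁅ v ⁆) (lk-closed Δ (proj₂ simplicial) ⁅ v ⁆) ∅

  L⁺ : ∀ G → v ∉ₛ G → T (Δ (⁅ v ⁆ ∪ G)) → T (L G)
  L⁺ G v∉ p = lk⁺ (lk Δ ⁅ v ⁆) ∅ G (λ _ → ∉⊥) (subst (T ∘ lk Δ ⁅ v ⁆) (sym (∪-identityʳ G))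
    (lk⁺ Δ ⁅ v ⁆ G (λ i∈G i∈v → v∉ (subst (_∈ₛ G) (x∈⁅y⁆⇒x≡y v i∈v) i∈G)) (subst (T ∘ Δ) (∪-comm ⁅ v ⁆ G) p)))

  L⁻ : ∀ G → T (L G) → v ∉ₛ G × T (Δ (⁅ v ⁆ ∪ G))
  L⁻ G p with lk⁻ Δ ⁅ v ⁆ G (subst (T ∘ lk Δ ⁅ v ⁆) (∪-identityʳ G) (proj₂ (lk⁻ (lk Δ ⁅ v ⁆) ∅ G p)))
  ... | d , q = (λ v∈ → d v∈ (x∈⁅x⁆ v)) , subst (T ∘ Δ) (∪-comm G ⁅ v ⁆) q

  lk-dim : (∀ F → T (Δ F) → ∣ F ∣ ≤ 3) → (∃ λ F → T (Δ F) × ∣ F ∣ ≡ 3 × v ∈ₛ F) → DimPlusOne (lk Δ ⁅ v ⁆) 2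
  lk-dim small (F , ΔF , ∣F∣≡3 , v∈F) with split-∈ v∈F
  ... | G , v∉G , refl =
    (G , lk⁺ Δ ⁅ v ⁆ G (λ i∈G i∈v → v∉G (subst (_∈ₛ G) (x∈⁅y⁆⇒x≡y v i∈v) i∈G)) (subst (T ∘ Δ) (∪-comm ⁅ v ⁆ G) ΔF) ,
      suc-injective (trans (sym (∣⁅⁆∪∣ v∉G)) ∣F∣≡3)) ,
    λ H p → s≤s⁻¹ (≤-trans (≤-reflexive (sym (∣⁅⁆∪∣ (λ v∈ → proj₁ (lk⁻ Δ ⁅ v ⁆ H p) v∈ (x∈⁅x⁆ v)))))
      (small _ (subst (T ∘ Δ) (∪-comm H ⁅ v ⁆) (proj₂ (lk⁻ Δ ⁅ v ⁆ H p)))))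

module BuchsbaumSkeleton {c ℓ} (K : Field c ℓ) {n : ℕ} (Δ : Complex n)
  (simplicial : IsSimplicialComplex Δ) (dim : DimPlusOne Δ 3) (buchsbaum : Homology.Buchsbaum K Δ) where

  open Skeleton Δ

  private
    F₃ = proj₁ (proj₁ dim)
    ΔF₃ = proj₁ (proj₂ (proj₁ dim))
    ∣F₃∣≡3 = proj₂ (proj₂ (proj₁ dim))
    small = proj₂ dim

    F₃-facet : Facet Δ F₃
    F₃-facet = maximal⇒Facet Δ F₃ ΔF₃ λ G ΔG _ → subst (∣ G ∣ ≤_) (sym ∣F₃∣≡3) (small G ΔG)

    facet-3 : ∀ F → Facet Δ F → ∣ F ∣ ≡ 3
    facet-3 F facet = trans (proj₁ buchsbaum F F₃ facet F₃-facet) ∣F₃∣≡3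

  -- Purity: without a triangle at `v`, an edge at `v` would be a facet, or `v` itself if there is
  -- no edge, while all facets have three elements.
  triangle-at : ∀ v → ∃ λ F → T (Δ F) × ∣ F ∣ ≡ 3 × v ∈ₛ F
  triangle-at v with anySubset? (λ F → Boolₚ.T? (Δ F) ×-dec ((∣ F ∣ ≟ 3) ×-dec (v ∈ₛ? F)))
  ... | yes found = found
  ... | no none with anySubset? (λ F → Boolₚ.T? (Δ F) ×-dec ((∣ F ∣ ≟ 2) ×-dec (v ∈ₛ? F)))
  ...   | yes (F , ΔF , ∣F∣≡2 , v∈F) = ⊥-elim (none (F , ΔF , facet-3 F (maximal⇒Facet Δ F ΔF max) , v∈F))
    where
    max : ∀ G → T (Δ G) → F ⊆ₛ G → ∣ G ∣ ≤ ∣ F ∣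
    max G ΔG F⊆G = subst (∣ G ∣ ≤_) (sym ∣F∣≡2)
      (s≤s⁻¹ (≤∧≢⇒< (small G ΔG) λ ∣G∣≡3 → none (G , ΔG , ∣G∣≡3 , F⊆G v∈F)))
  ...   | no none₂ = ⊥-elim (none (⁅ v ⁆ , proj₁ simplicial v , facet-3 ⁅ v ⁆ (maximal⇒Facet Δ ⁅ v ⁆ (proj₁ simplicial v) max) , x∈⁅x⁆ v))
    where
    max : ∀ G → T (Δ G) → ⁅ v ⁆ ⊆ₛ G → ∣ G ∣ ≤ ∣ ⁅ v ⁆ ∣
    max G ΔG v⊆G = subst (∣ G ∣ ≤_) (sym (∣⁅x⁆∣≡1 v)) (s≤s⁻¹ (≤∧≢⇒<
      (s≤s⁻¹ (≤∧≢⇒< (small G ΔG) λ ∣G∣≡3 → none (G , ΔG , ∣G∣≡3 , v⊆G (x∈⁅x⁆ v))))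
      λ ∣G∣≡2 → none₂ (G , ΔG , ∣G∣≡2 , v⊆G (x∈⁅x⁆ v))))

  -- The homological argument only refutes the absence of a crossing edge. There are finitely many
  -- pairs, so a search turns the refutation into an edge.
  link-crossing : ∀ v (S : Fin n → Bool) x y → E v x ≡ true → E v y ≡ true → S x ≡ true → S y ≡ false →
    ∃₂ λ x′ y′ → S x′ ≡ true × S y′ ≡ false × Tr v x′ y′ ≡ true
  link-crossing v S x y vx vy Sx Sy
    with Finₚ.any? (λ x′ → Finₚ.any? (λ y′ → (S x′ Boolₚ.≟ true) ×-dec ((S y′ Boolₚ.≟ false) ×-dec (Tr v x′ y′ Boolₚ.≟ true))))
  ... | yes (x′ , y′ , found) = x′ , y′ , found
  ... | no none = ⊥-elim (Chains.cut K L L-closed vanishes S x y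
          (L⁺ ⁅ x ⁆ (≢⇒∉⁅⁆ (proj₁ (E⁻ vx))) (proj₂ (E⁻ vx)))
          (L⁺ ⁅ y ⁆ (≢⇒∉⁅⁆ (proj₁ (E⁻ vy))) (proj₂ (E⁻ vy))) Sx Sy
          λ i j Si Sj (i≢j , Lij) → none (i , j , Si , Sj , Tr⁺
            (λ { refl → proj₁ (L⁻ _ Lij) (⊆∪ˡ {H = ⁅ j ⁆} id (x∈⁅x⁆ i)) })
            (λ { refl → proj₁ (L⁻ _ Lij) (⊆∪ʳ {G = ⁅ i ⁆} id (x∈⁅x⁆ j)) }) i≢j (proj₂ (L⁻ _ Lij))))
    where
    open LinkOfVertex Δ simplicial v
    vanishes : Homology.HomologyVanishes K L 1
    -- For the empty face and `d = 2` only `s = 2` is exempt, so the homology in degree 0, at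
    -- `s = 1`, has to vanish.
    vanishes = proj₂ buchsbaum v (proj₁ simplicial v) 2 (lk-dim small (triangle-at v)) ∅
      (lk⁺ Δ ⁅ v ⁆ ∅ (λ p → ⊥-elim (∉⊥ p)) (subst (T ∘ Δ) (sym (∪-identityˡ ⁅ v ⁆)) (proj₁ simplicial v)))
      1 (λ eq → case (trans eq (cong (2 ∸_) (∣⊥∣≡0 n))))
      where
      case : 1 ≡ 2 → ⊥
      case ()

  face-bounds : Connected Δ → ∃ λ a →
    faces Δ 2 ≤ tri n × 2 * faces Δ 2 ≤ 3 * faces Δ 3 + n ×
    faces Δ 2 + 3 ≡ 2 * n + a × faces Δ 3 + 2 ≤ n + a + U a
  face-bounds conn with two-elements {F = F₃} (≤-trans (n≤1+n 2) (≤-reflexive (sym ∣F₃∣≡3)))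
  ... | u₀ , w₀ , u₀∈ , w₀∈ , u₀≢w₀
    rewrite faces-2 | faces-3 =
    proj₁ h-bounds ,
    subst (λ m → e (allFin n) ≤ tri m) len edges≤ ,
    subst (λ m → 2 * e (allFin n) ≤ 3 * t (allFin n) + m) len edges≤triangles ,
    subst (λ m → e (allFin n) + 3 ≡ 2 * m + proj₁ h-bounds) len (proj₁ (proj₂ h-bounds)) ,
    subst (λ m → t (allFin n) + 2 ≤ m + proj₁ h-bounds + U (proj₁ h-bounds)) len (proj₂ (proj₂ h-bounds))
    where
    open Necessity Finₚ._≟_ (allFin n) (Uniqueₚ.allFin⁺ n) ∈-allFin E Tr E-sym E-irr Tr-sym Tr-sym′
      (Tr⇒E simplicial) (crossing simplicial conn) link-crossing u₀ w₀
      (E⁺ u₀≢w₀ (closed simplicial (∪⊆ (⁅⁆⊆ u₀∈) (⁅⁆⊆ w₀∈)) ΔF₃))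
    len : length (allFin n) ≡ n
    len = length-tabulate id

-- Attaching triangles

same : ∀ {n} → Subset n → Subset n → ℕ
same F G = ind (does (≡-dec Boolₚ._≟_ F G))

same-≡ : ∀ {n} (F : Subset n) → same F F ≡ 1
same-≡ F with ≡-dec Boolₚ._≟_ F F
... | yes _  = refl
... | no F≢F = ⊥-elim (F≢F refl)

same-≢ : ∀ {n} {F G : Subset n} → F ≢ G → same F G ≡ 0
same-≢ {F = F} {G} F≢G with ≡-dec Boolₚ._≟_ F G
... | yes F≡G = ⊥-elim (F≢G F≡G)
... | no _    = refl

same-∷ : ∀ {n} b (F G : Subset n) → same (b ∷ F) (b ∷ G) ≡ same F G
same-∷ true  F G = refl
same-∷ false F G = refl

ΣS-zero : ∀ n k (g : Subset n → ℕ) → (∀ F → g F ≡ 0) → ΣS n k g ≡ 0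
ΣS-zero zero    zero    g z = z []
ΣS-zero zero    (suc k) g z = refl
ΣS-zero (suc n) zero    g z = ΣS-zero n zero _ (λ F → z _)
ΣS-zero (suc n) (suc k) g z = cong₂ _+_ (ΣS-zero n k _ (λ F → z _)) (ΣS-zero n (suc k) _ (λ F → z _))

ΣS-point : ∀ {n} k (G : Subset n) c → ∣ G ∣ ≡ k → ΣS n k (λ F → same F G * c) ≡ c
ΣS-point zero    []          c refl = *-identityˡ c
ΣS-point zero    (false ∷ G) c eq   =
  trans (ΣS-cong _ 0 λ F _ → cong (_* c) (same-∷ false F G)) (ΣS-point zero G c eq)
ΣS-point (suc k) (true ∷ G)  c eq   = trans
  (cong₂ _+_ (trans (ΣS-cong _ k λ F _ → cong (_* c) (same-∷ true F G)) (ΣS-point k G c (suc-injective eq)))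
             (ΣS-zero _ (suc k) _ λ F → cong (_* c) (same-≢ {F = false ∷ F} {true ∷ G} λ ())))
  (+-identityʳ c)
ΣS-point (suc k) (false ∷ G) c eq   =
  cong₂ _+_ (ΣS-zero _ k _ λ F → cong (_* c) (same-≢ {F = true ∷ F} {false ∷ G} λ ()))
            (trans (ΣS-cong _ (suc k) λ F _ → cong (_* c) (same-∷ false F G)) (ΣS-point (suc k) G c eq))

module _ {n : ℕ} where

  infixl 5 _⊕_

  _⊕_ : Complex n → Subset n → Complex n
  (Δ ⊕ t) F = Δ F ∨ does (F ⊆ₛ? t)

  tri₃ : Fin n → Fin n → Fin n → Subset n
  tri₃ x y z = ⁅ x ⁆ ∪ (⁅ y ⁆ ∪ ⁅ z ⁆)

  Adj : Complex n → Fin n → Fin n → Set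
  Adj Δ i j = T (Δ (⁅ i ⁆ ∪ ⁅ j ⁆))

  module _ {Δ : Complex n} {t : Subset n} where

    ⊕⁻ : ∀ F → T ((Δ ⊕ t) F) → T (Δ F) ⊎ F ⊆ₛ t
    ⊕⁻ F p with Δ F
    ... | true  = inj₁ tt
    ... | false with F ⊆ₛ? t
    ...   | yes F⊆t = inj₂ F⊆t

    ⊕⁺ˡ : ∀ {F} → T (Δ F) → T ((Δ ⊕ t) F)
    ⊕⁺ˡ {F} p with Δ F
    ... | true = tt

    ⊕⁺ʳ : ∀ {F} → F ⊆ₛ t → T ((Δ ⊕ t) F)
    ⊕⁺ʳ {F} F⊆t with Δ F | F ⊆ₛ? t
    ... | true  | _      = tt
    ... | false | yes _  = tt
    ... | false | no F⊈t = F⊈t F⊆t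

  adj⊆ : ∀ {i j : Fin n} {t} → i ∈ₛ t → j ∈ₛ t → ⁅ i ⁆ ∪ ⁅ j ⁆ ⊆ₛ t
  adj⊆ i∈ j∈ = ∪⊆ (⁅⁆⊆ i∈) (⁅⁆⊆ j∈)

  adj⊆⁻ : ∀ {i j : Fin n} {t} → ⁅ i ⁆ ∪ ⁅ j ⁆ ⊆ₛ t → i ∈ₛ t × j ∈ₛ t
  adj⊆⁻ {i} {j} p = p (⊆∪ˡ {H = ⁅ j ⁆} id (x∈⁅x⁆ i)) , p (⊆∪ʳ {G = ⁅ i ⁆} id (x∈⁅x⁆ j))

  tri⊆ : ∀ {i j k : Fin n} {t} → i ∈ₛ t → j ∈ₛ t → k ∈ₛ t → tri₃ i j k ⊆ₛ t
  tri⊆ i∈ j∈ k∈ = ∪⊆ (⁅⁆⊆ i∈) (adj⊆ j∈ k∈)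

  adj-⊕⁻ : ∀ {Δ t i j} → Adj (Δ ⊕ t) i j → Adj Δ i j ⊎ (i ∈ₛ t × j ∈ₛ t)
  adj-⊕⁻ {Δ} {t} {i} {j} p with ⊕⁻ {Δ} {t} (⁅ i ⁆ ∪ ⁅ j ⁆) p
  ... | inj₁ q = inj₁ q
  ... | inj₂ q = inj₂ (adj⊆⁻ q)

  adj-⊕ˡ : ∀ {Δ t i j} → Adj Δ i j → Adj (Δ ⊕ t) i j
  adj-⊕ˡ {Δ} {t} p = ⊕⁺ˡ {Δ} {t} p

  adj-⊕ʳ : ∀ {Δ t i j} → i ∈ₛ t → j ∈ₛ t → Adj (Δ ⊕ t) i j
  adj-⊕ʳ {Δ} {t} p q = ⊕⁺ʳ {Δ} {t} (adj⊆ p q)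

  adj-sym : ∀ {Δ i j} → Adj Δ i j → Adj Δ j i
  adj-sym {Δ} {i} {j} = subst (T ∘ Δ) (∪-comm ⁅ i ⁆ ⁅ j ⁆)

  module _ {x y z : Fin n} where

    tri-∈⁻ : ∀ {i} → i ∈ₛ tri₃ x y z → i ≡ x ⊎ i ≡ y ⊎ i ≡ z
    tri-∈⁻ p with x∈p∪q⁻ ⁅ x ⁆ (⁅ y ⁆ ∪ ⁅ z ⁆) p
    ... | inj₁ q = inj₁ (x∈⁅y⁆⇒x≡y x q)
    ... | inj₂ q with x∈p∪q⁻ ⁅ y ⁆ ⁅ z ⁆ q
    ...   | inj₁ r = inj₂ (inj₁ (x∈⁅y⁆⇒x≡y y r))
    ...   | inj₂ r = inj₂ (inj₂ (x∈⁅y⁆⇒x≡y z r))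

    tri-∉ : ∀ {i} → i ≢ x → i ≢ y → i ≢ z → i ∉ₛ tri₃ x y z
    tri-∉ p q r i∈ with tri-∈⁻ i∈
    ... | inj₁ e        = p e
    ... | inj₂ (inj₁ e) = q e
    ... | inj₂ (inj₂ e) = r e

    tri-∈₁ : x ∈ₛ tri₃ x y z
    tri-∈₁ = ⊆∪ˡ {H = ⁅ y ⁆ ∪ ⁅ z ⁆} id (x∈⁅x⁆ x)

    tri-∈₂ : y ∈ₛ tri₃ x y z
    tri-∈₂ = ⊆∪ʳ {G = ⁅ x ⁆} id (⊆∪ˡ {H = ⁅ z ⁆} id (x∈⁅x⁆ y))

    tri-∈₃ : z ∈ₛ tri₃ x y z
    tri-∈₃ = ⊆∪ʳ {G = ⁅ x ⁆} id (⊆∪ʳ {G = ⁅ y ⁆} id (x∈⁅x⁆ z))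

  ν : Complex n → Subset n → ℕ
  ν Δ F = ind (not (Δ F))

  ν-new : ∀ Δ {F} → ¬ T (Δ F) → ν Δ F ≡ 1
  ν-new Δ ¬ΔF = cong (ind ∘ not) (¬T⇒≡ ¬ΔF)

  ν-old : ∀ Δ {F} → T (Δ F) → ν Δ F ≡ 0
  ν-old Δ ΔF = cong (ind ∘ not) (T⇒≡ ΔF)

  ind-∨-true : ∀ b → ind (b ∨ true) ≡ ind b + ind (not b)
  ind-∨-true true  = refl
  ind-∨-true false = refl

  module _ {x y z : Fin n} (x≢y : x ≢ y) (x≢z : x ≢ z) (y≢z : y ≢ z) where

    private
      t = tri₃ x y z
      xy = ⁅ x ⁆ ∪ ⁅ y ⁆
      xz = ⁅ x ⁆ ∪ ⁅ z ⁆
      yz = ⁅ y ⁆ ∪ ⁅ z ⁆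

    two-of-three : ∀ {F} → F ⊆ₛ t → ∣ F ∣ ≡ 2 → F ≡ xy ⊎ F ≡ xz ⊎ F ≡ yz
    two-of-three {F} F⊆t ∣F∣≡2 with two-elements {F = F} (≤-reflexive (sym ∣F∣≡2))
    ... | i , j , i∈ , j∈ , i≢j = name (tri-∈⁻ (F⊆t i∈)) (tri-∈⁻ (F⊆t j∈))
      where
      F≡ : F ≡ ⁅ i ⁆ ∪ ⁅ j ⁆
      F≡ = sym (⊆∧∣∣≤⇒≡ (adj⊆ i∈ j∈) (≤-reflexive (trans ∣F∣≡2 (sym (∣pair∣ i≢j)))))
      name : i ≡ x ⊎ i ≡ y ⊎ i ≡ z → j ≡ x ⊎ j ≡ y ⊎ j ≡ z → F ≡ xy ⊎ F ≡ xz ⊎ F ≡ yz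
      name (inj₁ refl)        (inj₁ refl)        = ⊥-elim (i≢j refl)
      name (inj₁ refl)        (inj₂ (inj₁ refl)) = inj₁ F≡
      name (inj₁ refl)        (inj₂ (inj₂ refl)) = inj₂ (inj₁ F≡)
      name (inj₂ (inj₁ refl)) (inj₁ refl)        = inj₁ (trans F≡ (∪-comm ⁅ y ⁆ ⁅ x ⁆))
      name (inj₂ (inj₁ refl)) (inj₂ (inj₁ refl)) = ⊥-elim (i≢j refl)
      name (inj₂ (inj₁ refl)) (inj₂ (inj₂ refl)) = inj₂ (inj₂ F≡)
      name (inj₂ (inj₂ refl)) (inj₁ refl)        = inj₂ (inj₁ (trans F≡ (∪-comm ⁅ z ⁆ ⁅ x ⁆)))
      name (inj₂ (inj₂ refl)) (inj₂ (inj₁ refl)) = inj₂ (inj₂ (trans F≡ (∪-comm ⁅ z ⁆ ⁅ y ⁆)))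
      name (inj₂ (inj₂ refl)) (inj₂ (inj₂ refl)) = ⊥-elim (i≢j refl)

    private
      xy≢xz : xy ≢ xz
      xy≢xz eq with adj⊆⁻ {t = xz} (subst (xy ⊆ₛ_) eq id)
      ... | _ , y∈ with x∈p∪q⁻ ⁅ x ⁆ ⁅ z ⁆ y∈
      ...   | inj₁ p = x≢y (sym (x∈⁅y⁆⇒x≡y x p))
      ...   | inj₂ p = y≢z (x∈⁅y⁆⇒x≡y z p)
      xy≢yz : xy ≢ yz
      xy≢yz eq with adj⊆⁻ {t = yz} (subst (xy ⊆ₛ_) eq id)
      ... | x∈ , _ with x∈p∪q⁻ ⁅ y ⁆ ⁅ z ⁆ x∈
      ...   | inj₁ p = x≢y (x∈⁅y⁆⇒x≡y y p)
      ...   | inj₂ p = x≢z (x∈⁅y⁆⇒x≡y z p)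
      xz≢yz : xz ≢ yz
      xz≢yz eq with adj⊆⁻ {t = yz} (subst (xz ⊆ₛ_) eq id)
      ... | x∈ , _ with x∈p∪q⁻ ⁅ y ⁆ ⁅ z ⁆ x∈
      ...   | inj₁ p = x≢y (x∈⁅y⁆⇒x≡y y p)
      ...   | inj₂ p = x≢z (x∈⁅y⁆⇒x≡y z p)

    faces-⊕-2 : ∀ Δ → faces (Δ ⊕ t) 2 ≡ faces Δ 2 + (ν Δ xy + (ν Δ xz + ν Δ yz))
    faces-⊕-2 Δ = begin
      faces (Δ ⊕ t) 2
        ≡⟨ faces-ΣS (Δ ⊕ t) 2 ⟩
      ΣS n 2 (ind ∘ (Δ ⊕ t))
        ≡⟨ ΣS-cong n 2 pointwise ⟩
      ΣS n 2 (λ F → ind (Δ F) + (p₁ F + (p₂ F + p₃ F)))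
        ≡⟨ trans (ΣS-+ n 2 (ind ∘ Δ) _) (cong (ΣS n 2 (ind ∘ Δ) +_)
             (trans (ΣS-+ n 2 p₁ _) (cong (ΣS n 2 p₁ +_) (ΣS-+ n 2 p₂ p₃)))) ⟩
      ΣS n 2 (ind ∘ Δ) + (ΣS n 2 p₁ + (ΣS n 2 p₂ + ΣS n 2 p₃))
        ≡⟨ cong₂ _+_ (sym (faces-ΣS Δ 2)) (cong₂ _+_ (ΣS-point 2 xy _ (∣pair∣ x≢y))
             (cong₂ _+_ (ΣS-point 2 xz _ (∣pair∣ x≢z)) (ΣS-point 2 yz _ (∣pair∣ y≢z)))) ⟩
      faces Δ 2 + (ν Δ xy + (ν Δ xz + ν Δ yz)) ∎
      where
      open ≡-Reasoning
      p₁ p₂ p₃ : Subset n → ℕ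
      p₁ F = same F xy * ν Δ xy
      p₂ F = same F xz * ν Δ xz
      p₃ F = same F yz * ν Δ yz
      pointwise : ∀ F → ∣ F ∣ ≡ 2 → ind ((Δ ⊕ t) F) ≡ ind (Δ F) + (p₁ F + (p₂ F + p₃ F))
      pointwise F ∣F∣≡2 with F ⊆ₛ? t
      ... | no F⊈t
        rewrite same-≢ {F = F} {xy} (λ { refl → F⊈t (adj⊆ tri-∈₁ tri-∈₂) })
              | same-≢ {F = F} {xz} (λ { refl → F⊈t (adj⊆ tri-∈₁ tri-∈₃) })
              | same-≢ {F = F} {yz} (λ { refl → F⊈t (adj⊆ tri-∈₂ tri-∈₃) })
              | Boolₚ.∨-identityʳ (Δ F) = sym (+-identityʳ _)
      ... | yes F⊆t with two-of-three F⊆t ∣F∣≡2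
      ...   | inj₁ refl rewrite same-≡ xy | same-≢ xy≢xz | same-≢ xy≢yz
            | +-identityʳ (ν Δ xy) | +-identityʳ (ν Δ xy) = ind-∨-true (Δ xy)
      ...   | inj₂ (inj₁ refl) rewrite same-≡ xz | same-≢ (xy≢xz ∘ sym) | same-≢ xz≢yz
            | +-identityʳ (ν Δ xz) | +-identityʳ (ν Δ xz) = ind-∨-true (Δ xz)
      ...   | inj₂ (inj₂ refl) rewrite same-≡ yz | same-≢ (xy≢yz ∘ sym) | same-≢ (xz≢yz ∘ sym)
            | +-identityʳ (ν Δ yz) = ind-∨-true (Δ yz)

    faces-⊕-3 : ∀ Δ → faces (Δ ⊕ t) 3 ≡ faces Δ 3 + ν Δ t
    faces-⊕-3 Δ = begin
      faces (Δ ⊕ t) 3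
        ≡⟨ faces-ΣS (Δ ⊕ t) 3 ⟩
      ΣS n 3 (ind ∘ (Δ ⊕ t))
        ≡⟨ ΣS-cong n 3 pointwise ⟩
      ΣS n 3 (λ F → ind (Δ F) + same F t * ν Δ t)
        ≡⟨ ΣS-+ n 3 (ind ∘ Δ) _ ⟩
      ΣS n 3 (ind ∘ Δ) + ΣS n 3 (λ F → same F t * ν Δ t)
        ≡⟨ cong₂ _+_ (sym (faces-ΣS Δ 3)) (ΣS-point 3 t _ (∣triple∣ x≢y x≢z y≢z)) ⟩
      faces Δ 3 + ν Δ t ∎
      where
      open ≡-Reasoning
      pointwise : ∀ F → ∣ F ∣ ≡ 3 → ind ((Δ ⊕ t) F) ≡ ind (Δ F) + same F t * ν Δ t
      pointwise F ∣F∣≡3 with F ⊆ₛ? t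
      ... | no F⊈t rewrite same-≢ {F = F} {t} (λ { refl → F⊈t id }) | Boolₚ.∨-identityʳ (Δ F) = sym (+-identityʳ _)
      ... | yes F⊆t with ⊆∧∣∣≤⇒≡ F⊆t (≤-reflexive (trans (∣triple∣ x≢y x≢z y≢z) (sym ∣F∣≡3)))
      ...   | refl rewrite same-≡ t | +-identityʳ (ν Δ t) = ind-∨-true (Δ t)

-- Connectedness of links under attachment

module _ {n : ℕ} where

  -- `a = b` is allowed and then merely says that `v` and `a` are adjacent; `edge-path` drops such
  -- steps when a path is turned into edges of the link.
  Step : Complex n → Fin n → Fin n → Fin n → Set
  Step Δ v a b = a ≢ v × b ≢ v × T (Δ (tri₃ v a b))

  LinkConnected : Complex n → Fin n → Set
  LinkConnected Δ v = ∀ a b → a ≢ v → b ≢ v → Adj Δ v a → Adj Δ v b → Star (Step Δ v) a b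

  step-sym : ∀ {Δ v a b} → Step Δ v a b → Step Δ v b a
  step-sym {Δ} {v} {a} {b} (a≢v , b≢v , p) = b≢v , a≢v , subst (λ F → T (Δ (⁅ v ⁆ ∪ F))) (∪-comm ⁅ a ⁆ ⁅ b ⁆) p

  path-sym : ∀ {Δ v a b} → Star (Step Δ v) a b → Star (Step Δ v) b a
  path-sym {Δ} = reverse (step-sym {Δ})

  path-⊕ : ∀ {Δ t v a b} → Star (Step Δ v) a b → Star (Step (Δ ⊕ t) v) a b
  path-⊕ {Δ} {t} = gmap id λ {a} {b} (p , q , r) → p , q , ⊕⁺ˡ {Δ = Δ} {t} {tri₃ _ a b} r

  -- It suffices that every new or old neighbour reaches one common `r`: through the old link if
  -- both were in it, and by an explicit path otherwise. The cases `link-anchor`, `link-fresh` and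
  -- `link-strip` differ only in the choice of `r` and of these paths.
  hub : ∀ {Δ Δ′ v} r → (∀ {F} → T (Δ F) → T (Δ′ F)) → r ≢ v → LinkConnected Δ v →
    (∀ a → a ≢ v → Adj Δ′ v a → (Adj Δ v a × Adj Δ v r) ⊎ Star (Step Δ′ v) a r) → LinkConnected Δ′ v
  hub {Δ} {Δ′} {v} r mono r≢v lc reach a b a≢v b≢v va vb = to-hub a a≢v va ◅◅ path-sym {Δ′} (to-hub b b≢v vb)
    where
    to-hub : ∀ a → a ≢ v → Adj Δ′ v a → Star (Step Δ′ v) a r
    to-hub a a≢v va with reach a a≢v va
    ... | inj₂ p         = p
    ... | inj₁ (p , q) = gmap id (λ (p , q , r) → p , q , mono r) (lc a r a≢v r≢v p q)

  link-∉ : ∀ {Δ t v} → v ∉ₛ t → LinkConnected Δ v → LinkConnected (Δ ⊕ t) v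
  link-∉ {Δ} {t} {v} v∉ lc a b a≢v b≢v va vb =
    path-⊕ {Δ} {t} (lc a b a≢v b≢v (old va) (old vb))
    where
    old : ∀ {a} → Adj (Δ ⊕ t) v a → Adj Δ v a
    old va with adj-⊕⁻ {Δ = Δ} va
    ... | inj₁ p       = p
    ... | inj₂ (p , _) = ⊥-elim (v∉ p)

  module _ {Δ : Complex n} {t : Subset n} {v y w : Fin n} (y≢v : y ≢ v) (w≢v : w ≢ v)
    (v∈ : v ∈ₛ t) (y∈ : y ∈ₛ t) (w∈ : w ∈ₛ t) (only : ∀ {i} → i ∈ₛ t → i ≡ v ⊎ i ≡ y ⊎ i ≡ w) where

    private
      corner : ∀ a → a ≢ v → a ∈ₛ t → Star (Step (Δ ⊕ t) v) a y
      corner a a≢v a∈ with only a∈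
      ... | inj₁ e           = ⊥-elim (a≢v e)
      ... | inj₂ (inj₁ refl) = ε
      ... | inj₂ (inj₂ refl) = (w≢v , y≢v , ⊕⁺ʳ {Δ = Δ} {t} (tri⊆ v∈ w∈ y∈)) ◅ ε

    -- The link of `v` gains the edge from `y` to `w`. Since `y` was in it before, no new component
    -- appears.
    link-anchor : Adj Δ v y → LinkConnected Δ v → LinkConnected (Δ ⊕ t) v
    link-anchor vy lc = hub {Δ} {Δ ⊕ t} y (λ {F} → ⊕⁺ˡ {Δ = Δ} {t} {F}) y≢v lc reach
      where
      reach : ∀ a → a ≢ v → Adj (Δ ⊕ t) v a → (Adj Δ v a × Adj Δ v y) ⊎ Star (Step (Δ ⊕ t) v) a y
      reach a a≢v va with adj-⊕⁻ {Δ = Δ} va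
      ... | inj₁ p       = inj₁ (p , vy)
      ... | inj₂ (_ , q) = inj₂ (corner a a≢v q)

    link-fresh : (∀ a → ¬ Adj Δ v a) → LinkConnected (Δ ⊕ t) v
    link-fresh isolated = hub {Δ} {Δ ⊕ t} y (λ {F} → ⊕⁺ˡ {Δ = Δ} {t} {F}) y≢v (λ a _ _ _ va → ⊥-elim (isolated a va)) reach
      where
      reach : ∀ a → a ≢ v → Adj (Δ ⊕ t) v a → (Adj Δ v a × Adj Δ v y) ⊎ Star (Step (Δ ⊕ t) v) a y
      reach a a≢v va with adj-⊕⁻ {Δ = Δ} va
      ... | inj₁ p       = ⊥-elim (isolated a p)
      ... | inj₂ (_ , q) = inj₂ (corner a a≢v q)

  -- The link of w receives the path x – y – v at its old vertex v.
  link-strip : ∀ {Δ x y v w} → x ≢ w → y ≢ w → v ≢ w → Adj Δ w v → LinkConnected Δ w →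
    LinkConnected (Δ ⊕ tri₃ x y w ⊕ tri₃ y w v) w
  link-strip {Δ} {x} {y} {v} {w} x≢w y≢w v≢w wv lc =
    hub {Δ} {Δ₂} v (λ {F} p → ⊕⁺ˡ {Δ = Δ₁} {tri₃ y w v} {F} (⊕⁺ˡ {Δ = Δ} {tri₃ x y w} {F} p)) v≢w lc reach
    where
    Δ₁ = Δ ⊕ tri₃ x y w
    Δ₂ = Δ₁ ⊕ tri₃ y w v
    yv : Step Δ₂ w y v
    yv = y≢w , v≢w , ⊕⁺ʳ {Δ = Δ₁} (tri⊆ {t = tri₃ y w v} tri-∈₂ tri-∈₁ tri-∈₃)
    xy : Step Δ₂ w x y
    xy = x≢w , y≢w , ⊕⁺ˡ {Δ = Δ₁} (⊕⁺ʳ {Δ = Δ} (tri⊆ {t = tri₃ x y w} tri-∈₃ tri-∈₁ tri-∈₂))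
    reach : ∀ a → a ≢ w → Adj Δ₂ w a → (Adj Δ w a × Adj Δ w v) ⊎ Star (Step Δ₂ w) a v
    reach a a≢w wa with adj-⊕⁻ {Δ = Δ₁} wa
    ... | inj₂ (_ , q) with tri-∈⁻ q
    ...   | inj₁ refl        = inj₂ (yv ◅ ε)
    ...   | inj₂ (inj₁ e)    = ⊥-elim (a≢w e)
    ...   | inj₂ (inj₂ refl) = inj₂ ε
    reach a a≢w wa | inj₁ p with adj-⊕⁻ {Δ = Δ} p
    ... | inj₁ q = inj₁ (q , wv)
    ... | inj₂ (_ , q) with tri-∈⁻ q
    ...   | inj₁ refl        = inj₂ (xy ◅ yv ◅ ε)
    ...   | inj₂ (inj₁ refl) = inj₂ (yv ◅ ε)
    ...   | inj₂ (inj₂ e)    = ⊥-elim (a≢w e)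

  reach-trans : ∀ {Δ : Complex n} {u v w} → Reach Δ u v → Reach Δ v w → Reach Δ u w
  reach-trans p here       = p
  reach-trans p (step q e) = step (reach-trans p q) e

  reach-sym : ∀ {Δ : Complex n} {u v} → Reach Δ u v → Reach Δ v u
  reach-sym here = here
  reach-sym {Δ} (step {v = v} {w = w} p e) = reach-trans (step here (adj-sym {Δ = Δ} {v} {w} e)) (reach-sym p)

  reach-mono : ∀ {Δ Δ′ : Complex n} {u v} → (∀ {F} → T (Δ F) → T (Δ′ F)) → Reach Δ u v → Reach Δ′ u v
  reach-mono f here       = here
  reach-mono f (step p e) = step (reach-mono f p) (f e)

  -- a stands for h₂ and s for h₂ + h₃.
  record Core (Δ : Complex n) (vs : List (Fin n)) (a s : ℕ) : Set where
    field
      closed    : ∀ F G → G ⊆ₛ F → T (Δ F) → T (Δ G)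
      pure      : ∀ F → T (Δ F) → ∃ λ G → F ⊆ₛ G × T (Δ G) × ∣ G ∣ ≡ 3
      vertex⁻   : ∀ {i} → T (Δ ⁅ i ⁆) → i ∈ vs
      vertex⁺   : ∀ {i} → i ∈ vs → T (Δ ⁅ i ⁆)
      connected : Connected Δ
      edges     : faces Δ 2 + 3 ≡ 2 * length vs + a
      triangles : faces Δ 3 + 2 ≡ length vs + s

    adj⇒∈ : ∀ {i j} → Adj Δ i j → i ∈ vs
    adj⇒∈ {i} {j} p = vertex⁻ (closed _ _ (⊆∪ˡ {H = ⁅ j ⁆} id) p)

  State : Complex n → List (Fin n) → ℕ → ℕ → Set
  State Δ vs a s = Core Δ vs a s × (∀ v → LinkConnected Δ v)

  -- The corner `z` is an old vertex and connects the triangle with the rest. Which sides are new is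
  -- left to the two counting hypotheses, so one lemma serves every kind of attachment. Links are
  -- kept out of it, because halfway through a strip one of them is disconnected.
  attach : ∀ {Δ vs vs′ a s a′ s′ x y z} → x ≢ y → x ≢ z → y ≢ z → Core Δ vs a s →
    (∀ {i} → i ∈ vs → i ∈ vs′) → (∀ {i} → i ∈ vs′ → i ∈ vs ⊎ i ∈ₛ tri₃ x y z) → (∀ {i} → i ∈ₛ tri₃ x y z → i ∈ vs′) →
    z ∈ vs →
    faces Δ 2 + (ν Δ (⁅ x ⁆ ∪ ⁅ y ⁆) + (ν Δ (⁅ x ⁆ ∪ ⁅ z ⁆) + ν Δ (⁅ y ⁆ ∪ ⁅ z ⁆))) + 3 ≡ 2 * length vs′ + a′ →
    faces Δ 3 + ν Δ (tri₃ x y z) + 2 ≡ length vs′ + s′ →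
    Core (Δ ⊕ tri₃ x y z) vs′ a′ s′
  attach {Δ} {vs} {vs′} {x = x} {y} {z} x≢y x≢z y≢z core grow⊆ cover t⊆ z∈ edges′ triangles′ = record
    { closed    = closed′
    ; pure      = pure′
    ; vertex⁻   = vertex⁻′
    ; vertex⁺   = λ i∈ → [ (λ p → ⊕⁺ˡ {Δ = Δ} (vertex⁺ p)) , (λ p → ⊕⁺ʳ {Δ = Δ} (⁅⁆⊆ p)) ] (cover i∈)
    ; connected = λ u v u∈ v∈ → reach-trans (to-z u u∈) (reach-sym (to-z v v∈))
    ; edges     = trans (cong (_+ 3) (faces-⊕-2 x≢y x≢z y≢z Δ)) edges′
    ; triangles = trans (cong (_+ 2) (faces-⊕-3 x≢y x≢z y≢z Δ)) triangles′
    }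
    where
    open Core core
    t = tri₃ x y z
    closed′ : ∀ F G → G ⊆ₛ F → T ((Δ ⊕ t) F) → T ((Δ ⊕ t) G)
    closed′ F G G⊆F p with ⊕⁻ {Δ = Δ} F p
    ... | inj₁ ΔF  = ⊕⁺ˡ {Δ = Δ} (closed F G G⊆F ΔF)
    ... | inj₂ F⊆t = ⊕⁺ʳ {Δ = Δ} (λ i∈ → F⊆t (G⊆F i∈))
    pure′ : ∀ F → T ((Δ ⊕ t) F) → ∃ λ G → F ⊆ₛ G × T ((Δ ⊕ t) G) × ∣ G ∣ ≡ 3
    pure′ F p with ⊕⁻ {Δ = Δ} F p
    ... | inj₂ F⊆t = t , F⊆t , ⊕⁺ʳ {Δ = Δ} id , ∣triple∣ x≢y x≢z y≢z
    ... | inj₁ ΔF with pure F ΔF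
    ...   | G , F⊆G , ΔG , ∣G∣≡3 = G , F⊆G , ⊕⁺ˡ {Δ = Δ} ΔG , ∣G∣≡3
    vertex⁻′ : ∀ {i} → T ((Δ ⊕ t) ⁅ i ⁆) → i ∈ vs′
    vertex⁻′ {i} p with ⊕⁻ {Δ = Δ} ⁅ i ⁆ p
    ... | inj₁ q = grow⊆ (vertex⁻ q)
    ... | inj₂ q = t⊆ (q (x∈⁅x⁆ i))
    to-z : ∀ u → T ((Δ ⊕ t) ⁅ u ⁆) → Reach (Δ ⊕ t) u z
    to-z u p with ⊕⁻ {Δ = Δ} ⁅ u ⁆ p
    ... | inj₁ q = reach-mono (λ {F} → ⊕⁺ˡ {Δ = Δ} {t} {F}) (connected u z q (vertex⁺ z∈))
    ... | inj₂ q = step here (adj-⊕ʳ {Δ = Δ} (q (x∈⁅x⁆ u)) tri-∈₃)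

  tri-∈⁻-yxz : ∀ {x y z} {i : Fin n} → i ∈ₛ tri₃ x y z → i ≡ y ⊎ i ≡ x ⊎ i ≡ z
  tri-∈⁻-yxz i∈ with tri-∈⁻ i∈
  ... | inj₁ e        = inj₂ (inj₁ e)
  ... | inj₂ (inj₁ e) = inj₁ e
  ... | inj₂ (inj₂ e) = inj₂ (inj₂ e)

  tri-∈⁻-zxy : ∀ {x y z} {i : Fin n} → i ∈ₛ tri₃ x y z → i ≡ z ⊎ i ≡ x ⊎ i ≡ y
  tri-∈⁻-zxy i∈ with tri-∈⁻ i∈
  ... | inj₁ e        = inj₂ (inj₁ e)
  ... | inj₂ (inj₁ e) = inj₂ (inj₂ e)
  ... | inj₂ (inj₂ e) = inj₁ e

  swap₂₃ : ∀ {x y z i : Fin n} → i ≡ x ⊎ i ≡ y ⊎ i ≡ z → i ≡ x ⊎ i ≡ z ⊎ i ≡ y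
  swap₂₃ (inj₁ e)        = inj₁ e
  swap₂₃ (inj₂ (inj₁ e)) = inj₂ (inj₂ e)
  swap₂₃ (inj₂ (inj₂ e)) = inj₂ (inj₁ e)

  -- One vertex, two edges and one triangle are added, and these contributions cancel in h₂ and in
  -- h₃. The link of `x` is a single edge.
  glue : ∀ {Δ vs a s x u w} → x ∉ vs → u ≢ w → Adj Δ u w → State Δ vs a s → State (Δ ⊕ tri₃ x u w) (x ∷ vs) a s
  glue {Δ} {vs} {a} {s} {x} {u} {w} x∉ u≢w uw (core , links) =
    attach x≢u x≢w u≢w core there cover t⊆ w∈ edges′ triangles′ , links′
    where
    open Core core
    u∈ = adj⇒∈ uw
    w∈ = adj⇒∈ (adj-sym {Δ = Δ} {u} {w} uw)
    x≢u : x ≢ u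
    x≢u refl = x∉ u∈
    x≢w : x ≢ w
    x≢w refl = x∉ w∈
    isolated : ∀ b → ¬ Adj Δ x b
    isolated b xb = x∉ (adj⇒∈ xb)
    cover : ∀ {i} → i ∈ x ∷ vs → i ∈ vs ⊎ i ∈ₛ tri₃ x u w
    cover (here refl) = inj₂ tri-∈₁
    cover (there i∈)  = inj₁ i∈
    t⊆ : ∀ {i} → i ∈ₛ tri₃ x u w → i ∈ x ∷ vs
    t⊆ i∈ with tri-∈⁻ i∈
    ... | inj₁ refl        = here refl
    ... | inj₂ (inj₁ refl) = there u∈
    ... | inj₂ (inj₂ refl) = there w∈
    edges′ : faces Δ 2 + (ν Δ (⁅ x ⁆ ∪ ⁅ u ⁆) + (ν Δ (⁅ x ⁆ ∪ ⁅ w ⁆) + ν Δ (⁅ u ⁆ ∪ ⁅ w ⁆))) + 3 ≡ 2 * suc (length vs) + a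
    edges′ rewrite ν-new Δ (isolated u) | ν-new Δ (isolated w) | ν-old Δ uw =
      trans (eq₁ (faces Δ 2)) (trans (cong (2 +_) edges) (eq₂ (length vs) a))
      where
      eq₁ : ∀ f → f + 2 + 3 ≡ 2 + (f + 3)
      eq₁ = solve-∀
      eq₂ : ∀ l a → 2 + (2 * l + a) ≡ 2 * suc l + a
      eq₂ = solve-∀
    triangles′ : faces Δ 3 + ν Δ (tri₃ x u w) + 2 ≡ suc (length vs) + s
    triangles′ rewrite ν-new Δ {tri₃ x u w} (λ p → isolated u (closed _ _ (adj⊆ tri-∈₁ tri-∈₂) p)) =
      trans (eq (faces Δ 3)) (cong suc triangles)
      where
      eq : ∀ f → f + 1 + 2 ≡ suc (f + 2)
      eq = solve-∀
    links′ : ∀ v → LinkConnected (Δ ⊕ tri₃ x u w) v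
    links′ v with v Finₚ.≟ x | v Finₚ.≟ u | v Finₚ.≟ w
    ... | yes refl | _ | _ = link-fresh {Δ} (x≢u ∘ sym) (x≢w ∘ sym) tri-∈₁ tri-∈₂ tri-∈₃ tri-∈⁻ isolated
    ... | no _ | yes refl | _ = link-anchor {Δ} (u≢w ∘ sym) x≢u tri-∈₂ tri-∈₃ tri-∈₁ (swap₂₃ ∘ tri-∈⁻-yxz) uw (links u)
    ... | no _ | no _ | yes refl =
      link-anchor {Δ} u≢w x≢w tri-∈₃ tri-∈₂ tri-∈₁ (swap₂₃ ∘ tri-∈⁻-zxy) (adj-sym {Δ = Δ} {u} {w} uw) (links w)
    ... | no p | no q | no r = link-∉ {Δ} (tri-∉ p q r) (links v)

  module _ {Δ vs a s} {x y z : Fin n} (x≢y : x ≢ y) (x≢z : x ≢ z) (y≢z : y ≢ z) (xz : Adj Δ x z) (yz : Adj Δ y z)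
    (st : State Δ vs a s) where

    private
      open module M = Core (proj₁ st)
      links = proj₂ st
      t⊆ : ∀ {i} → i ∈ₛ tri₃ x y z → i ∈ vs
      t⊆ i∈ with tri-∈⁻ i∈
      ... | inj₁ refl        = adj⇒∈ xz
      ... | inj₂ (inj₁ refl) = adj⇒∈ yz
      ... | inj₂ (inj₂ refl) = adj⇒∈ (adj-sym {Δ = Δ} {x} {z} xz)
      links′ : ∀ v → LinkConnected (Δ ⊕ tri₃ x y z) v
      links′ v with v Finₚ.≟ x | v Finₚ.≟ y | v Finₚ.≟ z
      ... | yes refl | _ | _ = link-anchor {Δ} (x≢z ∘ sym) (x≢y ∘ sym) tri-∈₁ tri-∈₃ tri-∈₂ (swap₂₃ ∘ tri-∈⁻) xz (links x)
      ... | no _ | yes refl | _ = link-anchor {Δ} (y≢z ∘ sym) x≢y tri-∈₂ tri-∈₃ tri-∈₁ (swap₂₃ ∘ tri-∈⁻-yxz) yz (links y)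
      ... | no _ | no _ | yes refl =
        link-anchor {Δ} y≢z x≢z tri-∈₃ tri-∈₂ tri-∈₁ (swap₂₃ ∘ tri-∈⁻-zxy) (adj-sym {Δ = Δ} {y} {z} yz) (links z)
      ... | no p | no q | no r = link-∉ {Δ} (tri-∉ p q r) (links v)
      new-face : ¬ T (Δ (tri₃ x y z)) → faces Δ 3 + ν Δ (tri₃ x y z) + 2 ≡ length vs + suc s
      new-face ¬t rewrite ν-new Δ {tri₃ x y z} ¬t =
        trans (eq (faces Δ 3)) (trans (cong suc M.triangles) (sym (+-suc (length vs) s)))
        where
        eq : ∀ f → f + 1 + 2 ≡ suc (f + 2)
        eq = solve-∀

    new-triangle : Adj Δ x y → ¬ T (Δ (tri₃ x y z)) → State (Δ ⊕ tri₃ x y z) vs a (suc s)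
    new-triangle xy ¬t =
      attach x≢y x≢z y≢z (proj₁ st) id inj₁ t⊆ (t⊆ {z} (tri-∈₃ {x = x} {y} {z})) edges′ (new-face ¬t) , links′
      where
      edges′ : faces Δ 2 + (ν Δ (⁅ x ⁆ ∪ ⁅ y ⁆) + (ν Δ (⁅ x ⁆ ∪ ⁅ z ⁆) + ν Δ (⁅ y ⁆ ∪ ⁅ z ⁆))) + 3 ≡ 2 * length vs + a
      edges′ rewrite ν-old Δ xy | ν-old Δ xz | ν-old Δ yz | +-identityʳ (faces Δ 2) = M.edges

    new-edge : ¬ Adj Δ x y → State (Δ ⊕ tri₃ x y z) vs (suc a) (suc s)
    new-edge ¬xy =
      attach x≢y x≢z y≢z (proj₁ st) id inj₁ t⊆ (t⊆ {z} (tri-∈₃ {x = x} {y} {z})) edges′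
        (new-face λ p → ¬xy (closed _ _ (adj⊆ tri-∈₁ tri-∈₂) p)) , links′
      where
      edges′ : faces Δ 2 + (ν Δ (⁅ x ⁆ ∪ ⁅ y ⁆) + (ν Δ (⁅ x ⁆ ∪ ⁅ z ⁆) + ν Δ (⁅ y ⁆ ∪ ⁅ z ⁆))) + 3 ≡ 2 * length vs + suc a
      edges′ rewrite ν-new Δ ¬xy | ν-old Δ xz | ν-old Δ yz =
        trans (eq (faces Δ 2)) (trans (cong suc M.edges) (sym (+-suc (2 * length vs) a)))
        where
        eq : ∀ f → f + 1 + 3 ≡ suc (f + 3)
        eq = solve-∀

  -- The complement of the edge graph loses the path x – w – y – v, h₃ drops by one and h₂ grows by three.
  module _ {Δ vs a s} {x w y v : Fin n} (x≢y : x ≢ y) (w≢v : w ≢ v) (x≢w : x ≢ w) (y≢w : y ≢ w) (y≢v : y ≢ v) (x≢v : x ≢ v)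
    (xy : Adj Δ x y) (wv : Adj Δ w v) (¬xw : ¬ Adj Δ x w) (¬yw : ¬ Adj Δ y w) (¬yv : ¬ Adj Δ y v)
    (st : State Δ vs a s) where

    private
      open module M = Core (proj₁ st)
      links = proj₂ st
      Δ₁ = Δ ⊕ tri₃ x y w
      Δ₂ = Δ₁ ⊕ tri₃ y w v
      x∈ : x ∈ vs
      x∈ = adj⇒∈ xy
      y∈ : y ∈ vs
      y∈ = adj⇒∈ (adj-sym {Δ = Δ} {x} {y} xy)
      w∈ : w ∈ vs
      w∈ = adj⇒∈ wv
      v∈ : v ∈ vs
      v∈ = adj⇒∈ (adj-sym {Δ = Δ} {w} {v} wv)
      xyw⊆ : ∀ {i} → i ∈ₛ tri₃ x y w → i ∈ vs
      xyw⊆ i∈ with tri-∈⁻ i∈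
      ... | inj₁ refl        = x∈
      ... | inj₂ (inj₁ refl) = y∈
      ... | inj₂ (inj₂ refl) = w∈
      ywv⊆ : ∀ {i} → i ∈ₛ tri₃ y w v → i ∈ vs
      ywv⊆ i∈ with tri-∈⁻ i∈
      ... | inj₁ refl        = y∈
      ... | inj₂ (inj₁ refl) = w∈
      ... | inj₂ (inj₂ refl) = v∈
      v∉xyw : v ∉ₛ tri₃ x y w
      v∉xyw = tri-∉ (x≢v ∘ sym) (y≢v ∘ sym) (w≢v ∘ sym)
      ¬yv₁ : ¬ Adj Δ₁ y v
      ¬yv₁ p with adj-⊕⁻ {Δ = Δ} p
      ... | inj₁ q       = ¬yv q
      ... | inj₂ (_ , q) = v∉xyw q
      -- Only a `Core`: after the first triangle the edge from `x` to `y` is a separate component of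
      -- the link of `w`, and the second triangle ties it to `v`.
      core₁ : Core Δ₁ vs (2 + a) (1 + s)
      core₁ = attach x≢y x≢w y≢w (proj₁ st) id inj₁ xyw⊆ w∈ edges′ triangles′
        where
        edges′ : faces Δ 2 + (ν Δ (⁅ x ⁆ ∪ ⁅ y ⁆) + (ν Δ (⁅ x ⁆ ∪ ⁅ w ⁆) + ν Δ (⁅ y ⁆ ∪ ⁅ w ⁆))) + 3 ≡ 2 * length vs + (2 + a)
        edges′ rewrite ν-old Δ xy | ν-new Δ ¬xw | ν-new Δ ¬yw = trans (eq₁ (faces Δ 2)) (trans (cong (2 +_) M.edges) (eq₂ (2 * length vs) a))
          where
          eq₁ : ∀ f → f + 2 + 3 ≡ 2 + (f + 3)
          eq₁ = solve-∀
          eq₂ : ∀ l a → 2 + (l + a) ≡ l + (2 + a)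
          eq₂ = solve-∀
        triangles′ : faces Δ 3 + ν Δ (tri₃ x y w) + 2 ≡ length vs + (1 + s)
        triangles′ rewrite ν-new Δ {tri₃ x y w} (λ p → ¬xw (closed _ _ (adj⊆ tri-∈₁ tri-∈₃) p)) =
          trans (eq (faces Δ 3)) (trans (cong suc M.triangles) (sym (+-suc (length vs) s)))
          where
          eq : ∀ f → f + 1 + 2 ≡ suc (f + 2)
          eq = solve-∀
      core₂ : Core Δ₂ vs (3 + a) (2 + s)
      core₂ = attach y≢w y≢v w≢v core₁ id inj₁ ywv⊆ v∈ edges′ triangles′
        where
        module M₁ = Core core₁
        edges′ : faces Δ₁ 2 + (ν Δ₁ (⁅ y ⁆ ∪ ⁅ w ⁆) + (ν Δ₁ (⁅ y ⁆ ∪ ⁅ v ⁆) + ν Δ₁ (⁅ w ⁆ ∪ ⁅ v ⁆))) + 3 ≡ 2 * length vs + (3 + a)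
        edges′ rewrite ν-old Δ₁ {⁅ y ⁆ ∪ ⁅ w ⁆} (adj-⊕ʳ {Δ = Δ} {tri₃ x y w} tri-∈₂ tri-∈₃) | ν-new Δ₁ ¬yv₁
                     | ν-old Δ₁ {⁅ w ⁆ ∪ ⁅ v ⁆} (adj-⊕ˡ {Δ = Δ} {tri₃ x y w} {w} {v} wv) =
          trans (eq (faces Δ₁ 2)) (trans (cong suc M₁.edges) (sym (+-suc (2 * length vs) (2 + a))))
          where
          eq : ∀ f → f + 1 + 3 ≡ suc (f + 3)
          eq = solve-∀
        triangles′ : faces Δ₁ 3 + ν Δ₁ (tri₃ y w v) + 2 ≡ length vs + (2 + s)
        triangles′ rewrite ν-new Δ₁ {tri₃ y w v} (λ p → ¬yv₁ (M₁.closed _ _ (adj⊆ tri-∈₁ tri-∈₃) p)) =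
          trans (eq (faces Δ₁ 3)) (trans (cong suc M₁.triangles) (sym (+-suc (length vs) (1 + s))))
          where
          eq : ∀ f → f + 1 + 2 ≡ suc (f + 2)
          eq = solve-∀
      links′ : ∀ u → LinkConnected Δ₂ u
      links′ u with u Finₚ.≟ w
      ... | yes refl = link-strip {Δ} x≢w y≢w (w≢v ∘ sym) wv (links w)
      ... | no u≢w with u Finₚ.≟ y
      ...   | yes refl = link-anchor {Δ₁} (y≢w ∘ sym) (y≢v ∘ sym) tri-∈₁ tri-∈₂ tri-∈₃ tri-∈⁻
                (adj-⊕ʳ {Δ = Δ} {tri₃ x y w} tri-∈₂ tri-∈₃)
                (link-anchor {Δ} x≢y (y≢w ∘ sym) tri-∈₂ tri-∈₁ tri-∈₃ tri-∈⁻-yxz (adj-sym {Δ = Δ} {x} {y} xy) (links y))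
      ...   | no u≢y with u Finₚ.≟ x
      ...     | yes refl = link-∉ {Δ₁} (tri-∉ x≢y x≢w x≢v)
                  (link-anchor {Δ} (x≢y ∘ sym) (x≢w ∘ sym) tri-∈₁ tri-∈₂ tri-∈₃ tri-∈⁻ xy (links x))
      ...     | no u≢x with u Finₚ.≟ v
      ...       | yes refl = link-anchor {Δ₁} w≢v y≢v tri-∈₃ tri-∈₂ tri-∈₁ (swap₂₃ ∘ tri-∈⁻-zxy)
                    (adj-⊕ˡ {Δ = Δ} {tri₃ x y w} {v} {w} (adj-sym {Δ = Δ} {w} {v} wv)) (link-∉ {Δ} v∉xyw (links v))
      ...       | no u≢v = link-∉ {Δ₁} (tri-∉ u≢y u≢w u≢v) (link-∉ {Δ} (tri-∉ u≢x u≢y u≢w) (links u))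

    strip : State (Δ ⊕ tri₃ x y w ⊕ tri₃ y w v) vs (3 + a) (2 + s)
    strip = core₂ , links′

-- Complexes with h₃ negative

-- ⌊C(N − 2, 2) / 3⌋
quota : ℕ → ℕ
quota zero                = 0
quota (suc zero)          = 0
quota (suc (suc zero))    = 0
quota (suc (suc (suc N))) = quota N + (N ∸ 1)

-- Three more vertices enlarge `tri` by exactly three times the gain of `quota`, so the estimate is
-- inherited in steps of three.
quota-max : ∀ m → tri m < 3 * suc (quota (2 + m))
quota-max zero                = s≤s z≤n
quota-max (suc zero)          = s≤s z≤n
quota-max (suc (suc zero))    = s≤s (s≤s z≤n)
quota-max (suc (suc (suc m))) = begin-strict
  2 + m + (1 + m + (m + tri m))               ≡⟨ eq₁ m (tri m) ⟩
  tri m + 3 * (1 + m)                         <⟨ +-monoˡ-< (3 * (1 + m)) (quota-max m) ⟩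
  3 * suc (quota (2 + m)) + 3 * (1 + m)       ≡⟨ eq₂ m (quota (2 + m)) ⟩
  3 * suc (quota (2 + m) + (1 + m))           ∎
  where
  open ≤-Reasoning
  eq₁ : ∀ m x → 2 + m + (1 + m + (m + x)) ≡ x + 3 * (1 + m)
  eq₁ = solve-∀
  eq₂ : ∀ m x → 3 * suc x + 3 * (1 + m) ≡ 3 * suc (x + (1 + m))
  eq₂ = solve-∀

module _ {n : ℕ} where

  some-edge : ∀ {Δ : Complex n} {vs a s u} → State Δ vs a s → u ∈ vs → ∃₂ λ v w → v ≢ w × Adj Δ v w
  some-edge {u = u} (core , _) u∈ with Core.pure core ⁅ u ⁆ (Core.vertex⁺ core u∈)
  ... | G , _ , ΔG , ∣G∣≡3 with two-elements {F = G} (≤-trans (n≤1+n 2) (≤-reflexive (sym ∣G∣≡3)))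
  ...   | v , w , v∈ , w∈ , v≢w = v , w , v≢w , Core.closed core G _ (adj⊆ v∈ w∈) ΔG

  glue-all : ∀ {Δ : Complex n} {vs a s u} xs → Unique (xs ++ vs) → u ∈ vs → State Δ vs a s →
    ∃ λ Δ′ → State Δ′ (xs ++ vs) a s
  glue-all []       _         u∈ st = _ , st
  glue-all (x ∷ xs) (x≢ ∷ uq) u∈ st with glue-all xs uq u∈ st
  ... | Δ′ , st′ with some-edge st′ (∈-++⁺ʳ xs u∈)
  ...   | v , w , v≢w , vw = _ , glue (λ x∈ → All.lookup x≢ x∈ refl) v≢w vw st′

  empty : Complex n
  empty _ = false

  triangle : ∀ {x y z} → x ≢ y → x ≢ z → y ≢ z → State (empty ⊕ tri₃ x y z) (x ∷ y ∷ z ∷ []) 0 0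
  triangle {x} {y} {z} x≢y x≢z y≢z = record
    { closed    = λ F G G⊆F p → ⊕⁺ʳ {Δ = empty} {t} (λ i∈ → inner p (G⊆F i∈))
    ; pure      = λ F p → t , inner p , ⊕⁺ʳ {Δ = empty} {t} id , ∣triple∣ x≢y x≢z y≢z
    ; vertex⁻   = λ {i} p → corner⁻ (tri-∈⁻ (inner {⁅ i ⁆} p (x∈⁅x⁆ i)))
    ; vertex⁺   = λ i∈ → ⊕⁺ʳ {Δ = empty} {t} (⁅⁆⊆ (corner⁺ i∈))
    ; connected = λ u v p q → step here (adj-⊕ʳ {Δ = empty} {t} (inner {⁅ u ⁆} p (x∈⁅x⁆ u)) (inner {⁅ v ⁆} q (x∈⁅x⁆ v)))
    ; edges     = cong (_+ 3) (trans (faces-⊕-2 x≢y x≢z y≢z empty) (cong (_+ 3) (no-faces 2)))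
    ; triangles = cong (_+ 2) (trans (faces-⊕-3 x≢y x≢z y≢z empty) (cong (_+ 1) (no-faces 3)))
    } , links
    where
    t = tri₃ x y z
    no-faces : ∀ k → faces empty k ≡ 0
    no-faces k = trans (faces-ΣS empty k) (ΣS-zero n k _ λ _ → refl)
    inner : ∀ {F} → T ((empty ⊕ t) F) → F ⊆ₛ t
    inner {F} p with ⊕⁻ {Δ = empty} {t} F p
    ... | inj₂ F⊆t = F⊆t
    corner⁻ : ∀ {i} → i ≡ x ⊎ i ≡ y ⊎ i ≡ z → i ∈ x ∷ y ∷ z ∷ []
    corner⁻ (inj₁ e)        = here e
    corner⁻ (inj₂ (inj₁ e)) = there (here e)
    corner⁻ (inj₂ (inj₂ e)) = there (there (here e))
    corner⁺ : ∀ {i} → i ∈ x ∷ y ∷ z ∷ [] → i ∈ₛ t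
    corner⁺ (here refl)                 = tri-∈₁
    corner⁺ (there (here refl))         = tri-∈₂
    corner⁺ (there (there (here refl))) = tri-∈₃
    links : ∀ v → LinkConnected (empty ⊕ t) v
    links v with v Finₚ.≟ x | v Finₚ.≟ y | v Finₚ.≟ z
    ... | yes refl | _ | _ = link-fresh {Δ = empty} (x≢y ∘ sym) (x≢z ∘ sym) tri-∈₁ tri-∈₂ tri-∈₃ tri-∈⁻ (λ _ p → p)
    ... | no _ | yes refl | _ = link-fresh {Δ = empty} x≢y (y≢z ∘ sym) tri-∈₂ tri-∈₁ tri-∈₃ tri-∈⁻-yxz (λ _ p → p)
    ... | no _ | no _ | yes refl = link-fresh {Δ = empty} x≢z y≢z tri-∈₃ tri-∈₁ tri-∈₂ tri-∈⁻-zxy (λ _ p → p)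
    ... | no p | no q | no r = link-∉ {Δ = empty} (tri-∉ p q r) λ _ _ _ _ ()

  -- A strip recorded by its adjacency conditions alone, without counts or links. A sequence of
  -- moves can thus be planned first and cut short at any point, which supplies every intermediate
  -- value of h₃.
  data Move (Δ : Complex n) : Complex n → Set where
    move : ∀ x w y v → x ≢ y → w ≢ v → x ≢ w → y ≢ w → y ≢ v → x ≢ v → Adj Δ x y → Adj Δ w v →
      ¬ Adj Δ x w → ¬ Adj Δ y w → ¬ Adj Δ y v → Move Δ (Δ ⊕ tri₃ x y w ⊕ tri₃ y w v)

  data Run : ℕ → Complex n → Complex n → Set where
    []  : ∀ {Δ} → Run 0 Δ Δ
    _∷_ : ∀ {k Δ Δ′ Δ″} → Move Δ Δ′ → Run k Δ′ Δ″ → Run (suc k) Δ Δ″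

  move-state : ∀ {Δ Δ′ vs a s} → Move Δ Δ′ → State Δ vs a s → State Δ′ vs (3 + a) (2 + s)
  move-state (move x w y v p₁ p₂ p₃ p₄ p₅ p₆ q₁ q₂ r₁ r₂ r₃) = strip p₁ p₂ p₃ p₄ p₅ p₆ q₁ q₂ r₁ r₂ r₃

  run-end : ∀ {k Δ Δ′ vs a s} → Run k Δ Δ′ → State Δ vs a s → State Δ′ vs (3 * k + a) (2 * k + s)
  run-end [] st = st
  run-end {suc k} {a = a} {s} (m ∷ r) st = subst₂ (State _ _) (eq₁ k a) (eq₂ k s) (run-end r (move-state m st))
    where
    eq₁ : ∀ k a → 3 * k + (3 + a) ≡ 3 * suc k + a
    eq₁ = solve-∀
    eq₂ : ∀ k a → 2 * k + (2 + a) ≡ 2 * suc k + a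
    eq₂ = solve-∀

  run-prefix : ∀ {k Δ Δ′} → Run k Δ Δ′ → ∀ j → j ≤ k → ∃ λ Δ″ → Run j Δ Δ″
  run-prefix r       zero    _         = _ , []
  run-prefix (m ∷ r) (suc j) (s≤s j≤k) with run-prefix r j j≤k
  ... | Δ″ , r′ = Δ″ , m ∷ r′

  move-mono : ∀ {Δ Δ′ i j} → Move Δ Δ′ → Adj Δ i j → Adj Δ′ i j
  move-mono {Δ} {i = i} {j} (move x w y v _ _ _ _ _ _ _ _ _ _ _) p =
    adj-⊕ˡ {Δ = Δ ⊕ tri₃ x y w} {tri₃ y w v} {i} {j} (adj-⊕ˡ {Δ = Δ} {tri₃ x y w} {i} {j} p)

  run-mono : ∀ {k Δ Δ′ i j} → Run k Δ Δ′ → Adj Δ i j → Adj Δ′ i j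
  run-mono []      p = p
  run-mono {i = i} {j} (m ∷ r) p = run-mono {i = i} {j} r (move-mono {i = i} {j} m p)

  ¬adj-⊕ : ∀ (Δ : Complex n) t i j → ¬ Adj Δ i j → i ∉ₛ t ⊎ j ∉ₛ t → ¬ Adj (Δ ⊕ t) i j
  ¬adj-⊕ Δ t i j ¬ij out p with adj-⊕⁻ {Δ = Δ} {t} {i} {j} p | out
  ... | inj₁ q        | _       = ¬ij q
  ... | inj₂ (q , _)  | inj₁ i∉ = i∉ q
  ... | inj₂ (_ , q)  | inj₂ j∉ = j∉ q

  ¬adj-⊕² : ∀ (Δ : Complex n) t t′ i j → ¬ Adj Δ i j → i ∉ₛ t ⊎ j ∉ₛ t → i ∉ₛ t′ ⊎ j ∉ₛ t′ → ¬ Adj (Δ ⊕ t ⊕ t′) i j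
  ¬adj-⊕² Δ t t′ i j ¬ij o o′ = ¬adj-⊕ (Δ ⊕ t) t′ i j (¬adj-⊕ Δ t i j ¬ij o) o′

  data Pairs (Δ : Complex n) : List (Fin n) → Set where
    []   : Pairs Δ []
    pair : ∀ {p q r} → Adj Δ p q → Pairs Δ r → Pairs Δ (p ∷ q ∷ r)

  pairs-mono : ∀ {Δ Δ′ r} → (∀ {i j} → Adj Δ i j → Adj Δ′ i j) → Pairs Δ r → Pairs Δ′ r
  pairs-mono f []                   = []
  pairs-mono f (pair {p} {q} pq ps) = pair (f {p} {q} pq) (pairs-mono (λ {i} {j} → f {i} {j}) ps)

  -- The six missing edges between {a, b, c} and an adjacent pair p, q form the paths a – p – b – q and p – c – q – a.
  pairs-run : ∀ {a b c} → a ≢ b → a ≢ c → b ≢ c → ∀ {Δ r} → Pairs Δ r → Unique r →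
    All (a ≢_) r → All (b ≢_) r → All (c ≢_) r → Adj Δ a b → Adj Δ a c →
    (∀ p → p ∈ r → ¬ Adj Δ a p × ¬ Adj Δ b p × ¬ Adj Δ c p) → ∃ λ Δ′ → Run (length r) Δ Δ′
  pairs-run a≢b a≢c b≢c [] _ _ _ _ _ _ _ = _ , []
  pairs-run {a} {b} {c} a≢b a≢c b≢c {Δ} (pair {p} {q} {r} pq ps) ((p≢q ∷ p≢r) ∷ q≢r ∷ uq)
    (a≢p ∷ a≢q ∷ a≢r) (b≢p ∷ b≢q ∷ b≢r) (c≢p ∷ c≢q ∷ c≢r) ab ac fresh =
    proj₁ rest , move₁ ∷ move₂ ∷ proj₂ rest
    where
    Δ₁ = Δ ⊕ tri₃ a b p ⊕ tri₃ b p q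
    Δ₂ = Δ₁ ⊕ tri₃ p q c ⊕ tri₃ q c a
    move₁ : Move Δ Δ₁
    move₁ = move a p b q a≢b p≢q a≢p b≢p b≢q a≢q ab pq (proj₁ (fresh p (here refl)))
      (proj₁ (proj₂ (fresh p (here refl)))) (proj₁ (proj₂ (fresh q (there (here refl)))))
    c∉₁ : c ∉ₛ tri₃ a b p
    c∉₁ = tri-∉ (a≢c ∘ sym) (b≢c ∘ sym) c≢p
    c∉₂ : c ∉ₛ tri₃ b p q
    c∉₂ = tri-∉ (b≢c ∘ sym) c≢p c≢q
    ¬pc : ¬ Adj Δ₁ p c
    ¬pc = ¬adj-⊕² Δ (tri₃ a b p) (tri₃ b p q) p c (proj₂ (proj₂ (fresh p (here refl))) ∘ adj-sym {Δ = Δ} {p} {c}) (inj₂ c∉₁) (inj₂ c∉₂)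
    ¬qc : ¬ Adj Δ₁ q c
    ¬qc = ¬adj-⊕² Δ (tri₃ a b p) (tri₃ b p q) q c (proj₂ (proj₂ (fresh q (there (here refl)))) ∘ adj-sym {Δ = Δ} {q} {c}) (inj₂ c∉₁) (inj₂ c∉₂)
    ¬qa : ¬ Adj Δ₁ q a
    ¬qa = ¬adj-⊕² Δ (tri₃ a b p) (tri₃ b p q) q a
      (proj₁ (fresh q (there (here refl))) ∘ adj-sym {Δ = Δ} {q} {a}) (inj₁ (tri-∉ (a≢q ∘ sym) (b≢q ∘ sym) (p≢q ∘ sym)))
      (inj₂ (tri-∉ a≢b a≢p a≢q))
    move₂ : Move Δ₁ Δ₂
    move₂ = move p c q a p≢q (a≢c ∘ sym) (c≢p ∘ sym) (c≢q ∘ sym) (a≢q ∘ sym) (a≢p ∘ sym)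
      (move-mono {i = p} {q} move₁ pq) (move-mono {i = c} {a} move₁ (adj-sym {Δ = Δ} {a} {c} ac)) ¬pc ¬qc ¬qa
    grow : ∀ {i j} → Adj Δ i j → Adj Δ₂ i j
    grow {i} {j} e = move-mono {i = i} {j} move₂ (move-mono {i = i} {j} move₁ e)
    fresh′ : ∀ v → v ∈ r → ¬ Adj Δ₂ a v × ¬ Adj Δ₂ b v × ¬ Adj Δ₂ c v
    fresh′ v v∈ with fresh v (there (there v∈))
    ... | ¬av , ¬bv , ¬cv = keep a ¬av , keep b ¬bv , keep c ¬cv
      where
      v≢ : ∀ {x} → All (x ≢_) r → v ≢ x
      v≢ x≢ v≡x = All.lookup x≢ v∈ (sym v≡x)
      keep : ∀ x → ¬ Adj Δ x v → ¬ Adj Δ₂ x v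
      keep x ¬xv = ¬adj-⊕² Δ₁ (tri₃ p q c) (tri₃ q c a) x v
        (¬adj-⊕² Δ (tri₃ a b p) (tri₃ b p q) x v ¬xv
          (inj₂ (tri-∉ (v≢ a≢r) (v≢ b≢r) (v≢ p≢r))) (inj₂ (tri-∉ (v≢ b≢r) (v≢ p≢r) (v≢ q≢r))))
        (inj₂ (tri-∉ (v≢ p≢r) (v≢ q≢r) (v≢ c≢r))) (inj₂ (tri-∉ (v≢ q≢r) (v≢ c≢r) (v≢ a≢r)))
    rest = pairs-run a≢b a≢c b≢c (pairs-mono (λ {i} {j} → grow {i} {j}) ps) uq a≢r b≢r c≢r
      (grow {a} {b} ab) (grow {a} {c} ac) fresh′

  -- What one round leaves for the next: an edge `u w` to glue on, and a matching of the other
  -- vertices; if the number of vertices is odd, the leftover `z` forms a triangle with `u` and `w`.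
  data Paired (Δ : Complex n) : List (Fin n) → Set where
    even : ∀ {u w r} → Adj Δ u w → Pairs Δ r → Paired Δ (u ∷ w ∷ r)
    odd  : ∀ {u w z r} → Adj Δ u w → Adj Δ u z → Adj Δ w z → Pairs Δ r → Paired Δ (u ∷ w ∷ z ∷ r)

  -- Only `top`, where `Q` strips have been used, is extended by further strips. The lower values
  -- survive the passage to more vertices by gluing, so they need no pairing.
  record Ladder (vs : List (Fin n)) (Q : ℕ) : Set where
    field
      rungs  : ∀ q → q ≤ Q → ∃ λ Δ → State Δ vs (3 * q) (2 * q)
      top    : Complex n
      state  : State top vs (3 * Q) (2 * Q)
      paired : Paired top vs

  climb : ∀ {vs Q k Δ Δ′} → (∀ q → q ≤ Q → ∃ λ Δ → State Δ vs (3 * q) (2 * q)) → State Δ vs (3 * Q) (2 * Q) →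
    Run k Δ Δ′ → Paired Δ′ vs → Ladder vs (Q + k)
  climb {vs} {Q} {k} {Δ} {Δ′} low st run prd = record
    { rungs = rungs ; top = Δ′ ; state = shift (run-end run st) ; paired = prd }
    where
    shift : ∀ {Δ k} → State Δ vs (3 * k + 3 * Q) (2 * k + 2 * Q) → State Δ vs (3 * (Q + k)) (2 * (Q + k))
    shift {Δ} {k} = subst₂ (State Δ vs) (eq₁ k Q) (eq₂ k Q)
      where
      eq₁ : ∀ k Q → 3 * k + 3 * Q ≡ 3 * (Q + k)
      eq₁ = solve-∀
      eq₂ : ∀ k Q → 2 * k + 2 * Q ≡ 2 * (Q + k)
      eq₂ = solve-∀
    rungs : ∀ q → q ≤ Q + k → ∃ λ Δ → State Δ vs (3 * q) (2 * q)
    rungs q q≤ with q ≤? Q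
    ... | yes q≤Q = low q q≤Q
    ... | no q≰Q with m≤n⇒∃[o]m+o≡n (≰⇒≥ q≰Q)
    ...   | j , refl with run-prefix run j (+-cancelˡ-≤ Q j k q≤)
    ...     | Δ″ , run′ = Δ″ , shift (run-end run′ st)

  -- Three new vertices a, b, c are glued on uw, au and ab.
  module Glued {Δ : Complex n} {c b a u w : Fin n} {r : List (Fin n)} {h s : ℕ}
    (uq : Unique (c ∷ b ∷ a ∷ u ∷ w ∷ r)) (uw : Adj Δ u w) (st : State Δ (u ∷ w ∷ r) h s) where

    private
      ∉-from : ∀ {x : Fin n} {xs} → All (x ≢_) xs → x ∉ xs
      ∉-from x≢ x∈ = All.lookup x≢ x∈ refl
      Δa = Δ ⊕ tri₃ a u w
      Δb = Δa ⊕ tri₃ b a u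

    Δ₃ : Complex n
    Δ₃ = Δb ⊕ tri₃ c a b

    old : ∀ {i j} → Adj Δ i j → Adj Δ₃ i j
    old {i} {j} e = adj-⊕ˡ {Δ = Δb} {tri₃ c a b} {i} {j}
      (adj-⊕ˡ {Δ = Δa} {tri₃ b a u} {i} {j} (adj-⊕ˡ {Δ = Δ} {tri₃ a u w} {i} {j} e))

    glued : State Δ₃ (c ∷ b ∷ a ∷ u ∷ w ∷ r) h s
    glued = case uq of λ
      { (c≢@(_ ∷ _ ∷ _) ∷ b≢@(b≢a ∷ _) ∷ a≢@(a≢u ∷ _) ∷ (u≢w ∷ _) ∷ _) →
      glue (∉-from c≢) (b≢a ∘ sym) (adj-⊕ʳ {Δ = Δa} {tri₃ b a u} tri-∈₂ tri-∈₁)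
        (glue (∉-from b≢) a≢u (adj-⊕ʳ {Δ = Δ} {tri₃ a u w} tri-∈₁ tri-∈₂) (glue (∉-from a≢) u≢w uw st)) }

    cb : Adj Δ₃ c b
    cb = adj-⊕ʳ {Δ = Δb} {tri₃ c a b} tri-∈₁ tri-∈₃

    ca : Adj Δ₃ c a
    ca = adj-⊕ʳ {Δ = Δb} {tri₃ c a b} tri-∈₁ tri-∈₂

    ba : Adj Δ₃ b a
    ba = adj-⊕ʳ {Δ = Δb} {tri₃ c a b} tri-∈₃ tri-∈₂

    ab : Adj Δ₃ a b
    ab = adj-⊕ʳ {Δ = Δb} {tri₃ c a b} tri-∈₂ tri-∈₃

    ac : Adj Δ₃ a c
    ac = adj-⊕ʳ {Δ = Δb} {tri₃ c a b} tri-∈₂ tri-∈₁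

    au : Adj Δ₃ a u
    au = adj-⊕ˡ {Δ = Δb} {tri₃ c a b} {a} {u} (adj-⊕ʳ {Δ = Δa} {tri₃ b a u} tri-∈₂ tri-∈₃)

    private
      unjoined : ∀ x v → All (x ≢_) (u ∷ w ∷ r) → x ∉ₛ tri₃ a u w ⊎ v ∉ₛ tri₃ a u w →
        x ∉ₛ tri₃ b a u ⊎ v ∉ₛ tri₃ b a u → v ∉ₛ tri₃ c a b → ¬ Adj Δ₃ x v
      unjoined x v x≢ o₁ o₂ v∉ = ¬adj-⊕ Δb (tri₃ c a b) x v
        (¬adj-⊕² Δ (tri₃ a u w) (tri₃ b a u) x v (λ e → ∉-from x≢ (Core.adj⇒∈ (proj₁ st) {x} {v} e)) o₁ o₂) (inj₂ v∉)

      old∉ : ∀ {v} → v ∈ u ∷ w ∷ r → v ∉ₛ tri₃ c a b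
      old∉ v∈ = case uq of λ
        { ((_ ∷ _ ∷ c≢) ∷ (_ ∷ b≢) ∷ a≢ ∷ _) →
        tri-∉ (All.lookup c≢ v∈ ∘ sym) (All.lookup a≢ v∈ ∘ sym) (All.lookup b≢ v∈ ∘ sym) }

    -- Among the old vertices `c` misses all, `b` all but `u`, and `a` all but `u` and `w`. With N
    -- old vertices these are 3(N - 1) missing edges, three for each of the N - 1 strips to come.
    ¬c : ∀ v → v ∈ u ∷ w ∷ r → ¬ Adj Δ₃ c v
    ¬c v v∈ = case uq of λ
      { ((c≢b ∷ c≢a ∷ c≢vs@(c≢u ∷ c≢w ∷ _)) ∷ _) →
      unjoined c v c≢vs (inj₁ (tri-∉ c≢a c≢u c≢w)) (inj₁ (tri-∉ c≢b c≢a c≢u)) (old∉ v∈) }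

    ¬b : ∀ v → v ∈ w ∷ r → ¬ Adj Δ₃ b v
    ¬b v v∈ = case uq of λ
      { (_ ∷ (b≢a ∷ b≢vs@(b≢u ∷ b≢w ∷ _)) ∷ (_ ∷ a≢) ∷ (u≢ ∷ _)) →
      unjoined b v b≢vs (inj₁ (tri-∉ b≢a b≢u b≢w))
        (inj₂ (tri-∉ (All.lookup (All.tail b≢vs) v∈ ∘ sym) (All.lookup a≢ v∈ ∘ sym) (All.lookup u≢ v∈ ∘ sym))) (old∉ (there v∈)) }

    ¬a : ∀ v → v ∈ r → ¬ Adj Δ₃ a v
    ¬a v v∈ = case uq of λ
      { (_ ∷ (b≢a ∷ _ ∷ _ ∷ b≢) ∷ a≢vs@(_ ∷ _ ∷ a≢) ∷ (_ ∷ u≢) ∷ w≢ ∷ _) →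
      unjoined a v a≢vs (inj₂ (tri-∉ (All.lookup a≢ v∈ ∘ sym) (All.lookup u≢ v∈ ∘ sym) (All.lookup w≢ v∈ ∘ sym)))
        (inj₂ (tri-∉ (All.lookup b≢ v∈ ∘ sym) (All.lookup a≢ v∈ ∘ sym) (All.lookup u≢ v∈ ∘ sym))) (old∉ (there (there v∈))) }

  -- After gluing, the missing edges at the new vertices form the path u – c – w – b if |vs| is even, and the two paths
  -- a – z – c – u, c – w – b – z if it is odd, besides two paths for each of the remaining pairs.
  ladder-step : ∀ {c b a vs Q} → Unique (c ∷ b ∷ a ∷ vs) → Ladder vs Q → Ladder (c ∷ b ∷ a ∷ vs) (Q + (length vs ∸ 1))
  ladder-step {c} {b} {a} {vs} {Q} uq ladder = go uq low (Ladder.paired ladder) (Ladder.state ladder)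
    where
    first : ∀ {Δ vs} → Paired Δ vs → ∃ λ u → u ∈ vs
    first (even _ _)    = _ , here refl
    first (odd _ _ _ _) = _ , here refl
    Rungs : List (Fin n) → Set
    Rungs vs = ∀ q → q ≤ Q → ∃ λ Δ → State Δ (c ∷ b ∷ a ∷ vs) (3 * q) (2 * q)
    low : Rungs vs
    low q q≤Q = glue-all (c ∷ b ∷ a ∷ []) uq (proj₂ (first (Ladder.paired ladder))) (proj₂ (Ladder.rungs ladder q q≤Q))
    go : ∀ {Δ vs} → Unique (c ∷ b ∷ a ∷ vs) → Rungs vs → Paired Δ vs → State Δ vs (3 * Q) (2 * Q) →
      Ladder (c ∷ b ∷ a ∷ vs) (Q + (length vs ∸ 1))
    go {Δ} {u ∷ w ∷ r} uq@((c≢b ∷ c≢a ∷ c≢u ∷ c≢w ∷ c≢r) ∷ (b≢a ∷ b≢u ∷ b≢w ∷ b≢r) ∷ (_ ∷ _ ∷ a≢r) ∷ (u≢w ∷ u≢r) ∷ w≢r ∷ uqr)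
      low (even uw ps) st =
      climb low glued (move₁ ∷ proj₂ rest)
        -- The number of vertices has become odd: `c`, `b`, `a` are the triangle, and `u w` joins
        -- the matching.
        (odd (to-end {c} {b} cb) (to-end {c} {a} ca) (to-end {b} {a} ba)
          (pair (to-end {u} {w} (old {u} {w} uw)) (pairs-mono (λ {i} {j} e → to-end {i} {j} (old {i} {j} e)) ps)))
      where
      open Glued {Δ} {c} {b} {a} {u} {w} {r} uq uw st
      Δ₄ = Δ₃ ⊕ tri₃ u w c ⊕ tri₃ w c b
      move₁ : Move Δ₃ Δ₄
      move₁ = move u c w b u≢w c≢b (c≢u ∘ sym) (c≢w ∘ sym) (b≢w ∘ sym) (b≢u ∘ sym) (old {u} {w} uw) cb
        (¬c u (here refl) ∘ adj-sym {Δ = Δ₃} {u} {c}) (¬c w (there (here refl)) ∘ adj-sym {Δ = Δ₃} {w} {c})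
        (¬b w (here refl) ∘ adj-sym {Δ = Δ₃} {w} {b})
      fresh : ∀ p → p ∈ r → ¬ Adj Δ₄ a p × ¬ Adj Δ₄ b p × ¬ Adj Δ₄ c p
      fresh p p∈ = keep a (¬a p p∈) , keep b (¬b p (there p∈)) , keep c (¬c p (there (there p∈)))
        where
        p≢ : ∀ {x} → All (x ≢_) r → p ≢ x
        p≢ x≢ p≡x = All.lookup x≢ p∈ (sym p≡x)
        keep : ∀ x → ¬ Adj Δ₃ x p → ¬ Adj Δ₄ x p
        keep x ¬xp = ¬adj-⊕² Δ₃ (tri₃ u w c) (tri₃ w c b) x p ¬xp
          (inj₂ (tri-∉ (p≢ u≢r) (p≢ w≢r) (p≢ c≢r))) (inj₂ (tri-∉ (p≢ w≢r) (p≢ c≢r) (p≢ b≢r)))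
      rest = pairs-run (b≢a ∘ sym) (c≢a ∘ sym) (c≢b ∘ sym)
        (pairs-mono (λ {i} {j} e → move-mono {i = i} {j} move₁ (old {i} {j} e)) ps) uqr a≢r b≢r c≢r
        (move-mono {i = a} {b} move₁ ab) (move-mono {i = a} {c} move₁ ac) fresh
      to-end : ∀ {i j} → Adj Δ₃ i j → Adj (proj₁ rest) i j
      to-end {i} {j} e = run-mono {i = i} {j} (move₁ ∷ proj₂ rest) e
    go {Δ} {u ∷ w ∷ z ∷ r} uq@((c≢b ∷ c≢a ∷ c≢u ∷ c≢w ∷ c≢z ∷ c≢r) ∷ (b≢a ∷ b≢u ∷ b≢w ∷ b≢z ∷ b≢r) ∷
        (a≢u ∷ a≢w ∷ a≢z ∷ a≢r) ∷ (u≢w ∷ u≢z ∷ u≢r) ∷ (w≢z ∷ w≢r) ∷ z≢r ∷ uqr)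
      low (odd uw uz wz ps) st =
      climb low glued (move₁ ∷ move₂ ∷ proj₂ rest)
        -- The number of vertices has become even: `c b` is the next edge to glue on, and the old
        -- triangle is split up into the pairs `a u` and `w z`.
        (even (to-end {c} {b} cb) (pair (to-end {a} {u} au) (pair (to-end {w} {z} (old {w} {z} wz))
          (pairs-mono (λ {i} {j} e → to-end {i} {j} (old {i} {j} e)) ps))))
      where
      open Glued {Δ} {c} {b} {a} {u} {w} {z ∷ r} uq uw st
      Δ₄ = Δ₃ ⊕ tri₃ a c z ⊕ tri₃ c z u
      move₁ : Move Δ₃ Δ₄
      move₁ = move a z c u (c≢a ∘ sym) (u≢z ∘ sym) a≢z c≢z c≢u a≢u ac (adj-sym {Δ = Δ₃} {u} {z} (old {u} {z} uz))
        (¬a z (here refl)) (¬c z (there (there (here refl)))) (¬c u (here refl))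
      keep₁ : ∀ i j → ¬ Adj Δ₃ i j → i ∉ₛ tri₃ a c z ⊎ j ∉ₛ tri₃ a c z → i ∉ₛ tri₃ c z u ⊎ j ∉ₛ tri₃ c z u → ¬ Adj Δ₄ i j
      keep₁ i j = ¬adj-⊕² Δ₃ (tri₃ a c z) (tri₃ c z u) i j
      w∉₁ : w ∉ₛ tri₃ a c z
      w∉₁ = tri-∉ (a≢w ∘ sym) (c≢w ∘ sym) w≢z
      w∉₂ : w ∉ₛ tri₃ c z u
      w∉₂ = tri-∉ (c≢w ∘ sym) w≢z (u≢w ∘ sym)
      Δ₅ = Δ₄ ⊕ tri₃ c b w ⊕ tri₃ b w z
      move₂ : Move Δ₄ Δ₅
      move₂ = move c w b z c≢b w≢z c≢w b≢w b≢z c≢z (move-mono {i = c} {b} move₁ cb) (move-mono {i = w} {z} move₁ (old {w} {z} wz))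
        (keep₁ c w (¬c w (there (here refl))) (inj₂ w∉₁) (inj₂ w∉₂))
        (keep₁ b w (¬b w (here refl)) (inj₂ w∉₁) (inj₂ w∉₂))
        (keep₁ b z (¬b z (there (here refl))) (inj₁ (tri-∉ b≢a (c≢b ∘ sym) b≢z)) (inj₁ (tri-∉ (c≢b ∘ sym) b≢z b≢u)))
      moves : ∀ {i j} → Adj Δ₃ i j → Adj Δ₅ i j
      moves {i} {j} e = move-mono {i = i} {j} move₂ (move-mono {i = i} {j} move₁ e)
      fresh : ∀ p → p ∈ r → ¬ Adj Δ₅ a p × ¬ Adj Δ₅ b p × ¬ Adj Δ₅ c p
      fresh p p∈ = keep a (¬a p (there p∈)) , keep b (¬b p (there (there p∈))) , keep c (¬c p (there (there (there p∈))))
        where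
        p≢ : ∀ {x} → All (x ≢_) r → p ≢ x
        p≢ x≢ p≡x = All.lookup x≢ p∈ (sym p≡x)
        keep : ∀ x → ¬ Adj Δ₃ x p → ¬ Adj Δ₅ x p
        keep x ¬xp = ¬adj-⊕² Δ₄ (tri₃ c b w) (tri₃ b w z) x p (keep₁ x p ¬xp
          (inj₂ (tri-∉ (p≢ a≢r) (p≢ c≢r) (p≢ z≢r))) (inj₂ (tri-∉ (p≢ c≢r) (p≢ z≢r) (p≢ u≢r))))
          (inj₂ (tri-∉ (p≢ c≢r) (p≢ b≢r) (p≢ w≢r))) (inj₂ (tri-∉ (p≢ b≢r) (p≢ w≢r) (p≢ z≢r)))
      rest = pairs-run (b≢a ∘ sym) (c≢a ∘ sym) (c≢b ∘ sym)
        (pairs-mono (λ {i} {j} e → moves {i} {j} (old {i} {j} e)) ps) uqr a≢r b≢r c≢r (moves {a} {b} ab) (moves {a} {c} ac) fresh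
      to-end : ∀ {i j} → Adj Δ₃ i j → Adj (proj₁ rest) i j
      to-end {i} {j} e = run-mono {i = i} {j} (move₁ ∷ move₂ ∷ proj₂ rest) e

  ladder-3 : ∀ {x y z} → Unique (x ∷ y ∷ z ∷ []) → Ladder (x ∷ y ∷ z ∷ []) 0
  ladder-3 {x} {y} {z} ((x≢y ∷ x≢z ∷ []) ∷ (y≢z ∷ []) ∷ _) = record
    { rungs = λ { zero _ → _ , st } ; top = empty ⊕ tri₃ x y z ; state = st
    ; paired = odd (adj-⊕ʳ {Δ = empty} {t} tri-∈₁ tri-∈₂) (adj-⊕ʳ {Δ = empty} {t} tri-∈₁ tri-∈₃) (adj-⊕ʳ {Δ = empty} {t} tri-∈₂ tri-∈₃) [] }
    where
    t = tri₃ x y z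
    st = triangle x≢y x≢z y≢z

  ladder-4 : ∀ {d x y z} → Unique (d ∷ x ∷ y ∷ z ∷ []) → Ladder (d ∷ x ∷ y ∷ z ∷ []) 0
  ladder-4 {d} {x} {y} {z} (d≢ ∷ (x≢y ∷ x≢z ∷ []) ∷ (y≢z ∷ []) ∷ _) = record
    { rungs = λ { zero _ → _ , st } ; top = empty ⊕ t ⊕ tri₃ d x y ; state = st
    ; paired = even (adj-⊕ʳ {Δ = empty ⊕ t} {tri₃ d x y} tri-∈₁ tri-∈₂)
                 (pair (adj-⊕ˡ {Δ = empty ⊕ t} {tri₃ d x y} {y} {z} (adj-⊕ʳ {Δ = empty} {t} tri-∈₂ tri-∈₃)) []) }
    where
    t = tri₃ x y z
    st = glue (λ d∈ → All.lookup d≢ d∈ refl) x≢y (adj-⊕ʳ {Δ = empty} {t} tri-∈₁ tri-∈₂) (triangle x≢y x≢z y≢z)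

  -- Five vertices need a base case of their own, as three fewer leave no triangle to start from.
  -- The stacked triangles miss just the edges `e z`, `z d` and `d y`, which form the path of one
  -- strip.
  ladder-5 : ∀ {d e x y z} → Unique (d ∷ e ∷ x ∷ y ∷ z ∷ []) → Ladder (d ∷ e ∷ x ∷ y ∷ z ∷ []) 1
  ladder-5 {d} {e} {x} {y} {z} (d≢@(d≢e ∷ d≢x ∷ d≢y ∷ d≢z ∷ []) ∷ e≢@(e≢x ∷ e≢y ∷ e≢z ∷ []) ∷ (x≢y ∷ x≢z ∷ []) ∷ (y≢z ∷ []) ∷ _) =
    climb {Q = 0} (λ { zero _ → _ , st }) st (move₁ ∷ [])
      (odd (move-mono {i = d} {e} move₁ (adj-⊕ʳ {Δ = Δe} {tri₃ d e x} tri-∈₁ tri-∈₂))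
           (move-mono {i = d} {x} move₁ (adj-⊕ʳ {Δ = Δe} {tri₃ d e x} tri-∈₁ tri-∈₃))
           (move-mono {i = e} {x} move₁ (adj-⊕ʳ {Δ = Δe} {tri₃ d e x} tri-∈₂ tri-∈₃))
           (pair (move-mono {i = y} {z} move₁ yz) []))
    where
    Δt = empty ⊕ tri₃ x y z
    Δe = Δt ⊕ tri₃ e x y
    Δd = Δe ⊕ tri₃ d e x
    st-t = triangle x≢y x≢z y≢z
    st-e = glue (λ e∈ → All.lookup e≢ e∈ refl) x≢y (adj-⊕ʳ {Δ = empty} {tri₃ x y z} tri-∈₁ tri-∈₂) st-t
    st : State Δd (d ∷ e ∷ x ∷ y ∷ z ∷ []) 0 0
    st = glue (λ d∈ → All.lookup d≢ d∈ refl) e≢x (adj-⊕ʳ {Δ = Δt} {tri₃ e x y} tri-∈₁ tri-∈₂) st-e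
    yz : Adj Δd y z
    yz = adj-⊕ˡ {Δ = Δe} {tri₃ d e x} {y} {z} (adj-⊕ˡ {Δ = Δt} {tri₃ e x y} {y} {z} (adj-⊕ʳ {Δ = empty} {tri₃ x y z} tri-∈₂ tri-∈₃))
    z∉e : z ∉ₛ tri₃ e x y
    z∉e = tri-∉ (e≢z ∘ sym) (x≢z ∘ sym) (y≢z ∘ sym)
    z∉d : z ∉ₛ tri₃ d e x
    z∉d = tri-∉ (d≢z ∘ sym) (e≢z ∘ sym) (x≢z ∘ sym)
    ¬ez : ¬ Adj Δd e z
    ¬ez = ¬adj-⊕² Δt (tri₃ e x y) (tri₃ d e x) e z (¬adj-⊕ empty (tri₃ x y z) e z (λ p → p) (inj₁ (tri-∉ e≢x e≢y e≢z))) (inj₂ z∉e) (inj₂ z∉d)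
    ¬dz : ¬ Adj Δd d z
    ¬dz = ¬adj-⊕² Δt (tri₃ e x y) (tri₃ d e x) d z (¬adj-⊕ empty (tri₃ x y z) d z (λ p → p) (inj₁ (tri-∉ d≢x d≢y d≢z))) (inj₂ z∉e) (inj₂ z∉d)
    ¬dy : ¬ Adj Δd d y
    ¬dy = ¬adj-⊕² Δt (tri₃ e x y) (tri₃ d e x) d y (¬adj-⊕ empty (tri₃ x y z) d y (λ p → p) (inj₁ (tri-∉ d≢x d≢y d≢z))) (inj₁ (tri-∉ d≢e d≢x d≢y))
      (inj₂ (tri-∉ (d≢y ∘ sym) (e≢y ∘ sym) (x≢y ∘ sym)))
    move₁ : Move Δd (Δd ⊕ tri₃ e d z ⊕ tri₃ d z y)
    move₁ = move e z d y (d≢e ∘ sym) (y≢z ∘ sym) e≢z d≢z d≢y e≢y (adj-⊕ʳ {Δ = Δe} {tri₃ d e x} tri-∈₂ tri-∈₁)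
      (adj-sym {Δ = Δd} {y} {z} yz) ¬ez ¬dz ¬dy

  ladder : ∀ vs → Unique vs → 3 ≤ length vs → Ladder vs (quota (length vs))
  ladder (x ∷ y ∷ z ∷ [])          uq _ = ladder-3 uq
  ladder (d ∷ x ∷ y ∷ z ∷ [])      uq _ = ladder-4 uq
  ladder (d ∷ e ∷ x ∷ y ∷ z ∷ []) uq _ = ladder-5 uq
  ladder (c ∷ b ∷ a ∷ vs@(_ ∷ _ ∷ _ ∷ _)) uq@(_ ∷ _ ∷ _ ∷ uq′) _ =
    ladder-step uq (ladder vs uq′ (s≤s (s≤s (s≤s z≤n))))
  ladder (_ ∷ [])     _ (s≤s ())
  ladder (_ ∷ _ ∷ []) _ (s≤s (s≤s ()))

-- The h-vector

open import Data.Integer as ℤ using (ℤ; +_; -[1+_])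
import Data.Integer.Properties as ℤₚ
import Data.Integer.Tactic.RingSolver as ℤ-Solver

-- Variables replace the face counts, so that `f₀ ≡ 1` and `f₁ ≡ n` can be matched on before the
-- ring solver is applied.
h-formula-1 : ∀ n f₀ f₁ → f₀ ≡ 1 → f₁ ≡ n →
  signℤ 1 (+ (3 * f₀)) ℤ.+ (signℤ 0 (+ (1 * f₁)) ℤ.+ + 0) ≡ + n ℤ.- + 3
h-formula-1 n _ _ refl refl = trans (eq (+ (1 * n))) (cong (λ x → + x ℤ.- + 3) (*-identityˡ n))
  where
  eq : ∀ x → ℤ.- (+ 3) ℤ.+ (x ℤ.+ + 0) ≡ x ℤ.- + 3
  eq = ℤ-Solver.solve-∀

h-formula-2 : ∀ n f₀ f₁ f₂ → f₀ ≡ 1 → f₁ ≡ n →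
  signℤ 2 (+ (3 * f₀)) ℤ.+ (signℤ 1 (+ (2 * f₁)) ℤ.+ (signℤ 0 (+ (1 * f₂)) ℤ.+ + 0)) ≡ + (f₂ + 3) ℤ.- + (2 * n)
h-formula-2 n _ _ f₂ refl refl =
  trans (eq (+ (2 * n)) (+ (1 * f₂))) (cong (λ x → + (x + 3) ℤ.- + (2 * n)) (*-identityˡ f₂))
  where
  eq : ∀ x y → ℤ.- (ℤ.- (+ 3)) ℤ.+ (ℤ.- x ℤ.+ (y ℤ.+ + 0)) ≡ y ℤ.+ + 3 ℤ.- x
  eq = ℤ-Solver.solve-∀

h-formula-3 : ∀ n f₀ f₁ f₂ f₃ → f₀ ≡ 1 → f₁ ≡ n →
  signℤ 3 (+ (1 * f₀)) ℤ.+ (signℤ 2 (+ (1 * f₁)) ℤ.+ (signℤ 1 (+ (1 * f₂)) ℤ.+ (signℤ 0 (+ (1 * f₃)) ℤ.+ + 0))) ≡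
  + (n + f₃) ℤ.- + (1 + f₂)
h-formula-3 n _ _ f₂ f₃ refl refl = trans (eq (+ (1 * n)) (+ (1 * f₂)) (+ (1 * f₃)))
  (trans (cong₂ (λ x y → + (x + 1 * f₃) ℤ.- + (1 + y)) (*-identityˡ n) (*-identityˡ f₂))
         (cong (λ z → + (n + z) ℤ.- + (1 + f₂)) (*-identityˡ f₃)))
  where
  eq : ∀ x y z → ℤ.- (ℤ.- (ℤ.- (+ 1))) ℤ.+ (ℤ.- (ℤ.- x) ℤ.+ (ℤ.- y ℤ.+ (z ℤ.+ + 0))) ≡ x ℤ.+ z ℤ.- (+ 1 ℤ.+ y)
  eq = ℤ-Solver.solve-∀

module _ {n : ℕ} (Δ : Complex n) (one : faces Δ 0 ≡ 1) (vertices : faces Δ 1 ≡ n) where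

  hvec-0 : hvec Δ 3 0 ≡ + 1
  hvec-0 = cong (λ x → + (1 * x) ℤ.+ + 0) one

  hvec-1 : hvec Δ 3 1 ≡ + n ℤ.- + 3
  hvec-1 = h-formula-1 n (faces Δ 0) (faces Δ 1) one vertices

  hvec-2 : hvec Δ 3 2 ≡ + (faces Δ 2 + 3) ℤ.- + (2 * n)
  hvec-2 = h-formula-2 n (faces Δ 0) (faces Δ 1) (faces Δ 2) one vertices

  hvec-3 : hvec Δ 3 3 ≡ + (n + faces Δ 3) ℤ.- + (1 + faces Δ 2)
  hvec-3 = h-formula-3 n (faces Δ 0) (faces Δ 1) (faces Δ 2) (faces Δ 3) one vertices

m+n-m : ∀ m n → + (m + n) ℤ.- + m ≡ + n
m+n-m m n = eq (+ m) (+ n)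
  where
  eq : ∀ x y → x ℤ.+ y ℤ.- x ≡ y
  eq = ℤ-Solver.solve-∀

difference-≤ : ∀ p q u → p ≤ u + q → + p ℤ.- + q ℤ.≤ + u
difference-≤ p q u le = subst (+ p ℤ.- + q ℤ.≤_) (eq (+ u) (+ q)) (ℤₚ.+-monoˡ-≤ (ℤ.- + q) (ℤ.+≤+ le))
  where
  eq : ∀ x y → x ℤ.+ y ℤ.- y ≡ x
  eq = ℤ-Solver.solve-∀

≤-3*difference : ∀ p q a → 3 * q ≤ a + 3 * p → ℤ.- + a ℤ.≤ + 3 ℤ.* (+ p ℤ.- + q)
≤-3*difference p q a le = subst₂ ℤ._≤_ (eq₁ (+ a) (+ (3 * q)))
  (trans (cong₂ (λ x y → + a ℤ.+ x ℤ.- (+ a ℤ.+ y)) (ℤₚ.pos-* 3 p) (ℤₚ.pos-* 3 q)) (eq₂ (+ a) (+ p) (+ q)))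
  (ℤₚ.+-monoˡ-≤ (ℤ.- (+ a ℤ.+ + (3 * q))) (ℤ.+≤+ le))
  where
  eq₁ : ∀ x y → y ℤ.- (x ℤ.+ y) ≡ ℤ.- x
  eq₁ = ℤ-Solver.solve-∀
  eq₂ : ∀ x y z → x ℤ.+ + 3 ℤ.* y ℤ.- (x ℤ.+ + 3 ℤ.* z) ≡ + 3 ℤ.* (y ℤ.- z)
  eq₂ = ℤ-Solver.solve-∀

HVector : ∀ {c ℓ} (K : Field c ℓ) (h₁ h₂ h₃ : ℤ) → Set _
HVector K h₁ h₂ h₃ = Σ ℕ λ n → Σ (Complex n) λ Δ →
  IsSimplicialComplex Δ × DimPlusOne Δ 3 × Connected Δ × Homology.Buchsbaum K Δ ×
  hvec Δ 3 0 ≡ + 1 × hvec Δ 3 1 ≡ h₁ × hvec Δ 3 2 ≡ h₂ × hvec Δ 3 3 ≡ h₃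

-- The lower bound on h₃ is multiplied by 3 to stay within the integers, and the absolute values
-- equal h₁ and h₂ because the other conditions make these non-negative.
Conditions : (h₁ h₂ h₃ : ℤ) → Set
Conditions h₁ h₂ h₃ =
  + 0 ℤ.≤ h₁ × (+ 0 ℤ.≤ h₂ × h₂ ℤ.≤ + ((suc ℤ.∣ h₁ ∣) C 2)) ×
  (ℤ.- h₂ ℤ.≤ + 3 ℤ.* h₃ × h₃ ℤ.≤ + macaulayUp 2 ℤ.∣ h₂ ∣)

-- With n vertices, 3 h₃ + h₂ = 3 `f₃` - 2 `f₂` + n, so the lower bound is the inequality summed
-- over links. The upper bound is h₃ = `f₃` + 2 - n - `a`, and h₂ reaches C(h₁ + 1, 2) just when all
-- pairs are edges.
conditions-from-faces : ∀ k a f₂ f₃ →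
  f₂ ≤ tri (3 + k) → 2 * f₂ ≤ 3 * f₃ + (3 + k) → f₂ + 3 ≡ 2 * (3 + k) + a → f₃ + 2 ≤ (3 + k) + a + U a →
  Conditions (+ (3 + k) ℤ.- + 3) (+ (f₂ + 3) ℤ.- + (2 * (3 + k))) (+ (3 + k + f₃) ℤ.- + (1 + f₂))
conditions-from-faces k a f₂ f₃ f₂≤ 2f₂≤ f₂≡ f₃≤
  rewrite f₂≡ | m+n-m (2 * (3 + k)) a | m+n-m 3 k | C2≡tri (suc k) =
  ℤ.+≤+ z≤n , (ℤ.+≤+ z≤n , ℤ.+≤+ a≤) , lower , upper
  where
  a≤ : a ≤ tri (suc k)
  a≤ = +-cancelˡ-≤ (2 * (3 + k)) a (tri (suc k)) (≤-trans (≤-reflexive (sym f₂≡))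
    (≤-trans (+-monoˡ-≤ 3 f₂≤) (≤-reflexive (eq k (tri (suc k))))))
    where
    eq : ∀ k x → 2 + k + (1 + k + x) + 3 ≡ 2 * (3 + k) + x
    eq = solve-∀
  n = 3 + k
  lower : ℤ.- (+ a) ℤ.≤ + 3 ℤ.* (+ (n + f₃) ℤ.- + (1 + f₂))
  lower = ≤-3*difference (n + f₃) (1 + f₂) a (begin
    3 * (1 + f₂)                 ≡⟨ eq₁ f₂ ⟩
    f₂ + 3 + 2 * f₂              ≤⟨ +-mono-≤ (≤-reflexive f₂≡) 2f₂≤ ⟩
    2 * n + a + (3 * f₃ + n)     ≡⟨ eq₂ n a f₃ ⟩
    a + 3 * (n + f₃)             ∎)
    where
    open ≤-Reasoning
    eq₁ : ∀ x → 3 * (1 + x) ≡ x + 3 + 2 * x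
    eq₁ = solve-∀
    eq₂ : ∀ n a x → 2 * n + a + (3 * x + n) ≡ a + 3 * (n + x)
    eq₂ = solve-∀
  upper : + (n + f₃) ℤ.- + (1 + f₂) ℤ.≤ + U a
  upper = difference-≤ (n + f₃) (1 + f₂) (U a) (+-cancelʳ-≤ 2 _ _ (begin
    n + f₃ + 2            ≡⟨ +-assoc n f₃ 2 ⟩
    n + (f₃ + 2)          ≤⟨ +-monoʳ-≤ n f₃≤ ⟩
    n + (n + a + U a)     ≡⟨ eq n a (U a) ⟩
    2 * n + a + U a       ≡⟨ cong (_+ U a) f₂≡ ⟨
    f₂ + 3 + U a          ≡⟨ eq′ f₂ (U a) ⟩
    U a + (1 + f₂) + 2    ∎))
    where
    open ≤-Reasoning
    eq : ∀ n a u → n + (n + a + u) ≡ 2 * n + a + u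
    eq = solve-∀
    eq′ : ∀ f u → f + 3 + u ≡ u + (1 + f) + 2
    eq′ = solve-∀

necessary : ∀ {c ℓ} (K : Field c ℓ) {h₁ h₂ h₃} → HVector K h₁ h₂ h₃ → Conditions h₁ h₂ h₃
necessary K (n , Δ , simplicial , dim@((F₃ , ΔF₃ , ∣F₃∣≡3) , _) , conn , buchsbaum , _ , refl , refl , refl)
  -- A face with three elements forces n ≥ 3, hence h₁ = n - 3 ≥ 0.
  with m≤n⇒∃[o]m+o≡n (subst (_≤ n) ∣F₃∣≡3 (∣p∣≤n F₃))
... | k , refl with BuchsbaumSkeleton.face-bounds K Δ simplicial dim buchsbaum conn
... | a , f₂≤ , 2f₂≤ , f₂≡ , f₃≤
  with hvec Δ 3 1 | hvec-1 Δ (Skeleton.faces-0 Δ simplicial zero) (Skeleton.faces-1 Δ simplicial)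
     | hvec Δ 3 2 | hvec-2 Δ (Skeleton.faces-0 Δ simplicial zero) (Skeleton.faces-1 Δ simplicial)
     | hvec Δ 3 3 | hvec-3 Δ (Skeleton.faces-0 Δ simplicial zero) (Skeleton.faces-1 Δ simplicial)
... | _ | refl | _ | refl | _ | refl = conditions-from-faces k a (faces Δ 2) (faces Δ 3) f₂≤ 2f₂≤ f₂≡ f₃≤

-- From connected links to the Buchsbaum property

module Realize {c ℓ} (K : Field c ℓ) {k : ℕ} {Δ : Complex (3 + k)} {a s} (st : State Δ (allFin (3 + k)) a s) where

  open Core (proj₁ st)
  open Homology K
  open Chains K

  private
    n = 3 + k
    links = proj₂ st

  simplicial : IsSimplicialComplex Δ
  simplicial = (λ i → vertex⁺ (∈-allFin i)) , closed

  small : ∀ F → T (Δ F) → ∣ F ∣ ≤ 3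
  small F ΔF with pure F ΔF
  ... | G , F⊆G , _ , ∣G∣≡3 = subst (∣ F ∣ ≤_) ∣G∣≡3 (p⊆q⇒∣p∣≤∣q∣ F⊆G)

  dim : DimPlusOne Δ 3
  dim with pure ⁅ zero ⁆ (proj₁ simplicial zero)
  ... | G , _ , ΔG , ∣G∣≡3 = (G , ΔG , ∣G∣≡3) , small

  facet-3 : ∀ F → Facet Δ F → ∣ F ∣ ≡ 3
  facet-3 F (ΔF , max) with pure F ΔF
  ... | G , F⊆G , ΔG , ∣G∣≡3 = trans (cong ∣_∣ (max G ΔG F⊆G)) ∣G∣≡3

  outside-point : ∀ {m} {F G : Subset m} → F ⊆ₛ G → ∣ F ∣ < ∣ G ∣ → ∃ λ i → i ∈ₛ G × i ∉ₛ F
  outside-point {F = F} {G} F⊆G lt with Finₚ.any? (λ i → (i ∈ₛ? G) ×-dec ¬? (i ∈ₛ? F))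
  ... | yes found = found
  ... | no none   = ⊥-elim (<⇒≱ lt (p⊆q⇒∣p∣≤∣q∣ G⊆F))
    where
    G⊆F : G ⊆ₛ F
    G⊆F {i} i∈ with i ∈ₛ? F
    ... | yes p = p
    ... | no ¬p = ⊥-elim (none (i , i∈ , ¬p))

  vanishes-above : ∀ {m} (Γ : Complex m) s → (∀ F → T (Γ F) → ∣ F ∣ ≢ s) → HomologyVanishes Γ s
  vanishes-above Γ s none ch _ = (λ _ → Field.0# K) , λ F ΓF ∣F∣≡s → ⊥-elim (none F ΓF ∣F∣≡s)

  module _ (v : Fin n) where

    private
      Lv = lk Δ ⁅ v ⁆

    face⁻ : ∀ F → T (Lv F) → v ∉ₛ F × T (Δ (⁅ v ⁆ ∪ F))
    face⁻ F p with lk⁻ Δ ⁅ v ⁆ F p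
    ... | d , q = (λ v∈ → d v∈ (x∈⁅x⁆ v)) , subst (T ∘ Δ) (∪-comm F ⁅ v ⁆) q

    face⁺ : ∀ F → v ∉ₛ F → T (Δ (⁅ v ⁆ ∪ F)) → T (Lv F)
    face⁺ F v∉ p = lk⁺ Δ ⁅ v ⁆ F (λ i∈F i∈v → v∉ (subst (_∈ₛ F) (x∈⁅y⁆⇒x≡y v i∈v) i∈F)) (subst (T ∘ Δ) (∪-comm ⁅ v ⁆ F) p)

    module _ (F : Subset n) (LF : T (Lv F)) where

      private
        Γ = lk Lv F

      ∣Fv∣ : ∣ ⁅ v ⁆ ∪ F ∣ ≡ suc ∣ F ∣
      ∣Fv∣ = ∣⁅⁆∪∣ (proj₁ (face⁻ F LF))

      disjoint-∣∪∣ : ∀ {m} (A B : Subset m) → (∀ {i} → i ∈ₛ A → i ∉ₛ B) → ∣ A ∪ B ∣ ≡ ∣ A ∣ + ∣ B ∣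
      disjoint-∣∪∣ []          []          d = refl
      disjoint-∣∪∣ (true  ∷ A) (true  ∷ B) d = ⊥-elim (d Data.Vec.here Data.Vec.here)
      disjoint-∣∪∣ (true  ∷ A) (false ∷ B) d = cong suc (disjoint-∣∪∣ A B λ p q → d (Data.Vec.there p) (Data.Vec.there q))
      disjoint-∣∪∣ (false ∷ A) (true  ∷ B) d =
        trans (cong suc (disjoint-∣∪∣ A B λ p q → d (Data.Vec.there p) (Data.Vec.there q))) (sym (+-suc ∣ A ∣ ∣ B ∣))
      disjoint-∣∪∣ (false ∷ A) (false ∷ B) d = disjoint-∣∪∣ A B λ p q → d (Data.Vec.there p) (Data.Vec.there q)

      size : ∀ G → T (Γ G) → ∣ G ∣ + ∣ F ∣ ≤ 2
      size G p with lk⁻ Lv F G p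
      ... | d , LGF with face⁻ (G ∪ F) LGF
      ...   | v∉ , q = s≤s⁻¹ (subst (_≤ 3) (trans (∣⁅⁆∪∣ v∉) (cong suc (disjoint-∣∪∣ G F d))) (small _ q))

      vanishes-top : ∀ s → 3 ≤ s + ∣ F ∣ → HomologyVanishes Γ s
      vanishes-top s 3≤ = vanishes-above Γ s λ G p → λ { refl → <⇒≱ 3≤ (size G p) }

      -- By purity the face formed by `v` and `F`, of size at most two, lies in a triangle. A
      -- further vertex of that triangle belongs to the link and bounds the empty face.
      vanishes-bottom : ∣ F ∣ < 2 → HomologyVanishes Γ 0
      vanishes-bottom ∣F∣<2 with pure (⁅ v ⁆ ∪ F) (proj₂ (face⁻ F LF))
      ... | G , vF⊆G , ΔG , ∣G∣≡3 with outside-point vF⊆G (subst₂ _<_ (sym ∣Fv∣) (sym ∣G∣≡3) (s≤s ∣F∣<2))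
      ...   | u , u∈ , u∉ = vanishes-0 Γ u (lk⁺ Lv F ⁅ u ⁆
        (λ i∈u i∈F → u∉ (⊆∪ʳ {G = ⁅ v ⁆} id (subst (_∈ₛ F) (x∈⁅y⁆⇒x≡y u i∈u) i∈F)))
        (face⁺ (⁅ u ⁆ ∪ F) v∉ (closed G _ (∪⊆ (λ p → vF⊆G (⊆∪ˡ {H = F} id p)) (∪⊆ (⁅⁆⊆ u∈) (λ p → vF⊆G (⊆∪ʳ {G = ⁅ v ⁆} id p)))) ΔG)))
        where
        v∉ : v ∉ₛ ⁅ u ⁆ ∪ F
        v∉ p with x∈p∪q⁻ ⁅ u ⁆ F p
        ... | inj₁ q = u∉ (subst (_∈ₛ ⁅ v ⁆ ∪ F) (x∈⁅y⁆⇒x≡y u q) (⊆∪ˡ {H = F} id (x∈⁅x⁆ v)))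
        ... | inj₂ q = proj₁ (face⁻ F LF) q

    open LinkOfVertex Δ simplicial v using (L; L-closed; L⁺; L⁻; lk-dim)

    edge-path : ∀ {i j} → Star (Step Δ v) i j → Star (Edge L) i j
    edge-path ε = ε
    edge-path (_◅_ {i} {j} (i≢v , j≢v , p) q) with i Finₚ.≟ j
    ... | yes refl = edge-path q
    ... | no i≢j   = (i≢j , L⁺ (⁅ i ⁆ ∪ ⁅ j ⁆) v∉ p) ◅ edge-path q
      where
      v∉ : v ∉ₛ ⁅ i ⁆ ∪ ⁅ j ⁆
      v∉ r with x∈p∪q⁻ ⁅ i ⁆ ⁅ j ⁆ r
      ... | inj₁ r = i≢v (sym (x∈⁅y⁆⇒x≡y i r))
      ... | inj₂ r = j≢v (sym (x∈⁅y⁆⇒x≡y j r))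

    neighbour⁻ : ∀ u → T (L ⁅ u ⁆) → u ≢ v × Adj Δ v u
    neighbour⁻ u p = (λ { refl → proj₁ (L⁻ ⁅ u ⁆ p) (x∈⁅x⁆ u) }) , proj₂ (L⁻ ⁅ u ⁆ p)

    vanishes-link-1 : HomologyVanishes L 1
    vanishes-link-1 with Finₚ.any? (λ r → Boolₚ.T? (L ⁅ r ⁆))
    ... | no none = vanishes-above L 1 λ F p ∣F∣≡1 → case F p (∣∣≡1⇒⁅⁆ ∣F∣≡1)
      where
      case : ∀ F → T (L F) → (∃ λ u → F ≡ ⁅ u ⁆) → ⊥
      case _ p (u , refl) = none (u , p)
    ... | yes (r , Lr) = vanishes-1 L (L-closed ⁅ r ⁆ ∅ ∅⊆ Lr) r λ u Lu →
      edge-path (links v u r (proj₁ (neighbour⁻ u Lu)) (proj₁ (neighbour⁻ r Lr)) (proj₂ (neighbour⁻ u Lu)) (proj₂ (neighbour⁻ r Lr)))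

    -- Connectedness of the link is needed only for `s = 1` and the empty face. For `s = 0` purity
    -- provides a vertex unless `F` is already an edge, which is the exempt case, and for
    -- `s + ∣ F ∣ ≥ 3` there are no faces.
    link-CM : CohenMacaulay Lv
    link-CM d Ldim F LF s s≢ with dim-unique Ldim (lk-dim small (triangle-at))
      where
      triangle-at : ∃ λ F → T (Δ F) × ∣ F ∣ ≡ 3 × v ∈ₛ F
      triangle-at with pure ⁅ v ⁆ (proj₁ simplicial v)
      ... | G , v⊆G , ΔG , ∣G∣≡3 = G , ΔG , ∣G∣≡3 , v⊆G (x∈⁅x⁆ v)
      dim-unique : ∀ {d e} → DimPlusOne Lv d → DimPlusOne Lv e → d ≡ e
      dim-unique ((F , LF , ∣F∣≡d) , d-max) ((G , LG , ∣G∣≡e) , e-max) =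
        ≤-antisym (subst (_≤ _) ∣F∣≡d (e-max F LF)) (subst (_≤ _) ∣G∣≡e (d-max G LG))
    ... | refl = cases s ∣ F ∣ refl s≢
      where
      at-size : ∀ {f} → ∣ F ∣ ≡ f → ∀ {m} → 3 ≤ m + f → 3 ≤ m + ∣ F ∣
      at-size refl le = le
      cases : ∀ s f → ∣ F ∣ ≡ f → s ≢ 2 ∸ f → HomologyVanishes (lk Lv F) s
      cases 0 0             eq s≢ = vanishes-bottom F LF (subst (_< 2) (sym eq) (s≤s z≤n))
      cases 0 1             eq s≢ = vanishes-bottom F LF (subst (_< 2) (sym eq) ≤-refl)
      cases 0 (suc (suc f)) eq s≢ = ⊥-elim (s≢ (sym (0∸n≡0 f)))
      cases 1 0             eq s≢ = subst (λ G → HomologyVanishes (lk Lv G) 1) (sym (∣∣≡0⇒∅ eq)) vanishes-link-1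
      cases 1 1             eq s≢ = ⊥-elim (s≢ refl)
      cases 1 (suc (suc f)) eq s≢ = vanishes-top F LF 1 (at-size eq {1} (s≤s (s≤s (s≤s z≤n))))
      cases 2 0             eq s≢ = ⊥-elim (s≢ refl)
      cases 2 (suc f)       eq s≢ = vanishes-top F LF 2 (at-size eq {2} (s≤s (s≤s (s≤s z≤n))))
      cases (suc (suc (suc s))) f eq s≢ = vanishes-top F LF (3 + s) (s≤s (s≤s (s≤s z≤n)))

  buchsbaum : Buchsbaum Δ
  buchsbaum = (λ F G p q → trans (facet-3 F p) (sym (facet-3 G q))) , λ v _ → link-CM v

  private
    len : length (allFin n) ≡ n
    len = length-tabulate id
    one : faces Δ 0 ≡ 1
    one = Skeleton.faces-0 Δ simplicial zero
    vertices : faces Δ 1 ≡ n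
    vertices = Skeleton.faces-1 Δ simplicial
    edges′ : faces Δ 2 + 3 ≡ 2 * n + a
    edges′ = trans edges (cong (λ l → 2 * l + a) len)
    triangles′ : faces Δ 3 + 2 ≡ n + s
    triangles′ = trans triangles (cong (_+ s) len)

  difference-≡ : ∀ p q s a → p + a ≡ s + q → + p ℤ.- + q ≡ + s ℤ.- + a
  difference-≡ p q s a eq = trans (eq₁ (+ p) (+ q) (+ a)) (trans (cong (λ x → + x ℤ.- + q ℤ.- + a) eq) (eq₂ (+ s) (+ q) (+ a)))
    where
    eq₁ : ∀ x y z → x ℤ.- y ≡ x ℤ.+ z ℤ.- y ℤ.- z
    eq₁ = ℤ-Solver.solve-∀
    eq₂ : ∀ x y z → x ℤ.+ y ℤ.- y ℤ.- z ≡ x ℤ.- z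
    eq₂ = ℤ-Solver.solve-∀

  hvector : HVector K (+ k) (+ a) (+ s ℤ.- + a)
  hvector = n , Δ , simplicial , dim , connected , buchsbaum ,
    hvec-0 Δ one vertices ,
    trans (hvec-1 Δ one vertices) (m+n-m 3 k) ,
    trans (hvec-2 Δ one vertices) (trans (cong (λ x → + x ℤ.- + (2 * n)) edges′) (m+n-m (2 * n) a)) ,
    trans (hvec-3 Δ one vertices) (difference-≡ (n + faces Δ 3) (1 + faces Δ 2) s a (+-cancelʳ-≡ 2 _ _ count))
    where
    count : n + faces Δ 3 + a + 2 ≡ s + (1 + faces Δ 2) + 2
    count = begin
      n + faces Δ 3 + a + 2       ≡⟨ eq₁ n (faces Δ 3) a ⟩
      n + a + (faces Δ 3 + 2)     ≡⟨ cong (λ x → n + a + x) triangles′ ⟩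
      n + a + (n + s)             ≡⟨ eq₂ n a s ⟩
      s + (2 * n + a)             ≡⟨ cong (λ x → s + x) edges′ ⟨
      s + (faces Δ 2 + 3)         ≡⟨ eq₃ s (faces Δ 2) ⟩
      s + (1 + faces Δ 2) + 2     ∎
      where
      open ≡-Reasoning
      eq₁ : ∀ n f a → n + f + a + 2 ≡ n + a + (f + 2)
      eq₁ = solve-∀
      eq₂ : ∀ n a s → n + a + (n + s) ≡ s + (2 * n + a)
      eq₂ = solve-∀
      eq₃ : ∀ s f → s + (f + 3) ≡ s + (1 + f) + 2
      eq₃ = solve-∀

-- Realizing all h-vectors

Σ₂-distinct : ∀ {a} {A : Set a} (g : A → A → ℕ) {xs} → Unique xs → (∀ {x y} → x ≢ y → g x y ≡ 1) →
  Σ₂ g xs ≡ tri (length xs)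
Σ₂-distinct g []               one = refl
Σ₂-distinct g (_∷_ {x} {xs} x≢ uq) one = cong₂ _+_ (row xs x≢) (Σ₂-distinct g uq one)
  where
  row : ∀ ys → All (x ≢_) ys → Σ₁ (g x) ys ≡ length ys
  row []       []         = refl
  row (y ∷ ys) (x≢y ∷ x≢) = cong₂ _+_ (one x≢y) (row ys x≢)

Unique-++⁻ʳ : ∀ {a} {A : Set a} (xs : List A) {ys} → Unique (xs ++ ys) → Unique ys
Unique-++⁻ʳ []       uq       = uq
Unique-++⁻ʳ (x ∷ xs) (_ ∷ uq) = Unique-++⁻ʳ xs uq

≤-split : ∀ {h} A {B} → h ≤ A + B → ∃₂ λ h₀ c → h₀ ≤ A × c ≤ B × h ≡ h₀ + c
≤-split {h} A {B} h≤ with h ≤? A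
... | yes h≤A = h , 0 , h≤A , z≤n , sym (+-identityʳ h)
... | no h≰A with m≤n⇒∃[o]m+o≡n (≰⇒≥ h≰A)
...   | c , refl = A , c , ≤-refl , +-cancelˡ-≤ A c B h≤ , refl

module _ {k : ℕ} where

  private
    n = 3 + k

  -- A path `x`, `z`, `y` with `x` and `y` not adjacent carries a triangle that adds one edge. If
  -- there is none, adjacency is transitive on distinct vertices, a connected graph is then
  -- complete, and h₂ is already C(k + 1, 2).
  fill : ∀ {Δ : Complex n} {a s} → State Δ (allFin n) a s → a < tri (1 + k) → ∃ λ Δ′ → State Δ′ (allFin n) (suc a) (suc s)
  fill {Δ} {a} {s} st a<
    with Finₚ.any? (λ x → Finₚ.any? (λ y → Finₚ.any? (λ z → ¬? (x Finₚ.≟ y) ×-dec (¬? (x Finₚ.≟ z) ×-dec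
           (¬? (y Finₚ.≟ z) ×-dec (Boolₚ.T? (Δ (⁅ x ⁆ ∪ ⁅ z ⁆)) ×-dec (Boolₚ.T? (Δ (⁅ y ⁆ ∪ ⁅ z ⁆)) ×-dec ¬? (Boolₚ.T? (Δ (⁅ x ⁆ ∪ ⁅ y ⁆))))))))))
  ... | yes (x , y , z , x≢y , x≢z , y≢z , xz , yz , ¬xy) = _ , new-edge x≢y x≢z y≢z xz yz st ¬xy
  ... | no none = ⊥-elim (<⇒≢ a< (+-cancelˡ-≡ (2 * n) a (tri (1 + k)) (begin
    2 * n + a                    ≡⟨ cong (λ l → 2 * l + a) (length-tabulate {n = n} id) ⟨
    2 * length (allFin n) + a    ≡⟨ edges ⟨
    faces Δ 2 + 3                ≡⟨ cong (_+ 3) (Skeleton.faces-2 Δ) ⟩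
    Σ₂ (λ i j → ind (E i j)) (allFin n) + 3
      ≡⟨ cong (_+ 3) (Σ₂-distinct (λ i j → ind (E i j)) (Uniqueₚ.allFin⁺ n) (λ {i} {j} i≢j → cong ind (E⁺ {i} {j} i≢j (all-adjacent i j i≢j)))) ⟩
    tri (length (allFin n)) + 3  ≡⟨ cong (λ l → tri l + 3) (length-tabulate {n = n} id) ⟩
    tri n + 3                    ≡⟨ eq k (tri (1 + k)) ⟩
    2 * n + tri (1 + k)          ∎)))
    where
    open Core (proj₁ st)
    open Skeleton Δ using (E; E⁺)
    open ≡-Reasoning
    eq : ∀ k x → 2 + k + (1 + k + x) + 3 ≡ 2 * (3 + k) + x
    eq = solve-∀
    adjacent : ∀ {u w} → Reach Δ u w → u ≡ w ⊎ Adj Δ u w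
    adjacent here = inj₁ refl
    adjacent {u} {w} (step {v = v} r vw) with u Finₚ.≟ w | u Finₚ.≟ v | v Finₚ.≟ w | adjacent r
    ... | yes refl | _        | _        | _         = inj₁ refl
    ... | no _     | yes refl | _        | _         = inj₂ vw
    ... | no _     | no u≢v   | _        | inj₁ u≡v  = ⊥-elim (u≢v u≡v)
    ... | no _     | no _     | yes refl | inj₂ uv   = inj₂ uv
    ... | no u≢w   | no u≢v   | no v≢w   | inj₂ uv with Boolₚ.T? (Δ (⁅ u ⁆ ∪ ⁅ w ⁆))
    ...   | yes uw = inj₂ uw
    ...   | no ¬uw = ⊥-elim (none (u , w , v , u≢w , u≢v , v≢w ∘ sym , uv , adj-sym {Δ = Δ} {v} {w} vw , ¬uw))
    all-adjacent : ∀ u w → u ≢ w → Adj Δ u w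
    all-adjacent u w u≢w with adjacent (connected u w (vertex⁺ (∈-allFin u)) (vertex⁺ (∈-allFin w)))
    ... | inj₁ u≡w = ⊥-elim (u≢w u≡w)
    ... | inj₂ uw  = uw

  fill-many : ∀ {Δ : Complex n} {a s} j → State Δ (allFin n) a s → a + j ≤ tri (1 + k) →
    ∃ λ Δ′ → State Δ′ (allFin n) (a + j) (s + j)
  fill-many {Δ} {a} {s} zero    st le = Δ , subst₂ (State Δ _) (sym (+-identityʳ a)) (sym (+-identityʳ s)) st
  fill-many {Δ} {a} {s} (suc j) st le with fill st (≤-trans (≤-trans (s≤s (m≤m+n a j)) (≤-reflexive (sym (+-suc a j)))) le)
  ... | Δ₁ , st₁ with fill-many j st₁ (≤-trans (≤-reflexive (sym (+-suc a j))) le)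
  ...   | Δ₂ , st₂ = Δ₂ , subst₂ (State Δ₂ _) (sym (+-suc a j)) (sym (+-suc s j)) st₂

-- Joining a vertex to a complete graph

module _ {n : ℕ} where

  -- Each triangle on the edge `x p` has all its sides present, so h₃ rises by one and no edge is
  -- added. The last component records this at `x`, where later joining steps rely on it.
  fan : ∀ {Δ : Complex n} {vs a s x p} → x ≢ p → Adj Δ x p → ∀ zs → Unique zs →
    (∀ {z} → z ∈ zs → x ≢ z × p ≢ z × Adj Δ x z × Adj Δ p z × ¬ T (Δ (tri₃ x p z))) → ∀ j → j ≤ length zs → State Δ vs a s →
    ∃ λ Δ′ → State Δ′ vs a (j + s) × (∀ {u w} → Adj Δ u w → Adj Δ′ u w) × (∀ q → q ≢ x → Adj Δ′ x q → Adj Δ x q)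
  fan x≢p xp zs uq ok zero _ st = _ , st , (λ e → e) , λ _ _ e → e
  fan {Δ} {vs} {a} {s} {x} {p} x≢p xp (z ∷ zs) (z≢ ∷ uq) ok (suc j) (s≤s j≤) st with ok (here refl)
  ... | x≢z , p≢z , xz , pz , ¬xpz
    with fan {Δ ⊕ tri₃ x p z} x≢p (grow {x} {p} xp) zs uq ok′ j j≤ (new-triangle x≢p x≢z p≢z xz pz st xp ¬xpz)
    where
    grow : ∀ {u w} → Adj Δ u w → Adj (Δ ⊕ tri₃ x p z) u w
    grow {u} {w} = adj-⊕ˡ {Δ = Δ} {tri₃ x p z} {u} {w}
    ok′ : ∀ {y} → y ∈ zs → x ≢ y × p ≢ y × Adj (Δ ⊕ tri₃ x p z) x y × Adj (Δ ⊕ tri₃ x p z) p y × ¬ T ((Δ ⊕ tri₃ x p z) (tri₃ x p y))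
    ok′ {y} y∈ with ok (there y∈)
    ... | x≢y , p≢y , xy , py , ¬xpy = x≢y , p≢y , grow {x} {y} xy , grow {p} {y} py , ¬new
      where
      ¬new : ¬ T ((Δ ⊕ tri₃ x p z) (tri₃ x p y))
      ¬new q with ⊕⁻ {Δ = Δ} {tri₃ x p z} (tri₃ x p y) q
      ... | inj₁ r = ¬xpy r
      ... | inj₂ r = tri-∉ (x≢y ∘ sym) (p≢y ∘ sym) (All.lookup z≢ y∈ ∘ sym) (r (tri-∈₃ {x = x} {p} {y}))
  ... | Δ′ , st′ , mono , only =
    Δ′ , subst (State Δ′ vs a) (+-suc j s) st′ , (λ {u} {w} e → mono {u} {w} (adj-⊕ˡ {Δ = Δ} {tri₃ x p z} {u} {w} e)) , only′
    where
    only′ : ∀ q → q ≢ x → Adj Δ′ x q → Adj Δ x q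
    only′ q q≢x e with adj-⊕⁻ {Δ = Δ} {tri₃ x p z} {x} {q} (only q q≢x e)
    ... | inj₁ r       = r
    ... | inj₂ (_ , r) with tri-∈⁻ r
    ...   | inj₁ q≡x         = ⊥-elim (q≢x q≡x)
    ...   | inj₂ (inj₁ refl) = xp
    ...   | inj₂ (inj₂ refl) = xz

  Complete : Complex n → List (Fin n) → Set
  Complete Δ vs = ∀ {u w} → u ∈ vs → w ∈ vs → u ≢ w → Adj Δ u w

  record Joined (Δ : Complex n) (vs : List (Fin n)) (x : Fin n) (ps : List (Fin n)) (a s : ℕ) : Set where
    field
      complex : Complex n
      state   : State complex (x ∷ vs) a s
      mono    : ∀ {u w} → Adj Δ u w → Adj complex u w
      joined  : ∀ {p} → p ∈ ps → Adj complex x p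
      only    : ∀ q → q ≢ x → Adj complex x q → q ∈ ps

  -- `i` is the gain in h₂ and `c` the gain in h₃. A neighbour `p` added to `i + 2` present ones
  -- comes with one triangle that leaves h₃ unchanged; completeness then permits one more triangle
  -- for each of the other `i + 1`. Summed up from two neighbours, these allowances are
  -- `tri (1 + i)`.
  join : ∀ {Δ vs a s x} → x ∉ vs → State Δ vs a s → Complete Δ vs → ∀ i ps → Unique ps → All (_∈ vs) ps →
    length ps ≡ 2 + i → ∀ c → c ≤ tri (1 + i) → Joined Δ vs x ps (i + a) (c + i + s)
  join {Δ} {vs} {a} {s} {x} x∉ st complete zero (p ∷ q ∷ []) ((p≢q ∷ []) ∷ _) (p∈ ∷ q∈ ∷ []) refl zero _ = record
    { complex = Δ ⊕ tri₃ x p q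
    ; state   = glue x∉ p≢q (complete p∈ q∈ p≢q) st
    ; mono    = λ {u} {w} → adj-⊕ˡ {Δ = Δ} {tri₃ x p q} {u} {w}
    ; joined  = λ { (here refl) → adj-⊕ʳ {Δ = Δ} {tri₃ x p q} tri-∈₁ tri-∈₂
                  ; (there (here refl)) → adj-⊕ʳ {Δ = Δ} {tri₃ x p q} tri-∈₁ tri-∈₃ }
    ; only    = only
    }
    where
    only : ∀ r → r ≢ x → Adj (Δ ⊕ tri₃ x p q) x r → r ∈ p ∷ q ∷ []
    only r r≢x e with adj-⊕⁻ {Δ = Δ} {tri₃ x p q} {x} {r} e
    ... | inj₁ xr       = ⊥-elim (x∉ (Core.adj⇒∈ (proj₁ st) {x} {r} xr))
    ... | inj₂ (_ , r∈) with tri-∈⁻ r∈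
    ...   | inj₁ r≡x         = ⊥-elim (r≢x r≡x)
    ...   | inj₂ (inj₁ refl) = here refl
    ...   | inj₂ (inj₂ refl) = there (here refl)
  join {Δ} {vs} {a} {s} {x} x∉ st complete (suc i) (p ∷ ps@(z₀ ∷ zs)) (p≢@(p≢z₀ ∷ p≢zs) ∷ uq@(z₀≢ ∷ uq-zs)) (p∈ ∷ ps∈@(z₀∈ ∷ zs∈)) len c c≤
    with ≤-split (tri (1 + i)) (≤-trans c≤ (≤-reflexive (+-comm (1 + i) (tri (1 + i)))))
  ... | c₀ , j , c₀≤ , j≤ , refl = result
    where
    smaller : Joined Δ vs x ps (i + a) (c₀ + i + s)
    smaller = join x∉ st complete i ps uq ps∈ (suc-injective len) c₀ c₀≤
    module S = Joined smaller
    Δ₁ = S.complex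
    Δ₂ = Δ₁ ⊕ tri₃ x p z₀
    ≢x : ∀ {q} → q ∈ vs → x ≢ q
    ≢x q∈ refl = x∉ q∈
    ¬xp : ¬ Adj Δ₁ x p
    ¬xp e = All.lookup p≢ (S.only p (≢x p∈ ∘ sym) e) refl
    st₂ : State Δ₂ (x ∷ vs) (suc (i + a)) (suc (c₀ + i + s))
    st₂ = new-edge (≢x p∈) (≢x z₀∈) p≢z₀ (S.joined (here refl)) (S.mono {p} {z₀} (complete p∈ z₀∈ p≢z₀)) S.state ¬xp
    grow : ∀ {u w} → Adj Δ₁ u w → Adj Δ₂ u w
    grow {u} {w} = adj-⊕ˡ {Δ = Δ₁} {tri₃ x p z₀} {u} {w}
    xp : Adj Δ₂ x p
    xp = adj-⊕ʳ {Δ = Δ₁} {tri₃ x p z₀} tri-∈₁ tri-∈₂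
    ok : ∀ {z} → z ∈ zs → x ≢ z × p ≢ z × Adj Δ₂ x z × Adj Δ₂ p z × ¬ T (Δ₂ (tri₃ x p z))
    ok {z} z∈ = ≢x z∈vs , p≢z , grow {x} {z} (S.joined (there z∈)) , grow {p} {z} (S.mono {p} {z} (complete p∈ z∈vs p≢z)) , ¬xpz
      where
      z∈vs = All.lookup zs∈ z∈
      p≢z = All.lookup p≢zs z∈
      ¬xpz : ¬ T (Δ₂ (tri₃ x p z))
      ¬xpz q with ⊕⁻ {Δ = Δ₁} {tri₃ x p z₀} (tri₃ x p z) q
      ... | inj₁ r = ¬xp (Core.closed (proj₁ S.state) _ _ (adj⊆ (tri-∈₁ {x = x} {p} {z}) tri-∈₂) r)
      ... | inj₂ r = tri-∉ (≢x z∈vs ∘ sym) (p≢z ∘ sym) (All.lookup z₀≢ z∈ ∘ sym) (r (tri-∈₃ {x = x} {p} {z}))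
    fanned = fan {Δ₂} (≢x p∈) xp zs uq-zs ok j (≤-trans j≤ (≤-reflexive (sym (suc-injective (suc-injective len))))) st₂
    Δ₃ = proj₁ fanned
    only : ∀ q → q ≢ x → Adj Δ₃ x q → q ∈ p ∷ ps
    only q q≢x e with adj-⊕⁻ {Δ = Δ₁} {tri₃ x p z₀} {x} {q} (proj₂ (proj₂ (proj₂ fanned)) q q≢x e)
    ... | inj₁ r        = there (S.only q q≢x r)
    ... | inj₂ (_ , r) with tri-∈⁻ r
    ...   | inj₁ q≡x         = ⊥-elim (q≢x q≡x)
    ...   | inj₂ (inj₁ refl) = here refl
    ...   | inj₂ (inj₂ refl) = there (here refl)
    to-end : ∀ {u w} → Adj Δ₂ u w → Adj Δ₃ u w
    to-end {u} {w} = proj₁ (proj₂ (proj₂ fanned)) {u} {w}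
    result : Joined Δ vs x (p ∷ ps) (suc i + a) (c₀ + j + suc i + s)
    result = record
      { complex = Δ₃
      ; state   = subst (State Δ₃ (x ∷ vs) (suc i + a)) (eq c₀ i j s) (proj₁ (proj₂ fanned))
      ; mono    = λ {u} {w} e → to-end {u} {w} (grow {u} {w} (S.mono {u} {w} e))
      ; joined  = λ { (here refl) → to-end {x} {p} xp ; (there {x = _} q∈) → to-end {x} (grow {x} (S.joined q∈)) }
      ; only    = only
      }
      where
      eq : ∀ c i j s → j + suc (c + i + s) ≡ c + j + suc i + s
      eq = solve-∀
  join _ _ _ zero    (_ ∷ [])            _ _ ()
  join _ _ _ zero    (_ ∷ _ ∷ _ ∷ _)     _ _ ()
  join _ _ _ (suc _) (_ ∷ [])            _ _ ()

  -- A vertex joined to all of `3 + j` earlier ones can raise h₃ by any amount up to `tri (2 + j)`,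
  -- and these capacities add up to `tet`. Splitting `h` fills the earlier vertices first.
  complete-graph : ∀ j vs → Unique vs → length vs ≡ 3 + j → ∀ h → h ≤ tet (2 + j) →
    ∃ λ Δ → State Δ vs (tri (1 + j)) (h + tri (1 + j)) × Complete Δ vs
  complete-graph zero (x ∷ y ∷ z ∷ []) ((x≢y ∷ x≢z ∷ []) ∷ (y≢z ∷ []) ∷ _) refl zero _ =
    empty ⊕ tri₃ x y z , triangle x≢y x≢z y≢z , λ u∈ w∈ _ → adj-⊕ʳ {Δ = empty} {tri₃ x y z} (corner u∈) (corner w∈)
    where
    corner : ∀ {i} → i ∈ x ∷ y ∷ z ∷ [] → i ∈ₛ tri₃ x y z
    corner (here refl)                 = tri-∈₁
    corner (there (here refl))         = tri-∈₂
    corner (there (there (here refl))) = tri-∈₃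
  complete-graph (suc j) (x ∷ vs) (x≢ ∷ uq) len h h≤
    with ≤-split (tet (2 + j)) (≤-trans h≤ (≤-reflexive (+-comm (tri (2 + j)) (tet (2 + j)))))
  ... | h₀ , c , h₀≤ , c≤ , refl with complete-graph j vs uq (suc-injective len) h₀ h₀≤
  ...   | Δ , st , complete = V.complex , subst (State V.complex (x ∷ vs) (tri (2 + j))) (eq h₀ c j (tri (1 + j))) V.state , complete′
    where
    module V = Joined (join (λ x∈ → All.lookup x≢ x∈ refl) st complete (1 + j) vs uq (All.tabulate id) (suc-injective len) c c≤)
    eq : ∀ h c j y → c + (1 + j) + (h + y) ≡ h + c + (1 + j + y)
    eq = solve-∀
    complete′ : Complete V.complex (x ∷ vs)
    complete′ (here refl) (here refl) u≢w = ⊥-elim (u≢w refl)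
    complete′ (here refl) (there w∈)  _   = V.joined w∈
    complete′ {u} (there u∈) (here refl) _   = adj-sym {Δ = V.complex} {x} {u} (V.joined u∈)
    complete′ {u} {w} (there u∈) (there w∈)  u≢w = V.mono {u} {w} (complete u∈ w∈ u≢w)

  private
    suffix : ∀ e {m} (vs : List (Fin n)) → length vs ≡ e + m → ∃₂ λ pre post → pre ++ post ≡ vs × length post ≡ m
    suffix e {m} vs len = take e vs , drop e vs , take++drop≡id e vs ,
      trans (length-drop e vs) (trans (cong (_∸ e) len) (m+n∸m≡n e m))

  -- The Macaulay representation is read as a construction. For h₂ = `tri (1 + j) + (1 + i)` take a
  -- complete graph on `3 + j` vertices, join one vertex to `3 + i` of them, and glue on the
  -- remaining `e`. The capacities `tet (2 + j)` and `tri (2 + i)` for h₃ sum to `U` of h₂.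
  upper : ∀ k vs → Unique vs → length vs ≡ 3 + k → ∀ a h → a ≤ tri (1 + k) → h ≤ U a → ∃ λ Δ → State Δ vs a (h + a)
  upper k vs uq len zero zero _ _ with suffix k vs (trans len (+-comm 3 k))
  ... | pre , post@(u ∷ _ ∷ _ ∷ []) , refl , refl with complete-graph 0 post (Unique-++⁻ʳ pre uq) refl 0 z≤n
  ...   | Δ , st , _ = glue-all pre uq (here refl) st
  upper k vs uq len (suc a) h a≤ h≤ with decompose a
  ... | suc j , i , i<m , a≡ with m≤n⇒∃[o]m+o≡n (1+j≤k)
    where
    1+j≤k : suc j ≤ k
    1+j≤k = s≤s⁻¹ (≮⇒≥ λ k< → <⇒≱ (≤-trans (s≤s (m≤m+n (tri (suc j)) i)) (≤-trans (≤-reflexive (trans (sym (+-suc (tri (suc j)) i)) (sym a≡))) a≤))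
      (tri-mono (s≤s⁻¹ k<)))
  ... | e , refl with suffix e vs (trans len (eq j e))
    where
    eq : ∀ j e → 3 + (suc j + e) ≡ e + (4 + j)
    eq = solve-∀
  ... | pre , x ∷ post , refl , len-post with Unique-++⁻ʳ pre uq
  ... | x≢ ∷ uq-post with ≤-split (tet (2 + j)) {tri (2 + i)} (≤-trans h≤ (≤-reflexive (trans (cong U a≡) (U-tri (suc j) (suc i) i<m))))
  ... | h₀ , c , h₀≤ , c≤ , refl with complete-graph j post uq-post (suc-injective len-post) h₀ h₀≤
  ... | Δ , st , complete = glue-all pre uq (here refl)
        (subst₂ (State V.complex (x ∷ post)) (trans (+-comm (suc i) _) (sym a≡))
          (trans (eq h₀ c i (tri (1 + j))) (cong (λ x → h₀ + c + x) (sym a≡))) V.state)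
    where
    ps = take (3 + i) post
    ps-length : length ps ≡ 3 + i
    ps-length = trans (length-take (3 + i) post) (m≤n⇒m⊓n≡m (subst (3 + i ≤_) (sym (suc-injective len-post)) (s≤s (s≤s i<m))))
    module V = Joined (join (λ x∈ → All.lookup x≢ x∈ refl) st complete (suc i) ps (Uniqueₚ.take⁺ (3 + i) uq-post)
      (All.tabulate (λ p∈ → subst (_ ∈_) (take++drop≡id (3 + i) post) (∈-++⁺ˡ p∈))) ps-length c c≤)
    eq : ∀ h c i y → c + suc i + (h + y) ≡ h + c + (y + suc i)
    eq = solve-∀

sufficient : ∀ {c ℓ} (K : Field c ℓ) {h₁ h₂ h₃} → Conditions h₁ h₂ h₃ → HVector K h₁ h₂ h₃
sufficient K {+ k} {+ a} {+ p} (_ , (_ , a≤) , _ , p≤)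
  with upper k (allFin (3 + k)) (Uniqueₚ.allFin⁺ (3 + k)) (length-tabulate id) a p
         (subst (a ≤_) (C2≡tri (suc k)) (ℤ.drop‿+≤+ a≤)) (ℤ.drop‿+≤+ p≤)
... | Δ , st = subst (HVector K (+ k) (+ a)) (eq (+ p) (+ a)) (Realize.hvector K st)
  where
  eq : ∀ x y → x ℤ.+ y ℤ.- y ≡ x
  eq = ℤ-Solver.solve-∀
sufficient K {+ k} {+ a} { -[1+ p ]} (_ , (_ , a≤) , lower , _) = result
  where
  q = suc p
  a≤tri : a ≤ tri (suc k)
  a≤tri = subst (a ≤_) (C2≡tri (suc k)) (ℤ.drop‿+≤+ a≤)
  3q≤a : 3 * q ≤ a
  3q≤a = ℤ.drop‿+≤+ (subst (ℤ.- (+ 3 ℤ.* -[1+ p ]) ℤ.≤_) (ℤₚ.neg-involutive (+ a)) (ℤₚ.neg-mono-≤ lower))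
  L : Ladder (allFin (3 + k)) (quota (3 + k))
  L = subst (λ l → Ladder (allFin (3 + k)) (quota l)) (length-tabulate {n = 3 + k} id)
    (ladder (allFin (3 + k)) (Uniqueₚ.allFin⁺ (3 + k)) (s≤s (s≤s (s≤s z≤n))))
  -- Three strips' worth of edges cannot exceed C(h₁ + 1, 2): from 3q ≤ h₂ ≤ C(k + 1, 2) < 3(quota +
  -- 1) the number of strips is within reach.
  q≤quota : q ≤ quota (3 + k)
  q≤quota = s≤s⁻¹ (*-cancelˡ-< 3 q (suc (quota (3 + k))) (≤-<-trans (≤-trans 3q≤a a≤tri) (quota-max (suc k))))
  result : HVector K (+ k) (+ a) -[1+ p ]
  result with Ladder.rungs L q q≤quota | m≤n⇒∃[o]m+o≡n 3q≤a
  ... | Δ , st | j , refl with fill-many j st a≤tri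
  ...   | Δ′ , st′ = subst (HVector K (+ k) (+ (3 * q + j))) (trans (cong₂ (λ x y → x ℤ.+ + j ℤ.- (y ℤ.+ + j)) (ℤₚ.pos-* 2 q) (ℤₚ.pos-* 3 q)) (eq (+ q) (+ j)))
          (Realize.hvector K st′)
    where
    eq : ∀ x y → + 2 ℤ.* x ℤ.+ y ℤ.- (+ 3 ℤ.* x ℤ.+ y) ≡ ℤ.- x
    eq = ℤ-Solver.solve-∀
sufficient K {_} { -[1+ _ ]} (_ , (() , _) , _)
sufficient K { -[1+ _ ]} (() , _)

theorem1p1 : ∀ {c ℓ} (K : Field c ℓ) (h₁ h₂ h₃ : ℤ) →
    (Σ ℕ λ n → Σ (Complex n) λ Δ →
        IsSimplicialComplex Δ × DimPlusOne Δ 3 × Connected Δ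
        × Homology.Buchsbaum K Δ
        × hvec Δ 3 0 ≡ + 1 × hvec Δ 3 1 ≡ h₁ × hvec Δ 3 2 ≡ h₂ × hvec Δ 3 3 ≡ h₃)
    ⇔
    (+ 0 ℤ.≤ h₁
     × (+ 0 ℤ.≤ h₂ × h₂ ℤ.≤ + ((suc ℤ.∣ h₁ ∣) C 2))
     × (ℤ.- h₂ ℤ.≤ + 3 ℤ.* h₃ × h₃ ℤ.≤ + macaulayUp 2 ℤ.∣ h₂ ∣))
theorem1p1 K h₁ h₂ h₃ = mk⇔ (necessary K) (sufficient K)
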